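{- For every integer $n\ge1$ and every integer $r\ge4$, $$f(n,r,4)=\begin{cases} 3n-\left\lceil\frac{2n}{3}\right\rceil, & r=4,\\[2mm] \frac{2r}{3}\,n, & r\ge6\text{ and }r\equiv0\pmod 3,\\[2mm] \left(r-\left\lceil\frac r3\right\rceil\right)n, & r\equiv2\pmod 3,\\[2mm] (r-1)n-\left\lceil\frac{(m-1)(r-1)n}{r}\right\rceil-\eta(n,r), & r=3m-2\equiv1\pmod 3,\ r\ge7, \end{cases}$$ where in the last line $m\ge3$ is the integer with $r=3m-2$.
   Context: A balanced $r$-partite graph with parts of size $n$ is a simple graph whose vertex set is partitioned into $r$ independent sets, each of size $n$. $f(n,r,4)$ denotes the largest possible minimum degree of a balanced $r$-partite graph with parts of size $n$ that contains no copy of the complete graph $K_4$. For $r=3m-2$ with $m\ge3$, write $n=qr+\rho$ with integers $q\ge 0$ and $0\le\rho<r$. Define $\eta(n,r)=1$ if there is an integer $h$ with $1\le h\le m-2$, $\rho=3h+1$ and $(q+1)\nmid(m-h-1)$; otherwise define $\eta(n,r)=0$. -}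

module Defs where

open import Data.Fin using (Fin)
open import Data.List using (List; length; filter; cartesianProduct; allFin)
open import Data.Nat
open import Data.Nat.Divisibility using (_∤_; _∣?_)
open import Data.Nat.DivMod using (_/_; _%_)
open import Data.Nat.Properties using (_≟_; _≤?_; anyUpTo?)
open import Data.Product using (_×_; _,_; ∃; ∃-syntax; Σ-syntax)
open import Function.Definitions using (Injective)
open import Level using (0ℓ)
open import Relation.Binary using (Rel; Decidable; Symmetric; Irreflexive)
open import Relation.Binary.PropositionalEquality using (_≡_; _≢_)
open import Relation.Nullary using (¬_; Dec; yes; no)
open import Relation.Nullary.Decidable using (map′; _×-dec_; ¬?)

-- Adjacency is decidable so that degrees can be counted constructively.
record SimpleGraph (V : Set) : Set₁ where
  field
    Adj    : Rel V 0ℓ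
    adj?   : Decidable Adj
    sym    : Symmetric Adj
    irrefl : Irreflexive _≡_ Adj

-- The vertex (i , x) is the x-th vertex of the i-th part, so that the r parts
-- partition the vertex set and each has exactly n vertices.
Vertex : (n r : ℕ) → Set
Vertex n r = Fin r × Fin n

vertices : (n r : ℕ) → List (Vertex n r)
vertices n r = cartesianProduct (allFin r) (allFin n)

record BalancedPartiteGraph (n r : ℕ) : Set₁ where
  field
    graph : SimpleGraph (Vertex n r)

  open SimpleGraph graph public

  field
    independent : ∀ i x y → ¬ Adj (i , x) (i , y)

  degree : Vertex n r → ℕ
  degree v = length (filter (adj? v) (vertices n r))

  IsMinDegree : ℕ → Set
  IsMinDegree d = (∀ v → d ≤ degree v) × (∃[ v ] degree v ≡ d)

  ContainsK : ℕ → Set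
  ContainsK t = Σ[ φ ∈ (Fin t → Vertex n r) ]
    Injective _≡_ _≡_ φ × (∀ i j → i ≢ j → Adj (φ i) (φ j))

open BalancedPartiteGraph using (IsMinDegree; ContainsK)

-- f⟨ n , r , t ⟩≡ d says that the maximum f(n,r,t) exists and equals d.
f⟨_,_,_⟩≡_ : (n r t d : ℕ) → Set₁
f⟨ n , r , t ⟩≡ d =
  (Σ[ G ∈ BalancedPartiteGraph n r ] ¬ ContainsK G t × IsMinDegree G d)
  × (∀ (G : BalancedPartiteGraph n r) d′ → ¬ ContainsK G t → IsMinDegree G d′ → d′ ≤ d)

⌈_/_⌉ : (a b : ℕ) .{{_ : NonZero b}} → ℕ
⌈ a / b ⌉ = (a + (b ∸ 1)) / b

-- Here q = n / r and ρ = n % r. The parameter m is meant to satisfy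
-- r = 3m - 2 and m ≥ 3, and then no subtraction below is truncated.
Exceptional : (n r m : ℕ) .{{_ : NonZero r}} → Set
Exceptional n r m =
  ∃[ h ] 1 ≤ h × h ≤ m ∸ 2 × n % r ≡ 3 * h + 1 × (n / r + 1) ∤ (m ∸ h ∸ 1)

exceptional? : (n r m : ℕ) .{{_ : NonZero r}} → Dec (Exceptional n r m)
exceptional? n r m =
  map′ (λ (h , _ , p) → h , p)
       (λ (h , 1≤h , h≤ , p) → h , s≤s h≤ , 1≤h , h≤ , p)
       (anyUpTo? (λ h → 1 ≤? h ×-dec h ≤? m ∸ 2 ×-dec n % r ≟ 3 * h + 1
                        ×-dec ¬? ((n / r + 1) ∣? (m ∸ h ∸ 1)))
                 (suc (m ∸ 2)))

η : (n r m : ℕ) .{{_ : NonZero r}} → ℕ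
η n r m with exceptional? n r m
... | yes _ = 1
... | no  _ = 0

{-# OPTIONS --safe #-}
module Submission where

open import Data.Nat using (ℕ; _+_; _*_; _∸_; _≤_; NonZero)
open import Data.Nat.DivMod using (_/_; _%_)
open import Data.Product using (_×_)
open import Relation.Binary.PropositionalEquality using (_≡_)
open import Defs

-- Lower bounds: for r = 4 the complement of three complete bipartite graphs, otherwise the graph of
-- all pairs of different parts and colours for a suitable 3-colouring of the vertices.
-- Upper bounds: for r = 4, Haxell's argument for independent transversals, and for 3 ∣ r, Turán's.
-- For the other r pass to a saturated K₄-free supergraph of the N = rn vertices.  If non-adjacency is
-- transitive there, the graph is 3-colourable.  If not, it contains a wheel W₅; when 5 δ > 3 N, the
-- vertices missing the hub h all see the whole rim and so are independent, while N(h) is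
-- triangle-free.  Double counting over the rim excludes this: for r ≥ 8 because 8 δ ≤ 5 N, and for
-- r = 5 and r = 7 by also using that a vertex sees nothing in its own part.
-- In a 3-colourable graph a part with two colours forces the third colour class to be large, and the
-- bounds at the parts where the large colours are scarcest give the formula for r ≡ 1, where equality
-- forces the divisibility condition that defines η.

-- Saturation disregards the parts and may join two vertices of one part, so degrees are bounded in
-- the given graph while the wheel and K₄-freeness belong to the supergraph. It is useful because
-- each missing edge `ux` then comes with an edge seen by both its ends, which supplies triangles
-- for averaging: weigh a few vertices, and a vertex that sees more than the average weight sees a
-- whole triangle, a K₄. The threshold 3/5 comes from two weighings of total 10 in which a set
-- avoiding the triangles weighs at most 6; the ratio 5/8 comes from a wheel whose hub weighs 3 and
-- whose rim vertices weigh 1. For r = 3k + 1 and n = rq + 3h + 1 with q positive, equality leaves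
-- no freedom: every part that meets a large colour lies wholly in it or misses it in exactly q + 1
-- vertices. Counting that colour shows that q + 1 divides k - h, the quotient being the number of
-- whole parts. The construction that attains the bound reads this count backwards.

-- Certified linear arithmetic over the natural numbers.

module LinearArithmetic where

  open import Data.Bool.Base using (Bool; true; false; if_then_else_; T)
  open import Data.List.Base using (List; []; _∷_; foldr; map)
  import Data.List.Properties as List
  open import Data.Maybe.Base using (Maybe; just; nothing)
  open import Data.Nat
  open import Data.Nat.Properties
  open import Data.Nat.Tactic.RingSolver using (solve-∀)
  open import Data.Product using (_×_; _,_)
  open import Function using (_∘_)
  open import Relation.Binary.PropositionalEquality
  open import Relation.Nullary using (yes; no)

  infix  8 #_
  infixl 7 _:*_
  infixl 6 _:+_

  data Expr : Set where
    #_      : ℕ → Expr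
    κ       : ℕ → Expr
    _:+_ _:*_ : Expr → Expr → Expr

  -- Variable indices with repetition, kept sorted by `insert`, so that equal monomials are equal
  -- lists.
  Mono = List ℕ
  Poly = List (Mono × ℕ)

  insert : ℕ → Mono → Mono
  insert i [] = i ∷ []
  insert i (j ∷ m) = if i ≤ᵇ j then i ∷ j ∷ m else j ∷ insert i m

  addT : Mono → ℕ → Poly → Poly
  addT m c [] = (m , c) ∷ []
  addT m c ((m′ , c′) ∷ p) with List.≡-dec _≟_ m m′
  ... | yes _ = (m′ , c + c′) ∷ p
  ... | no  _ = (m′ , c′) ∷ addT m c p

  addP : Poly → Poly → Poly
  addP p q = foldr (λ (m , c) → addT m c) q p

  mulT : Mono → ℕ → Poly → Poly
  mulT m c p = map (λ (m′ , c′) → foldr insert m′ m , c * c′) p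

  mulP : Poly → Poly → Poly
  mulP [] q = []
  mulP ((m , c) ∷ p) q = addP (mulT m c q) (mulP p q)

  norm : Expr → Poly
  norm (# i) = (i ∷ [] , 1) ∷ []
  norm (κ c)  = ([] , c) ∷ []
  norm (e :+ f)  = addP (norm e) (norm f)
  norm (e :* f)  = mulP (norm e) (norm f)

  -- Subtraction that fails instead of truncating. Iterated by `leqP` it tests domination
  -- coefficient by coefficient, which implies the inequality because all variables are natural
  -- numbers.
  subT : Mono → ℕ → Poly → Maybe Poly
  subT m zero p = just p
  subT m c [] = nothing
  subT m c ((m′ , c′) ∷ p) with List.≡-dec _≟_ m m′
  ... | yes _ = if c ≤ᵇ c′ then just ((m′ , c′ ∸ c) ∷ p) else nothing
  ... | no  _ with subT m c p
  ...   | just p′ = just ((m′ , c′) ∷ p′)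
  ...   | nothing = nothing

  leqP : Poly → Poly → Bool
  leqP [] q = true
  leqP ((m , c) ∷ p) q with subT m c q
  ... | just q′ = leqP p q′
  ... | nothing = false

  module _ (ρ : List ℕ) where

    look : List ℕ → ℕ → ℕ
    look []      _       = 0
    look (x ∷ _) zero    = x
    look (_ ∷ ρ) (suc i) = look ρ i

    eval : Expr → ℕ
    eval (# i) = look ρ i
    eval (κ c)  = c
    eval (e :+ f)  = eval e + eval f
    eval (e :* f)  = eval e * eval f

    evalM : Mono → ℕ
    evalM = foldr (λ i x → look ρ i * x) 1

    evalP : Poly → ℕ
    evalP = foldr (λ (m , c) x → c * evalM m + x) 0

    private
      swap* : ∀ a b c → a * (b * c) ≡ b * (a * c)
      swap* = solve-∀

    insert-sound : ∀ i m → evalM (insert i m) ≡ look ρ i * evalM m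
    insert-sound i [] = refl
    insert-sound i (j ∷ m) with i ≤ᵇ j
    ... | true = refl
    ... | false rewrite insert-sound i m = swap* (look ρ j) (look ρ i) (evalM m)

    mulM-sound : ∀ m m′ → evalM (foldr insert m′ m) ≡ evalM m * evalM m′
    mulM-sound [] m′ = sym (+-identityʳ _)
    mulM-sound (i ∷ m) m′ rewrite insert-sound i (foldr insert m′ m) | mulM-sound m m′ =
      sym (*-assoc (look ρ i) _ _)

    addT-sound : ∀ m c p → evalP (addT m c p) ≡ c * evalM m + evalP p
    addT-sound m c [] = refl
    addT-sound m c ((m′ , c′) ∷ p) with List.≡-dec _≟_ m m′
    ... | yes refl = lemma c c′ (evalM m) (evalP p)
      where lemma : ∀ c c′ x y → (c + c′) * x + y ≡ c * x + (c′ * x + y)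
            lemma = solve-∀
    ... | no _ rewrite addT-sound m c p = lemma (c * evalM m) (c′ * evalM m′) (evalP p)
      where lemma : ∀ x y z → y + (x + z) ≡ x + (y + z)
            lemma = solve-∀

    addP-sound : ∀ p q → evalP (addP p q) ≡ evalP p + evalP q
    addP-sound [] q = refl
    addP-sound ((m , c) ∷ p) q rewrite addT-sound m c (addP p q) | addP-sound p q =
      sym (+-assoc (c * evalM m) _ _)

    mulT-sound : ∀ m c p → evalP (mulT m c p) ≡ c * evalM m * evalP p
    mulT-sound m c [] = sym (*-zeroʳ (c * evalM m))
    mulT-sound m c ((m′ , c′) ∷ p) rewrite mulM-sound m m′ | mulT-sound m c p =
      lemma c c′ (evalM m) (evalM m′) (evalP p)
      where lemma : ∀ c c′ x y z → c * c′ * (x * y) + c * x * z ≡ c * x * (c′ * y + z)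
            lemma = solve-∀

    mulP-sound : ∀ p q → evalP (mulP p q) ≡ evalP p * evalP q
    mulP-sound [] q = refl
    mulP-sound ((m , c) ∷ p) q
      rewrite addP-sound (mulT m c q) (mulP p q) | mulT-sound m c q | mulP-sound p q =
      sym (*-distribʳ-+ (evalP q) (c * evalM m) (evalP p))

    norm-sound : ∀ e → evalP (norm e) ≡ eval e
    norm-sound (# i) = trans (+-identityʳ _) (trans (+-identityʳ _) (*-identityʳ _))
    norm-sound (κ c)  = trans (+-identityʳ _) (*-identityʳ c)
    norm-sound (e :+ f) rewrite addP-sound (norm e) (norm f) = cong₂ _+_ (norm-sound e) (norm-sound f)
    norm-sound (e :* f) rewrite mulP-sound (norm e) (norm f) = cong₂ _*_ (norm-sound e) (norm-sound f)

    subT-sound : ∀ m c p {q} → subT m c p ≡ just q → evalP p ≡ c * evalM m + evalP q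
    subT-sound m zero p refl = refl
    subT-sound m (suc c) ((m′ , c′) ∷ p) eq with List.≡-dec _≟_ m m′
    subT-sound m (suc c) ((m′ , c′) ∷ p) eq | yes refl with c <ᵇ c′ | <ᵇ⇒< c c′
    subT-sound m (suc c) ((m′ , c′) ∷ p) refl | yes refl | true | c<c′ = begin
      c′ * evalM m + evalP p                                  ≡⟨ cong (λ x → x * evalM m + evalP p) (sym (m+[n∸m]≡n (c<c′ _))) ⟩
      (suc c + (c′ ∸ suc c)) * evalM m + evalP p              ≡⟨ lemma (suc c) (c′ ∸ suc c) (evalM m) (evalP p) ⟩
      suc c * evalM m + ((c′ ∸ suc c) * evalM m + evalP p)    ∎
      where
      open ≡-Reasoning
      lemma : ∀ c c′ x y → (c + c′) * x + y ≡ c * x + (c′ * x + y)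
      lemma = solve-∀
    subT-sound m (suc c) ((m′ , c′) ∷ p) eq | no _ with subT m (suc c) p in eq′
    subT-sound m (suc c) ((m′ , c′) ∷ p) refl | no _ | just p′
      rewrite subT-sound m (suc c) p eq′ = lemma (suc c * evalM m) (c′ * evalM m′) (evalP p′)
      where lemma : ∀ x y z → y + (x + z) ≡ x + (y + z)
            lemma = solve-∀

    leqP-sound : ∀ p q → leqP p q ≡ true → evalP p ≤ evalP q
    leqP-sound [] q _ = z≤n
    leqP-sound ((m , c) ∷ p) q ok with subT m c q in eq
    ... | just q′ rewrite subT-sound m c q eq = +-monoʳ-≤ (c * evalM m) (leqP-sound p q′ ok)

    leq-sound : ∀ e f → leqP (norm e) (norm f) ≡ true → eval e ≤ eval f
    leq-sound e f ok = subst₂ _≤_ (norm-sound e) (norm-sound f) (leqP-sound (norm e) (norm f) ok)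

  infix  5 _≼_
  infix  4 _·_by_
  infixl 3 _⊹_

  record Inequality : Set where
    constructor _≼_
    field left right : Expr

  Holds : List ℕ → Inequality → Set
  Holds ρ (a ≼ b) = eval ρ a ≤ eval ρ b

  -- The multipliers of a Farkas certificate, each together with the proved inequality that it
  -- scales.
  data Facts (ρ : List ℕ) : Set where
    ∅      : Facts ρ
    _·_by_  : ℕ → (i : Inequality) → Holds ρ i → Facts ρ
    _⊹_    : Facts ρ → Facts ρ → Facts ρ

  module _ {ρ : List ℕ} where

    lhs rhs : Facts ρ → Expr
    lhs ∅               = κ 0
    lhs (c · a ≼ _ by _) = κ c :* a
    lhs (fs ⊹ gs)       = lhs fs :+ lhs gs
    rhs ∅               = κ 0
    rhs (c · _ ≼ b by _) = κ c :* b
    rhs (fs ⊹ gs)       = rhs fs :+ rhs gs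

    lhs≤rhs : ∀ fs → eval ρ (lhs fs) ≤ eval ρ (rhs fs)
    lhs≤rhs ∅               = z≤n
    lhs≤rhs (c · _ ≼ _ by h) = *-monoʳ-≤ c h
    lhs≤rhs (fs ⊹ gs)       = +-mono-≤ (lhs≤rhs fs) (lhs≤rhs gs)

  Certified : {ρ : List ℕ} → ℕ → Inequality → Facts ρ → Bool
  Certified k (p ≼ q) fs = leqP (norm (κ (suc k) :* p :+ rhs fs)) (norm (κ k :+ κ (suc k) :* q :+ lhs fs))

  abstract
    -- lin ρ k (p ≼ q) (c₁ · a₁ ≼ b₁ by h₁ ⊹ … ⊹ cₘ · aₘ ≼ bₘ by hₘ) proves p ≤ q when
    -- (k + 1) (q - p) + k - (c₁ (b₁ - a₁) + … + cₘ (bₘ - aₘ)) has nonnegative coefficients;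
    -- the atom # i stands for the i-th entry of ρ.
    lin : ∀ ρ k (i : Inequality) (fs : Facts ρ) {_ : T (Certified k i fs)} → Holds ρ i
    -- The allowance `k` is less than the factor `k + 1`, so integrality absorbs it; inequalities
    -- that need division and rounding are proved in this way.
    lin ρ k (p ≼ q) fs {ok} = s≤s⁻¹ (*-cancelˡ-< (suc k) (eval ρ p) (suc (eval ρ q)) (begin-strict
      suc k * eval ρ p          ≤⟨ +-cancelʳ-≤ (eval ρ (rhs fs)) _ _
                                     (≤-trans (leq-sound ρ (κ (suc k) :* p :+ rhs fs) (κ k :+ κ (suc k) :* q :+ lhs fs) (T⇒≡ ok)) (+-monoʳ-≤ (k + suc k * eval ρ q) (lhs≤rhs fs))) ⟩
      k + suc k * eval ρ q      <⟨ ≤-refl ⟩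
      suc k + suc k * eval ρ q  ≡⟨ *-suc (suc k) (eval ρ q) ⟨
      suc k * suc (eval ρ q)    ∎))
      where
      open ≤-Reasoning
      T⇒≡ : ∀ {b} → T b → b ≡ true
      T⇒≡ {true} _ = refl

  absurd : ∀ {ℓ} {A : Set ℓ} → 1 ≤ 0 → A
  absurd ()

  ≡⇒≤ : ∀ {a b : ℕ} → a ≡ b → a ≤ b
  ≡⇒≤ = ≤-reflexive

  ≡⇒≥ : ∀ {a b : ℕ} → a ≡ b → b ≤ a
  ≡⇒≥ = ≤-reflexive ∘ sym

  scaleʳ : ∀ {a b} c → a ≤ b → a * c ≤ b * c
  scaleʳ c = *-monoˡ-≤ c

  scaleˡ : ∀ {a b} c → a ≤ b → c * a ≤ c * b
  scaleˡ c = *-monoʳ-≤ c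

-- Sums over vertices and the averaging argument.

module Sums where

  open import Data.Bool.Base using (Bool; true; false; if_then_else_; _∧_; T)
  import Data.Bool.ListAction as Bool
  open import Data.Empty using (⊥; ⊥-elim)
  open import Data.Fin.Base using (Fin; zero; suc)
  open import Data.Fin.Properties using (any?)
  import Data.Fin.Properties as Fin
  open import Data.List.Base using (List; []; _∷_; length; filter; cartesianProduct; allFin; tabulate; map; _++_)
  import Data.List.Base as List
  import Data.List.Properties as List
  open import Data.List.Relation.Unary.All using (All; []; _∷_)
  open import Data.List.Relation.Unary.Any using (Any; here; there)
  open import Data.Nat
  open import Data.Nat.Properties
  open import Data.Product using (_×_; _,_; ∃; ∃-syntax; proj₁)
  open import Data.Vec.Base as Vec using (Vec; []; _∷_; lookup)
  open import Function using (_∘_; id)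
  open import Relation.Binary.PropositionalEquality
  open import Relation.Nullary using (Dec; yes; no; does)
  open import Relation.Nullary.Decidable using (map′)
  open import Relation.Unary using (Pred; Decidable)
  open LinearArithmetic

  open import Algebra.Properties.CommutativeMonoid.Sum +-0-commutativeMonoid public
    using (sum; ∑-distrib-+; ∑-comm; sum-cong-≗)

  ⟦_⟧ : ∀ {ℓ} {P : Set ℓ} → Dec P → ℕ
  ⟦ d ⟧ = if does d then 1 else 0

  module _ {ℓ} {P : Set ℓ} where

    ⟦⟧-yes : (d : Dec P) → P → ⟦ d ⟧ ≡ 1
    ⟦⟧-yes (yes _) _ = refl
    ⟦⟧-yes (no ¬p) p = ⊥-elim (¬p p)

    ⟦⟧≤1 : (d : Dec P) → ⟦ d ⟧ ≤ 1
    ⟦⟧≤1 (yes _) = ≤-refl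
    ⟦⟧≤1 (no _)  = z≤n

    ⟦⟧-pos : (d : Dec P) → 0 < ⟦ d ⟧ → P
    ⟦⟧-pos (yes p) _ = p

  ⟦⟧-mono : ∀ {ℓ ℓ′} {P : Set ℓ} {Q : Set ℓ′} (d : Dec P) (e : Dec Q) → (P → Q) → ⟦ d ⟧ ≤ ⟦ e ⟧
  ⟦⟧-mono (no _)  e f = z≤n
  ⟦⟧-mono (yes p) e f = ≤-reflexive (sym (⟦⟧-yes e (f p)))

  sum-mono : ∀ {n} {f g : Fin n → ℕ} → (∀ i → f i ≤ g i) → sum f ≤ sum g
  sum-mono {zero}  h = z≤n
  sum-mono {suc n} h = +-mono-≤ (h zero) (sum-mono (h ∘ suc))

  sum-*ˡ : ∀ {n} c (f : Fin n → ℕ) → sum (λ i → c * f i) ≡ c * sum f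
  sum-*ˡ {zero}  c f = sym (*-zeroʳ c)
  sum-*ˡ {suc n} c f = trans (cong (c * f zero +_) (sum-*ˡ c (f ∘ suc))) (sym (*-distribˡ-+ c (f zero) _))

  sum-const : ∀ n c → sum {n} (λ _ → c) ≡ n * c
  sum-const zero    c = refl
  sum-const (suc n) c = cong (c +_) (sum-const n c)

  sum-<⇒∃ : ∀ {n} {f g : Fin n → ℕ} → sum f < sum g → ∃[ i ] f i < g i
  sum-<⇒∃ {suc n} {f} {g} h with f zero <? g zero
  ... | yes p = zero , p
  ... | no ¬p with sum-<⇒∃ {n} {f ∘ suc} {g ∘ suc} (+-cancelˡ-< (f zero) _ _ (<-≤-trans h (+-monoˡ-≤ _ (≮⇒≥ ¬p))))
  ...   | i , p = suc i , p

  sum-single : ∀ {n} (j : Fin n) (f : Fin n → ℕ) → sum (λ i → ⟦ i Fin.≟ j ⟧ * f i) ≡ f j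
  sum-single {suc n} zero f = trans (cong (f zero + 0 +_) (trans (sum-const n 0) (*-zeroʳ n)))
    (trans (+-identityʳ _) (+-identityʳ (f zero)))
  sum-single {suc n} (suc j) f = sum-single j (f ∘ suc)

  module _ {n r : ℕ} where

    V = Vertex n r

    ∑ : (V → ℕ) → ℕ
    ∑ f = sum (λ i → sum (λ x → f (i , x)))

    ∑-mono : {f g : V → ℕ} → (∀ v → f v ≤ g v) → ∑ f ≤ ∑ g
    ∑-mono h = sum-mono (λ i → sum-mono (λ x → h (i , x)))

    ∑-+ : ∀ f g → ∑ (λ v → f v + g v) ≡ ∑ f + ∑ g
    ∑-+ f g = trans (sum-cong-≗ (λ i → ∑-distrib-+ (λ x → f (i , x)) (λ x → g (i , x))))
                    (∑-distrib-+ (λ i → sum (λ x → f (i , x))) (λ i → sum (λ x → g (i , x))))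

    ∑-* : ∀ c f → ∑ (λ v → c * f v) ≡ c * ∑ f
    ∑-* c f = trans (sum-cong-≗ (λ i → sum-*ˡ c (λ x → f (i , x)))) (sum-*ˡ c (λ i → sum (λ x → f (i , x))))

    ∑-const : ∀ c → ∑ (λ _ → c) ≡ r * n * c
    ∑-const c = trans (sum-cong-≗ {r} (λ i → sum-const n c)) (trans (sum-const r (n * c)) (sym (*-assoc r n c)))

    ∑-part : ∀ j (f : V → ℕ) → ∑ (λ v → ⟦ proj₁ v Fin.≟ j ⟧ * f v) ≡ sum (λ x → f (j , x))
    ∑-part j f = trans (sum-cong-≗ (λ i → sum-*ˡ ⟦ i Fin.≟ j ⟧ (λ x → f (i , x)))) (sum-single j (λ i → sum (λ x → f (i , x))))

    ∑-<⇒∃ : {f g : V → ℕ} → ∑ f < ∑ g → ∃[ v ] f v < g v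
    ∑-<⇒∃ h with sum-<⇒∃ h
    ... | i , h′ with sum-<⇒∃ h′
    ...   | x , p = (i , x) , p

    ∃? : ∀ {ℓ} {P : V → Set ℓ} → (∀ v → Dec (P v)) → Dec (∃ P)
    ∃? P? = map′ (λ (i , x , p) → (i , x) , p) (λ ((i , x) , p) → i , x , p) (any? (λ i → any? (λ x → P? (i , x))))

  private
    length-filter-++ : ∀ {a p} {A : Set a} {P : Pred A p} (P? : Decidable P) xs ys →
      length (filter P? (xs ++ ys)) ≡ length (filter P? xs) + length (filter P? ys)
    length-filter-++ P? xs ys = trans (cong length (List.filter-++ P? xs ys)) (List.length-++ (filter P? xs))

    length-filter-tabulate : ∀ {a p n} {A : Set a} {P : Pred A p} (P? : Decidable P) (f : Fin n → A) →
      length (filter P? (tabulate f)) ≡ sum (λ i → ⟦ P? (f i) ⟧)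
    length-filter-tabulate {n = zero} P? f = refl
    length-filter-tabulate {n = suc n} P? f with does (P? (f zero))
    ... | true  = cong suc (length-filter-tabulate P? (f ∘ suc))
    ... | false = length-filter-tabulate P? (f ∘ suc)

    length-filter-product : ∀ {p n r} {A : Set} {P : Pred (A × Fin n) p} (P? : Decidable P) (f : Fin r → A) →
      length (filter P? (cartesianProduct (tabulate f) (allFin n))) ≡ sum (λ i → sum (λ x → ⟦ P? (f i , x) ⟧))
    length-filter-product {r = zero} P? f = refl
    length-filter-product {n = n} {r = suc r} P? f = trans
      (length-filter-++ P? (map (f zero ,_) (allFin n)) _)
      (cong₂ _+_
        (trans (cong (length ∘ filter P?) (List.map-tabulate id (f zero ,_)))
               (length-filter-tabulate P? (λ x → f zero , x)))
        (length-filter-product P? (f ∘ suc)))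

  degree-∑ : ∀ {n r} (G : BalancedPartiteGraph n r) v →
             BalancedPartiteGraph.degree G v ≡ ∑ (λ z → ⟦ BalancedPartiteGraph.adj? G v z ⟧)
  degree-∑ {n} {r} G v = length-filter-product {n = n} {r = r} (BalancedPartiteGraph.adj? G v) id

  K₄-free : ∀ {V} → SimpleGraph V → Set
  K₄-free G = ∀ {a b c d} → Adj a b → Adj a c → Adj a d → Adj b c → Adj b d → Adj c d → ⊥
    where open SimpleGraph G

  -- Exhaustion over all truth assignments, evaluated during type checking wherever a concrete
  -- predicate is supplied.
  ∀ᵇ : ∀ m → (Vec Bool m → Bool) → Bool
  ∀ᵇ zero    p = p []
  ∀ᵇ (suc m) p = ∀ᵇ m (λ b → p (true ∷ b)) ∧ ∀ᵇ m (λ b → p (false ∷ b))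

  ∀ᵇ-sound : ∀ m p → T (∀ᵇ m p) → ∀ b → T (p b)
  ∀ᵇ-sound zero p h [] = h
  ∀ᵇ-sound (suc m) p h (c ∷ b) with ∀ᵇ m (λ b → p (true ∷ b)) in eq₁ | ∀ᵇ m (λ b → p (false ∷ b)) in eq₂
  ∀ᵇ-sound (suc m) p h (true ∷ b)  | true | true = ∀ᵇ-sound m (λ b → p (true ∷ b)) (subst T (sym eq₁) _) b
  ∀ᵇ-sound (suc m) p h (false ∷ b) | true | true = ∀ᵇ-sound m (λ b → p (false ∷ b)) (subst T (sym eq₂) _) b

  weight : ∀ {m} → Vec ℕ m → Vec Bool m → ℕ
  weight []      []          = 0
  weight (w ∷ ws) (true ∷ b)  = w + weight ws b
  weight (w ∷ ws) (false ∷ b) = weight ws b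

  -- Every set of indices of weight more than k contains a member of F.
  Unavoidable : ∀ {m} → Vec ℕ m → List (List (Fin m)) → ℕ → Bool
  Unavoidable {m} w F k = ∀ᵇ m (λ b → if weight w b ≤ᵇ k then true else Bool.any (Bool.all (lookup b)) F)

  private
    all⇒All : ∀ {m ℓ} {P : Fin m → Set ℓ} (b : Vec Bool m) → (∀ i → T (lookup b i) → P i) →
              ∀ S → T (Bool.all (lookup b) S) → All P S
    all⇒All b f [] _ = []
    all⇒All b f (i ∷ S) h with lookup b i in eq
    ... | true = f i (subst T (sym eq) _) ∷ all⇒All b f S h

    any⇒Any : ∀ {m ℓ} {P : Fin m → Set ℓ} (b : Vec Bool m) → (∀ i → T (lookup b i) → P i) →
              ∀ F → T (Bool.any (Bool.all (lookup b)) F) → Any (All P) F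
    any⇒Any b f (S ∷ F) h with Bool.all (lookup b) S in eq
    ... | true  = here (all⇒All b f S (subst T (sym eq) _))
    ... | false = there (any⇒Any b f F h)

  unavoidable : ∀ {m ℓ} {P : Fin m → Set ℓ} (w : Vec ℕ m) F k → T (Unavoidable w F k) →
    (b : Vec Bool m) → (∀ i → T (lookup b i) → P i) → k < weight w b → Any (All P) F
  unavoidable w F k u b f h with ∀ᵇ-sound _ (λ b → if weight w b ≤ᵇ k then true else Bool.any (Bool.all (lookup b)) F) u b
  ... | p with weight w b ≤ᵇ k in eq
  ...   | true  = ⊥-elim (<⇒≱ h (≤ᵇ⇒≤ _ _ (subst T (sym eq) _)))
  ...   | false = any⇒Any b f F p

  module Counting {n r : ℕ} (G : SimpleGraph (Vertex n r)) where
    open SimpleGraph G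

    deg : V → ℕ
    deg v = ∑ (λ z → ⟦ adj? v z ⟧)

    private
      seen : ∀ {m} → Vec V m → V → Vec Bool m
      seen L z = Vec.map (λ l → does (adj? l z)) L

      seen-sound : ∀ {m} (L : Vec V m) z i → T (lookup (seen L z) i) → Adj (lookup L i) z
      seen-sound (l ∷ L) z zero h with adj? l z
      ... | yes p = p
      seen-sound (l ∷ L) z (suc i) h = seen-sound L z i h

      weigh : ∀ {m} → Vec ℕ m → Vec V m → V → ℕ
      weigh w L z = weight w (seen L z)

      -- Double counting: an entry of weight `w` contributes `w` at each of its neighbours, of which
      -- there are at least `δ`.
      ∑-weigh : ∀ {m} (w : Vec ℕ m) (L : Vec V m) {δ} → (∀ v → δ ≤ deg v) →
                Vec.sum w * δ ≤ ∑ (weigh w L)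
      ∑-weigh [] [] h = z≤n
      ∑-weigh (w ∷ ws) (l ∷ L) {δ} h = begin
        (w + Vec.sum ws) * δ                                      ≡⟨ *-distribʳ-+ δ w _ ⟩
        w * δ + Vec.sum ws * δ                                    ≤⟨ +-mono-≤ (*-monoʳ-≤ w (h l)) (∑-weigh ws L h) ⟩
        w * deg l + ∑ (weigh ws L)                                ≡⟨ cong (_+ ∑ (weigh ws L)) (∑-* w (λ z → ⟦ adj? l z ⟧)) ⟨
        ∑ (λ z → w * ⟦ adj? l z ⟧) + ∑ (weigh ws L)               ≡⟨ ∑-+ (λ z → w * ⟦ adj? l z ⟧) (weigh ws L) ⟨
        ∑ (λ z → w * ⟦ adj? l z ⟧ + weigh ws L z)                 ≤⟨ ∑-mono step ⟩
        ∑ (weigh (w ∷ ws) (l ∷ L))                                ∎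
        where
        open ≤-Reasoning
        step : ∀ z → w * ⟦ adj? l z ⟧ + weigh ws L z ≤ weigh (w ∷ ws) (l ∷ L) z
        step z with does (adj? l z)
        ... | true  = +-monoˡ-≤ _ (≤-reflexive (*-identityʳ w))
        ... | false = +-monoˡ-≤ _ (≤-reflexive (*-zeroʳ w))

    abstract
      -- Some z has weight more than k in L on average, hence sees every entry indexed by some member of F.
      heavy-vertex : ∀ {m ℓ} {R : Set ℓ} (w : Vec ℕ m) (L : Vec V m) F k s {δ} → (∀ v → δ ≤ deg v) →
        {_ : T (Unavoidable w F k)} {_ : T (s ≡ᵇ Vec.sum w)} → k * (r * n) < s * δ →
        (∀ z → All (λ S → All (λ i → Adj (lookup L i) z) S → R) F) → R
      heavy-vertex {R = R} w L F k s {δ} h {u} {e} lt f = finish (∑-<⇒∃ {n} {r} {λ _ → k} {weigh w L}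
        (≤-<-trans (≤-reflexive (trans (∑-const {n} {r} k) (*-comm (r * n) k)))
          (<-≤-trans lt (≤-trans (≤-reflexive (cong (_* δ) (≡ᵇ⇒≡ s (Vec.sum w) e))) (∑-weigh w L h)))))
        where
        match : ∀ {z F} → All (λ S → All (λ i → Adj (lookup L i) z) S → R) F →
                Any (All (λ i → Adj (lookup L i) z)) F → R
        match (g ∷ gs) (here p)  = g p
        match (g ∷ gs) (there a) = match gs a

        finish : (∃[ z ] k < weigh w L z) → R
        finish (z , p) = match (f z) (unavoidable w F k u (seen L z) (seen-sound L z) p)

-- Saturated K₄-free graphs: 3-colourable, or a wheel with an independent set of vertices missing
-- its hub.

module Saturation where

  open import Data.Empty using (⊥; ⊥-elim)
  open import Data.Fin.Base using (Fin)
  open import Data.Fin.Patterns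
  import Data.Fin.Properties as Fin
  open import Data.List.Base using (List; []; _∷_; cartesianProduct)
  open import Data.List.Membership.Propositional using (_∈_)
  open import Data.List.Membership.Propositional.Properties using (∈-allFin; ∈-cartesianProduct⁺)
  open import Data.List.Relation.Unary.All using (All; []; _∷_)
  open import Data.List.Relation.Unary.Any using (here; there)
  open import Data.Nat
  open import Data.Nat.Properties using (≮⇒≥)
  open import Data.Product using (_×_; _,_; ∃; ∃-syntax; Σ-syntax)
  import Data.Product.Properties as Prod
  open import Data.Sum using (_⊎_; inj₁; inj₂; [_,_]′)
  open import Data.Vec.Base using (Vec; []; _∷_; lookup)
  open import Function using (_∘_; id)
  open import Relation.Binary.PropositionalEquality using (_≡_; _≢_; refl; trans)
  import Relation.Binary.PropositionalEquality as ≡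
  open import Relation.Nullary using (¬_; Dec; yes; no)
  open import Relation.Nullary.Decidable using (_×-dec_; _⊎-dec_; ¬?; decidable-stable)
  open LinearArithmetic
  open Sums

  -- The edge `ab` is what would complete a K₄ if `ux` were added.
  Joined : ∀ {V} → SimpleGraph V → V → V → Set
  Joined G u x = ∃[ a ] ∃[ b ] Adj a b × Adj u a × Adj u b × Adj x a × Adj x b
    where open SimpleGraph G

  Saturated : ∀ {V} → SimpleGraph V → Set
  Saturated G = ∀ {u x} → u ≢ x → ¬ Adj u x → Joined G u x
    where open SimpleGraph G

  _⊆ᵍ_ : ∀ {V} → SimpleGraph V → SimpleGraph V → Set
  G ⊆ᵍ H = ∀ {u v} → SimpleGraph.Adj G u v → SimpleGraph.Adj H u v

  module _ {n r : ℕ} where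

    _≟ᵛ_ : (u v : Vertex n r) → Dec (u ≡ v)
    _≟ᵛ_ = Prod.≡-dec Fin._≟_ Fin._≟_

    module _ (G : SimpleGraph (Vertex n r)) where
      open SimpleGraph G

      joined? : ∀ u x → Dec (Joined G u x)
      joined? u x = ∃? λ a → ∃? λ b →
        adj? a b ×-dec adj? u a ×-dec adj? u b ×-dec adj? x a ×-dec adj? x b

      module _ {u x : Vertex n r} (u≢x : u ≢ x) where

        End : Vertex n r → Vertex n r → Set
        End a b = (a ≡ u × b ≡ x) ⊎ (a ≡ x × b ≡ u)

        addEdge : SimpleGraph (Vertex n r)
        addEdge = record
          { Adj    = λ a b → Adj a b ⊎ End a b
          ; adj?   = λ a b → adj? a b ⊎-dec (((a ≟ᵛ u) ×-dec (b ≟ᵛ x)) ⊎-dec ((a ≟ᵛ x) ×-dec (b ≟ᵛ u)))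
          ; sym    = λ { (inj₁ p) → inj₁ (sym p)
                       ; (inj₂ (inj₁ (p , q))) → inj₂ (inj₂ (q , p))
                       ; (inj₂ (inj₂ (p , q))) → inj₂ (inj₁ (q , p)) }
          ; irrefl = λ { refl (inj₁ p) → irrefl refl p
                       ; refl (inj₂ (inj₁ (p , q))) → u≢x (trans (≡.sym p) q)
                       ; refl (inj₂ (inj₂ (p , q))) → u≢x (trans (≡.sym q) p) }
          }

        open SimpleGraph addEdge using () renaming (Adj to Adj⁺; sym to sym⁺; irrefl to irrefl⁺)

        private
          -- The vertex `c` sees both ends of the new edge, hence is neither of them, so no edge at
          -- `c` can be the new one.
          old : ∀ {a b c d} → End a b → Adj⁺ c a → Adj⁺ c b → Adj⁺ c d → Adj c d
          old e ca cb (inj₁ p) = p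
          old (inj₁ (refl , refl)) ca cb (inj₂ (inj₁ (refl , _))) = ⊥-elim (irrefl⁺ refl ca)
          old (inj₁ (refl , refl)) ca cb (inj₂ (inj₂ (refl , _))) = ⊥-elim (irrefl⁺ refl cb)
          old (inj₂ (refl , refl)) ca cb (inj₂ (inj₁ (refl , _))) = ⊥-elim (irrefl⁺ refl cb)
          old (inj₂ (refl , refl)) ca cb (inj₂ (inj₂ (refl , _))) = ⊥-elim (irrefl⁺ refl ca)

          end⇒joined : ∀ {a b c d} → End a b → Adj⁺ a c → Adj⁺ a d → Adj⁺ b c → Adj⁺ b d → Adj⁺ c d → Joined G u x
          end⇒joined {a} {b} {c} {d} e ac ad bc bd cd with old e (sym⁺ ac) (sym⁺ bc) cd
            | sym (old e (sym⁺ ac) (sym⁺ bc) (sym⁺ ac)) | sym (old e (sym⁺ ad) (sym⁺ bd) (sym⁺ ad))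
            | sym (old e (sym⁺ ac) (sym⁺ bc) (sym⁺ bc)) | sym (old e (sym⁺ ad) (sym⁺ bd) (sym⁺ bd))
          end⇒joined (inj₁ (refl , refl)) _ _ _ _ _ | cd | ac | ad | bc | bd = _ , _ , cd , ac , ad , bc , bd
          end⇒joined (inj₂ (refl , refl)) _ _ _ _ _ | cd | ac | ad | bc | bd = _ , _ , cd , bc , bd , ac , ad

        addEdge-K₄-free : K₄-free G → ¬ Joined G u x → K₄-free addEdge
        addEdge-K₄-free k ¬j = go
          where
          go : K₄-free addEdge
          -- Each case relabels the four vertices so that the new edge becomes the first pair.
          go (inj₂ e) ac ad bc bd cd = ¬j (end⇒joined e ac ad bc bd cd)
          go ab (inj₂ e) ad bc bd cd = ¬j (end⇒joined e ab ad (sym⁺ bc) cd bd)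
          go ab ac (inj₂ e) bc bd cd = ¬j (end⇒joined e ab ac (sym⁺ bd) (sym⁺ cd) bc)
          go ab ac ad (inj₂ e) bd cd = ¬j (end⇒joined e (sym⁺ ab) bd (sym⁺ ac) cd ad)
          go ab ac ad bc (inj₂ e) cd = ¬j (end⇒joined e (sym⁺ ab) bc (sym⁺ ad) (sym⁺ cd) ac)
          go ab ac ad bc bd (inj₂ e) = ¬j (end⇒joined e (sym⁺ ac) (sym⁺ bc) (sym⁺ ad) (sym⁺ bd) ab)
          go (inj₁ ab) (inj₁ ac) (inj₁ ad) (inj₁ bc) (inj₁ bd) (inj₁ cd) = k ab ac ad bc bd cd

    private
      Handled : SimpleGraph (Vertex n r) → Vertex n r × Vertex n r → Set
      Handled G (u , x) = u ≢ x → SimpleGraph.Adj G u x ⊎ Joined G u x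

      handled-mono : ∀ {G H} → G ⊆ᵍ H → ∀ p → Handled G p → Handled H p
      handled-mono G⊆H p h u≢x with h u≢x
      ... | inj₁ a = inj₁ (G⊆H a)
      ... | inj₂ (a , b , ab , ua , ub , xa , xb) =
        inj₂ (a , b , G⊆H ab , G⊆H ua , G⊆H ub , G⊆H xa , G⊆H xb)

      -- One pass over the pairs suffices: a pair that is adjacent or has a common edge stays so
      -- when further edges are added.
      handle : ∀ (L : List (Vertex n r × Vertex n r)) G → K₄-free G →
        Σ[ H ∈ SimpleGraph (Vertex n r) ] (G ⊆ᵍ H) × K₄-free H × (∀ {p} → p ∈ L → Handled H p)
      handle [] G k = G , id , k , λ ()
      handle ((u , x) ∷ L) G k with u ≟ᵛ x | joined? G u x
      ... | yes u≡x | _ =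
        let (H , G⊆H , k′ , h) = handle L G k in
        H , G⊆H , k′ , λ { (here refl) u≢x → ⊥-elim (u≢x u≡x) ; (there i) → h i }
      ... | no _ | yes j =
        let (H , G⊆H , k′ , h) = handle L G k in
        H , (λ {_} {_} → G⊆H) , k′ , λ { (here refl) → handled-mono {G} {H} G⊆H (u , x) (λ _ → inj₂ j) ; (there i) → h i }
      ... | no u≢x | no ¬j =
        let (H , G⊆H , k′ , h) = handle L (addEdge G u≢x) (addEdge-K₄-free G u≢x k ¬j) in
        H , (λ {_} {_} e → G⊆H (inj₁ e)) , k′ ,
        λ { (here refl) _ → inj₁ (G⊆H (inj₂ (inj₁ (refl , refl)))) ; (there i) → h i }

    saturate : ∀ G → K₄-free G → Σ[ H ∈ SimpleGraph (Vertex n r) ] (G ⊆ᵍ H) × K₄-free H × Saturated H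
    saturate G k =
      let vs = vertices n r
          (H , G⊆H , k′ , h) = handle (cartesianProduct vs vs) G k
          ∈vs = λ ((i , x) : Vertex n r) → ∈-cartesianProduct⁺ (∈-allFin i) (∈-allFin x)
      in H , G⊆H , k′ , λ {u} {x} u≢x ¬a →
        [ (λ a → ⊥-elim (¬a a)) , id ]′ (h (∈-cartesianProduct⁺ (∈vs u) (∈vs x)) u≢x)

  record Wheel {V} (G : SimpleGraph V) (h c₀ c₁ c₂ c₃ c₄ : V) : Set where
    constructor wheel
    open SimpleGraph G
    field
      s₀ : Adj h c₀
      s₁ : Adj h c₁
      s₂ : Adj h c₂
      s₃ : Adj h c₃
      s₄ : Adj h c₄
      r₀ : Adj c₀ c₁
      r₁ : Adj c₁ c₂
      r₂ : Adj c₂ c₃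
      r₃ : Adj c₃ c₄
      r₄ : Adj c₄ c₀

  data Structure {V} (G : SimpleGraph V) : Set where
    coloured : (col : V → Fin 3) → (∀ {u v} → SimpleGraph.Adj G u v → col u ≢ col v) → Structure G
    hub : ∀ {h c₀ c₁ c₂ c₃ c₄} → Wheel G h c₀ c₁ c₂ c₃ c₄ →
          (∀ {w w′} → ¬ SimpleGraph.Adj G h w → ¬ SimpleGraph.Adj G h w′ → ¬ SimpleGraph.Adj G w w′) →
          Structure G

  module Dense {n r δ : ℕ} (G : SimpleGraph (Vertex n r)) (k₄ : K₄-free G)
               (δ≤ : ∀ v → δ ≤ Counting.deg G v) where
    open SimpleGraph G
    open Counting G

    adjacent : 0 < δ → ∀ v → ∃ (Adj v)
    adjacent lt v = heavy-vertex (1 ∷ []) (v ∷ []) ((0F ∷ []) ∷ []) 0 1 δ≤ (lin (r ∷ n ∷ δ ∷ []) 0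
        (κ 1 :+ κ 0 :* (# 0 :* # 1) ≼ κ 1 :* # 2)
        (1 · κ 1 ≼ # 2 by lt))
      λ z → (λ { (p ∷ []) → z , p }) ∷ []

    common₂ : r * n < 2 * δ → ∀ u v → ∃[ z ] Adj u z × Adj v z
    common₂ lt u v = heavy-vertex (1 ∷ 1 ∷ []) (u ∷ v ∷ []) ((0F ∷ 1F ∷ []) ∷ []) 1 2 δ≤ (lin (r ∷ n ∷ δ ∷ []) 0
        (κ 1 :+ κ 1 :* (# 0 :* # 1) ≼ κ 2 :* # 2)
        (1 · κ 1 :+ # 0 :* # 1 ≼ κ 2 :* # 2 by lt))
      λ z → (λ { (p ∷ q ∷ []) → z , p , q }) ∷ []

    common₃ : 2 * (r * n) < 3 * δ → ∀ u v w → ∃[ z ] Adj u z × Adj v z × Adj w z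
    common₃ lt u v w = heavy-vertex (1 ∷ 1 ∷ 1 ∷ []) (u ∷ v ∷ w ∷ []) ((0F ∷ 1F ∷ 2F ∷ []) ∷ []) 2 3 δ≤ lt
      λ z → (λ { (p ∷ q ∷ s ∷ []) → z , p , q , s }) ∷ []

    -- The assumed density gives any three vertices a common neighbour, so a vertex grows greedily
    -- to an edge, a triangle and a K₄.
    turán : Vertex n r → ¬ (2 * (r * n) < 3 * δ)
    turán v lt =
      let (v₁ , e₁)           = adjacent (lin (δ ∷ r ∷ n ∷ []) 2 (κ 1 ≼ # 0)
                                            (1 · κ 1 :+ κ 2 :* (# 1 :* # 2) ≼ κ 3 :* # 0 by lt)) v
          (v₂ , e₂ , e₃)      = common₂ (lin (r ∷ n ∷ δ ∷ []) 2 (κ 1 :+ # 0 :* # 1 ≼ κ 2 :* # 2)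
              (2 · κ 1 :+ κ 2 :* (# 0 :* # 1) ≼ κ 3 :* # 2 by lt)) v v₁
          (v₃ , e₄ , e₅ , e₆) = common₃ lt v v₁ v₂
      in k₄ e₁ e₂ e₄ e₃ e₅ e₆

    private
      clash : ∀ {m ℓ} {R : Set ℓ} (L : Vec (Vertex n r) m) {i j k z} →
        Adj (lookup L i) (lookup L j) → Adj (lookup L i) (lookup L k) → Adj (lookup L j) (lookup L k) →
        All (λ l → Adj (lookup L l) z) (i ∷ j ∷ k ∷ []) → R
      clash L ij ik jk (iz ∷ jz ∷ kz ∷ []) = ⊥-elim (k₄ ij ik iz jk jz kz)

    -- The rim alone weighs 5, so seeing more means seeing the hub and at least three of five rim
    -- vertices. Two of these are consecutive and form a triangle with the hub.
    wheel-sparse : ∀ {h c₀ c₁ c₂ c₃ c₄} → Wheel G h c₀ c₁ c₂ c₃ c₄ → 8 * δ ≤ 5 * (r * n)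
    wheel-sparse {h} {c₀} {c₁} {c₂} {c₃} {c₄} (wheel s₀ s₁ s₂ s₃ s₄ r₀ r₁ r₂ r₃ r₄) = ≮⇒≥ λ lt →
      let L = h ∷ c₀ ∷ c₁ ∷ c₂ ∷ c₃ ∷ c₄ ∷ [] in
      heavy-vertex (3 ∷ 1 ∷ 1 ∷ 1 ∷ 1 ∷ 1 ∷ []) L
        ((0F ∷ 1F ∷ 2F ∷ []) ∷ (0F ∷ 2F ∷ 3F ∷ []) ∷ (0F ∷ 3F ∷ 4F ∷ []) ∷ (0F ∷ 4F ∷ 5F ∷ []) ∷ (0F ∷ 5F ∷ 1F ∷ []) ∷ [])
        5 8 δ≤ lt
        λ z → clash L s₀ s₁ r₀ ∷ clash L s₁ s₂ r₁ ∷ clash L s₂ s₃ r₂ ∷ clash L s₃ s₄ r₃ ∷ clash L s₄ s₀ r₄ ∷ []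

    module _ (sat : Saturated G) (dense : 3 * (r * n) < 5 * δ) where

      private
        Bad : Vertex n r → Vertex n r → Vertex n r → Set
        Bad u x y = ¬ Adj u x × ¬ Adj u y × Adj x y

        found : ∀ {u x y z a c} → Adj u z → Adj x z → Adj y z → Adj a z → Adj c z →
          Adj x y → Adj y c → Adj u c → Adj u a → Adj x a → ∃[ v ] ∃[ a ] ∃[ c ] Wheel G v x y c u a
        found zu zx zy za zc xy yc uc ua xa =
          _ , _ , _ , wheel (sym zx) (sym zy) (sym zc) (sym zu) (sym za) xy yc (sym uc) ua (sym xa)

      -- By saturation u and x have a common edge ab, and u and y a common edge cd.
      -- If no vertex sees five of u, x, y, a, b, c, d, the minimum degree is at most 4/7.
      bad⇒wheel : ∀ {u x y} → Bad u x y → ∃[ v ] ∃[ a ] ∃[ c ] Wheel G v x y c u a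
      bad⇒wheel {u} {x} {y} (ux , uy , xy) =
        let (a , b , ab , ua , ub , xa , xb) = sat {u} {x} (λ { refl → uy xy }) ux
            (c , d , cd , uc , ud , yc , yd) = sat {u} {y} (λ { refl → ux (sym xy) }) uy
            L = u ∷ x ∷ y ∷ a ∷ b ∷ c ∷ d ∷ []
        in heavy-vertex (1 ∷ 1 ∷ 1 ∷ 1 ∷ 1 ∷ 1 ∷ 1 ∷ []) L
             ( (1F ∷ 3F ∷ 4F ∷ []) ∷ (0F ∷ 3F ∷ 4F ∷ []) ∷ (2F ∷ 5F ∷ 6F ∷ []) ∷ (0F ∷ 5F ∷ 6F ∷ [])
             ∷ (0F ∷ 1F ∷ 2F ∷ 3F ∷ 5F ∷ []) ∷ (0F ∷ 1F ∷ 2F ∷ 3F ∷ 6F ∷ [])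
             ∷ (0F ∷ 1F ∷ 2F ∷ 4F ∷ 5F ∷ []) ∷ (0F ∷ 1F ∷ 2F ∷ 4F ∷ 6F ∷ []) ∷ [])
             4 7 δ≤ (lin (r ∷ n ∷ δ ∷ []) 4 (κ 1 :+ κ 4 :* (# 0 :* # 1) ≼ κ 7 :* # 2)
                       (7 · κ 1 :+ κ 3 :* (# 0 :* # 1) ≼ κ 5 :* # 2 by dense))
             λ z → clash L xa xb ab ∷ clash L ua ub ab ∷ clash L yc yd cd ∷ clash L uc ud cd
               ∷ (λ { (zu ∷ zx ∷ zy ∷ za ∷ zc ∷ []) → found zu zx zy za zc xy yc uc ua xa })
               ∷ (λ { (zu ∷ zx ∷ zy ∷ za ∷ zd ∷ []) → found zu zx zy za zd xy yd ud ua xa })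
               ∷ (λ { (zu ∷ zx ∷ zy ∷ zb ∷ zc ∷ []) → found zu zx zy zb zc xy yc uc ub xb })
               ∷ (λ { (zu ∷ zx ∷ zy ∷ zb ∷ zd ∷ []) → found zu zx zy zb zd xy yd ud ub xb }) ∷ []

      -- If `w` missed all three, `bad⇒wheel` would give a wheel with rim h y c w a, and saturation
      -- an edge `pq` seen by `w` and `t`. With the hub `v` counted twice, a set containing none of
      -- the listed triangles weighs at most 6 of 10.
      sees-triangle : ∀ {w h y t} → Adj h y → Adj h t → Adj y t → ¬ Adj w h → ¬ Adj w y → Adj w t
      sees-triangle {w} {h} {y} {t} hy ht yt wh wy = decidable-stable (adj? w t) λ wt →
        let (v , a , c , wheel vh vy vc vw va _ yc cw wa ah) = bad⇒wheel (wh , wy , hy)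
            (p , q , pq , wp , wq , tp , tq) = sat {w} {t} (λ { refl → wh (sym ht) }) wt
            L = h ∷ y ∷ t ∷ v ∷ a ∷ c ∷ w ∷ p ∷ q ∷ []
        in heavy-vertex (1 ∷ 1 ∷ 1 ∷ 2 ∷ 1 ∷ 1 ∷ 1 ∷ 1 ∷ 1 ∷ []) L
             ( (0F ∷ 1F ∷ 2F ∷ []) ∷ (3F ∷ 0F ∷ 1F ∷ []) ∷ (3F ∷ 1F ∷ 5F ∷ []) ∷ (3F ∷ 5F ∷ 6F ∷ [])
             ∷ (3F ∷ 6F ∷ 4F ∷ []) ∷ (3F ∷ 4F ∷ 0F ∷ []) ∷ (6F ∷ 7F ∷ 8F ∷ []) ∷ (2F ∷ 7F ∷ 8F ∷ []) ∷ [])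
             6 10 δ≤ (lin (r ∷ n ∷ δ ∷ []) 0 (κ 1 :+ κ 6 :* (# 0 :* # 1) ≼ κ 10 :* # 2)
                        (2 · κ 1 :+ κ 3 :* (# 0 :* # 1) ≼ κ 5 :* # 2 by dense))
             λ z → clash L hy ht yt ∷ clash L vh vy hy ∷ clash L vy vc yc ∷ clash L vc vw cw
               ∷ clash L vw va wa ∷ clash L va vh ah ∷ clash L wp wq pq ∷ clash L tp tq pq ∷ []

      -- As `w` misses both `h` and `c₀`, all three lie on the rim of a second wheel, around `v`.
      -- With `h` counted twice, the triangles of the two wheels and w c₁ c₂ again leave at most 6
      -- of 10.
      rim-gap : ∀ {h c₀ c₁ c₂ c₃ c₄ w} → Wheel G h c₀ c₁ c₂ c₃ c₄ →
                ¬ Adj w h → ¬ Adj w c₀ → Adj w c₁ → Adj w c₂ → ⊥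
      rim-gap {h} {c₀} {c₁} {c₂} {c₃} {c₄} {w} (wheel s₀ s₁ s₂ s₃ s₄ r₀ r₁ r₂ r₃ r₄) wh w₀ w₁ w₂ =
        let (v , a , c , wheel vh v₀ vc vw va _ yc cw wa ah) = bad⇒wheel (wh , w₀ , s₀)
            L = h ∷ c₀ ∷ c₁ ∷ c₂ ∷ c₃ ∷ c₄ ∷ v ∷ c ∷ w ∷ []
        in heavy-vertex (2 ∷ 1 ∷ 1 ∷ 1 ∷ 1 ∷ 1 ∷ 1 ∷ 1 ∷ 1 ∷ []) L
             ( (0F ∷ 1F ∷ 2F ∷ []) ∷ (0F ∷ 2F ∷ 3F ∷ []) ∷ (0F ∷ 3F ∷ 4F ∷ []) ∷ (0F ∷ 4F ∷ 5F ∷ []) ∷ (0F ∷ 5F ∷ 1F ∷ [])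
             ∷ (6F ∷ 0F ∷ 1F ∷ []) ∷ (6F ∷ 1F ∷ 7F ∷ []) ∷ (6F ∷ 7F ∷ 8F ∷ []) ∷ (8F ∷ 2F ∷ 3F ∷ []) ∷ [])
             6 10 δ≤ (lin (r ∷ n ∷ δ ∷ []) 0 (κ 1 :+ κ 6 :* (# 0 :* # 1) ≼ κ 10 :* # 2)
                        (2 · κ 1 :+ κ 3 :* (# 0 :* # 1) ≼ κ 5 :* # 2 by dense))
             λ z → clash L s₀ s₁ r₀ ∷ clash L s₁ s₂ r₁ ∷ clash L s₂ s₃ r₂ ∷ clash L s₃ s₄ r₃ ∷ clash L s₄ s₀ r₄
               ∷ clash L vh v₀ s₀ ∷ clash L v₀ vc yc ∷ clash L vc vw cw ∷ clash L w₁ w₂ r₁ ∷ []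

      -- If `w` missed `c₀`, it would see `c₁` and `c₄` by `sees-triangle`, miss `c₂` by `rim-gap`,
      -- and hence see `c₃`; then `c₄` and `c₃` contradict `rim-gap` in the reversed wheel.
      sees-rim : ∀ {h c₀ c₁ c₂ c₃ c₄ w} → Wheel G h c₀ c₁ c₂ c₃ c₄ → ¬ Adj w h → Adj w c₀
      sees-rim {h} {c₀} {c₁} {c₂} {c₃} {c₄} {w} W@(wheel s₀ s₁ s₂ s₃ s₄ r₀ r₁ r₂ r₃ r₄) wh =
        decidable-stable (adj? w c₀) λ w₀ →
          let w₂ = λ (w₂ : Adj w c₂) → rim-gap W wh w₀ (sees-triangle s₀ s₁ r₀ wh w₀) w₂
              w₄ = sees-triangle s₀ s₄ (sym r₄) wh w₀
          in rim-gap (wheel s₀ s₄ s₃ s₂ s₁ (sym r₄) (sym r₃) (sym r₂) (sym r₁) (sym r₀)) wh w₀ w₄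
               (sees-triangle s₂ s₃ r₂ wh w₂)

      -- Adjacent vertices that both see the rim edge `c₀` `c₁` would form a K₄ with it.
      misses-hub-independent : ∀ {h c₀ c₁ c₂ c₃ c₄} → Wheel G h c₀ c₁ c₂ c₃ c₄ →
        ∀ {w w′} → ¬ Adj h w → ¬ Adj h w′ → ¬ Adj w w′
      misses-hub-independent W@(wheel s₀ s₁ s₂ s₃ s₄ r₀ r₁ r₂ r₃ r₄) hw hw′ ww′ =
        k₄ ww′ (sees-rim W (hw ∘ sym)) (sees-rim W⁺ (hw ∘ sym))
               (sees-rim W (hw′ ∘ sym)) (sees-rim W⁺ (hw′ ∘ sym)) r₀
        where W⁺ = wheel s₁ s₂ s₃ s₄ s₀ r₁ r₂ r₃ r₄ r₀

      private
        -- Without a bad triple, non-adjacency is transitive. Two vertices that see both `v₀` and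
        -- `v₁` must miss `v₂`, as there is no K₄, and so miss each other: the remaining vertices
        -- form a single class.
        twins⇒coloured : (∀ {u x y} → ¬ Bad u x y) → ∀ {v₀ v₁ v₂} → Adj v₀ v₁ → Adj v₀ v₂ → Adj v₁ v₂ → Structure G
        twins⇒coloured ¬bad {v₀} {v₁} {v₂} e₀₁ e₀₂ e₁₂ = coloured col proper
          where
          twins : ∀ {u x y} → ¬ Adj u x → ¬ Adj u y → ¬ Adj x y
          twins p q e = ¬bad (p , q , e)

          col : Vertex n r → Fin 3
          col z with adj? v₀ z | adj? v₁ z
          ... | no _  | _     = 0F
          ... | yes _ | no _  = 1F
          ... | yes _ | yes _ = 2F

          proper : ∀ {u v} → Adj u v → col u ≢ col v
          proper {u} {v} e with adj? v₀ u | adj? v₁ u | adj? v₀ v | adj? v₁ v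
          ... | no p  | _     | no q  | _     = λ _ → twins p q e
          ... | yes _ | no p  | yes _ | no q  = λ _ → twins p q e
          ... | yes a | yes b | yes c | yes d = λ _ →
            twins (λ p → k₄ e₀₁ e₀₂ a e₁₂ b p) (λ p → k₄ e₀₁ e₀₂ c e₁₂ d p) e
          ... | no _  | _     | yes _ | no _  = λ ()
          ... | no _  | _     | yes _ | yes _ = λ ()
          ... | yes _ | no _  | no _  | _     = λ ()
          ... | yes _ | yes _ | no _  | _     = λ ()
          ... | yes _ | no _  | yes _ | yes _ = λ ()
          ... | yes _ | yes _ | yes _ | no _  = λ ()

      structure : Vertex n r → Structure G
      structure v₀ = decide (∃? λ u → ∃? λ x → ∃? λ y → ¬? (adj? u x) ×-dec ¬? (adj? u y) ×-dec adj? x y)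
        where
        decide : Dec (∃[ u ] ∃[ x ] ∃[ y ] Bad u x y) → Structure G
        decide (yes (_ , _ , _ , bad)) =
          let (_ , _ , _ , W) = bad⇒wheel bad in hub W (misses-hub-independent W)
        decide (no ¬bad) =
          let (v₁ , e₀₁)       = adjacent (lin (δ ∷ r ∷ n ∷ []) 4 (κ 1 ≼ # 0)
                                             (1 · κ 1 :+ κ 3 :* (# 1 :* # 2) ≼ κ 5 :* # 0 by dense)) v₀
              (v₂ , e₀₂ , e₁₂) = common₂ (lin (r ∷ n ∷ δ ∷ []) 4 (κ 1 :+ # 0 :* # 1 ≼ κ 2 :* # 2)
                  (2 · κ 1 :+ κ 3 :* (# 0 :* # 1) ≼ κ 5 :* # 2 by dense)) v₀ v₁
          in twins⇒coloured (λ b → ¬bad (_ , _ , _ , b)) e₀₁ e₀₂ e₁₂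

-- Colour counts of 3-coloured graphs, part by part.

module Tables where

  open import Data.Empty using (⊥; ⊥-elim)
  open import Data.Fin.Base using (Fin; zero; suc)
  open import Data.Fin.Patterns
  open import Data.Fin.Properties using (any?)
  open import Data.List.Base using ([]; _∷_)
  open import Data.Nat
  open import Data.Nat.Divisibility using (_∣_; divides; 1∣_)
  open import Data.Nat.Properties
  open import Data.Product using (_×_; _,_; ∃-syntax; proj₁; proj₂)
  open import Data.Sum using (_⊎_; inj₁; inj₂)
  open import Relation.Binary.PropositionalEquality
  open import Relation.Nullary using (¬_; Dec; yes; no)
  open import Relation.Nullary.Decidable using (_×-dec_)
  open LinearArithmetic
  open Sums

  sum-*ʳ : ∀ {n} (f : Fin n → ℕ) c → sum (λ i → f i * c) ≡ sum f * c
  sum-*ʳ f c = trans (sum-cong-≗ (λ i → *-comm (f i) c)) (trans (sum-*ˡ c f) (*-comm c (sum f)))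

  pos : ℕ → ℕ
  pos zero    = 0
  pos (suc _) = 1

  support : ∀ {r} → (Fin r → ℕ) → ℕ
  support x = sum (λ i → pos (x i))

  support-upper : ∀ {r c} (x : Fin r → ℕ) → (∀ i → x i ≤ c) → sum x ≤ support x * c
  support-upper {r} {c} x h = ≤-trans (sum-mono step) (≤-reflexive (sum-*ʳ (λ i → pos (x i)) c))
    where
    step : ∀ i → x i ≤ pos (x i) * c
    step i with x i | h i
    ... | zero  | _ = z≤n
    ... | suc _ | p = ≤-trans p (m≤m+n c 0)

  support-lower : ∀ {r c} (x : Fin r → ℕ) → (∀ i → 0 < x i → c ≤ x i) → support x * c ≤ sum x
  support-lower {r} {c} x h = ≤-trans (≤-reflexive (sym (sum-*ʳ (λ i → pos (x i)) c))) (sum-mono step)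
    where
    step : ∀ i → pos (x i) * c ≤ x i
    step i with x i | h i
    ... | zero  | _ = z≤n
    ... | suc _ | p = ≤-trans (≤-reflexive (+-identityʳ c)) (p z<s)

  0<sum⇒∃ : ∀ {r} (x : Fin r → ℕ) → 0 < sum x → ∃[ i ] 0 < x i
  0<sum⇒∃ {r} x h = sum-<⇒∃ {f = λ _ → 0} (≤-<-trans (≤-reflexive (trans (sum-const r 0) (*-zeroʳ r))) h)

  least-positive : ∀ {r} (x : Fin r → ℕ) → (∃[ i ] 0 < x i) → ∃[ i ] 0 < x i × (∀ j → 0 < x j → x i ≤ x j)
  least-positive x (i , p) = go (x i) i p ≤-refl
    where
    go : ∀ b i → 0 < x i → x i ≤ b → ∃[ i ] 0 < x i × (∀ j → 0 < x j → x i ≤ x j)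
    go zero i p le = ⊥-elim (<⇒≱ p le)
    go (suc b) i p le with any? (λ j → (0 <? x j) ×-dec (x j <? x i))
    ... | yes (j , q , lt) = go b j q (s≤s⁻¹ (≤-trans lt le))
    ... | no ¬q = i , p , λ j q → ≮⇒≥ (λ lt → ¬q (j , q , lt))

  -- Row `i` counts the three colours in part `i`. There are r = 3k + 1 + e parts, and `g` stands
  -- for the excess of the minimum degree over 2kn + en. A vertex sees neither its own colour nor
  -- its own part, which gives the bound at every part that its colour meets.
  record Table (r k g n e : ℕ) (x y z : Fin r → ℕ) : Set where
    field
      rows  : ∀ i → x i + y i + z i ≡ n
      total : sum x + sum y + sum z ≡ 3 * (k * n) + n + e * n
      boundˣ : ∀ i → 0 < x i → g + sum x ≤ k * n + x i
      boundʸ : ∀ i → 0 < y i → g + sum y ≤ k * n + y i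
      boundᶻ : ∀ i → 0 < z i → g + sum z ≤ k * n + z i

  module _ {r k g n e : ℕ} {x y z : Fin r → ℕ} where

    swapᵗ : Table r k g n e x y z → Table r k g n e y x z
    swapᵗ t = record
      { rows = λ i → trans (cong (_+ z i) (+-comm (y i) (x i))) (rows i)
      ; total = trans (cong (_+ sum z) (+-comm (sum y) (sum x))) total
      ; boundˣ = boundʸ ; boundʸ = boundˣ ; boundᶻ = boundᶻ }
      where open Table t

    rotateᵗ : Table r k g n e x y z → Table r k g n e y z x
    rotateᵗ t = record
      { rows = λ i → trans (+-comm (y i + z i) (x i)) (trans (sym (+-assoc (x i) (y i) (z i))) (rows i))
      ; total = trans (+-comm (sum y + sum z) (sum x)) (trans (sym (+-assoc (sum x) (sum y) (sum z))) total)
      ; boundˣ = boundʸ ; boundʸ = boundᶻ ; boundᶻ = boundˣ }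
      where open Table t

    module _ (t : Table r k g n e x y z) (0<g : 0 < g) where
      open Table t

      x≤n : ∀ i → x i ≤ n
      x≤n i = lin (x i ∷ n ∷ y i ∷ z i ∷ []) 0 (# 0 ≼ # 1) (1 · # 0 :+ # 2 :+ # 3 ≼ # 1 by ≡⇒≤ (rows i))

      -- Add the bounds of the two colours at their common part, of which they fill at most `n`
      -- vertices, and compare with the total.
      big : ∀ i → 0 < x i → 0 < y i → k * n + 2 * g + e * n ≤ sum z
      big i p q = lin (k ∷ n ∷ g ∷ e ∷ sum z ∷ sum x ∷ x i ∷ sum y ∷ y i ∷ z i ∷ []) 0
          (# 0 :* # 1 :+ κ 2 :* # 2 :+ # 3 :* # 1 ≼ # 4)
                    (1 · # 2 :+ # 5 ≼ # 0 :* # 1 :+ # 6 by boundˣ i p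
                     ⊹ 1 · # 2 :+ # 7 ≼ # 0 :* # 1 :+ # 8 by boundʸ i q
                     ⊹ 1 · κ 3 :* (# 0 :* # 1) :+ # 1 :+ # 3 :* # 1 ≼ # 5 :+ # 7 :+ # 4 by ≡⇒≥ total
                     ⊹ 1 · # 6 :+ # 8 :+ # 9 ≼ # 1 by ≡⇒≤ (rows i))

      present : 0 < sum x → g + sum x ≤ k * n + n
      present p = let (i , q) = 0<sum⇒∃ x p in lin (g ∷ sum x ∷ k ∷ n ∷ x (proj₁ (0<sum⇒∃ x p)) ∷ []) 0
                          (# 0 :+ # 1 ≼ # 2 :* # 3 :+ # 3)
                                                 (1 · # 0 :+ # 1 ≼ # 2 :* # 3 :+ # 4 by boundˣ i q
                                                  ⊹ 1 · # 4 ≼ # 3 by x≤n i)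

      -- A colour made of whole parts has a multiple of `n` vertices, and `present` keeps it below
      -- (k + 1) n.
      full⇒small : 0 < n → (∀ i → 0 < x i → n ≤ x i) → sum x ≤ k * n
      full⇒small 0<n h = ≮⇒≥ λ lt →
        let s≤k : support x ≤ k
            s≤k = ≮⇒≥ λ k<s →
              absurd (lin (g ∷ sum x ∷ k ∷ n ∷ support x ∷ []) 0 (κ 1 ≼ κ 0)
                        (1 · # 0 :+ # 1 ≼ # 2 :* # 3 :+ # 3
                            by present (lin (sum x ∷ k ∷ n ∷ []) 0 (κ 1 ≼ # 0) (1 · κ 1 :+ # 1 :* # 2 ≼ # 0 by lt))
                         ⊹ 1 · (κ 1 :+ # 2) :* # 3 ≼ # 4 :* # 3 by scaleʳ n k<s
                         ⊹ 1 · # 4 :* # 3 ≼ # 1 by support-lower x h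
                         ⊹ 1 · κ 1 ≼ # 0 by 0<g))
        in absurd (lin (k ∷ n ∷ sum x ∷ support x ∷ []) 0 (κ 1 ≼ κ 0)
                     (1 · κ 1 :+ # 0 :* # 1 ≼ # 2 by lt ⊹ 1 · # 2 ≼ # 3 :* # 1 by support-upper x x≤n
                      ⊹ 1 · # 3 :* # 1 ≼ # 0 :* # 1 by scaleʳ n s≤k))

      partial : 0 < n → k * n < sum x → ∃[ i ] 0 < x i × x i < n
      partial 0<n lt with any? (λ i → (0 <? x i) ×-dec (x i <? n))
      ... | yes p = p
      ... | no ¬p = ⊥-elim (<⇒≱ lt (full⇒small 0<n (λ i p → ≮⇒≥ (λ q → ¬p (i , p , q)))))

      partner : ∀ i → x i < n → 0 < y i ⊎ 0 < z i
      partner i p with 0 <? y i | 0 <? z i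
      ... | yes q | _     = inj₁ q
      ... | no _  | yes q = inj₂ q
      ... | no q  | no q′ = absurd (lin (x i ∷ n ∷ y i ∷ z i ∷ []) 0 (κ 1 ≼ κ 0)
          (1 · κ 1 :+ # 0 ≼ # 1 by p ⊹ 1 · # 2 ≼ κ 0 by ≮⇒≥ q ⊹ 1 · # 3 ≼ κ 0 by ≮⇒≥ q′
           ⊹ 1 · # 1 ≼ # 0 :+ # 2 :+ # 3 by ≡⇒≥ (rows i)))

  record Extreme {r} (k g n : ℕ) (x z : Fin r → ℕ) : Set where
    field
      i     : Fin r
      0<x   : 0 < x i
      least : ∀ j → 0 < x j → x i ≤ x j
      0<z   : 0 < z i
      sum-n : x i + z i ≡ n
      g≤kz  : g ≤ k * z i

  -- More than `k` parts meet the colour because it exceeds kn, so k + 1 times its least positive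
  -- entry is at most its size; the bound at that part then yields `g≤kz`. A part from `partial`
  -- ensures that the least entry is below `n`.
  extreme : ∀ {r k g n x y z} → Table r k g n 0 x y z → 0 < g → 0 < n →
            k * n + 2 * g ≤ sum x → (∀ i → 0 < x i → y i ≡ 0) → Extreme k g n x z
  extreme {r} {k} {g} {n} {x} {y} {z} t 0<g 0<n bigˣ apart = build (least-positive x (i , p)) x<n
    where
    open Table t
    kn<x : k * n < sum x
    kn<x = lin (k ∷ n ∷ sum x ∷ g ∷ []) 0 (κ 1 :+ # 0 :* # 1 ≼ # 2)
             (1 · # 0 :* # 1 :+ κ 2 :* # 3 ≼ # 2 by bigˣ ⊹ 2 · κ 1 ≼ # 3 by 0<g)
    i = proj₁ (partial t 0<g 0<n kn<x)
    p = proj₁ (proj₂ (partial t 0<g 0<n kn<x))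
    x<n = proj₂ (proj₂ (partial t 0<g 0<n kn<x))

    k<s : k < support x
    k<s = ≰⇒> λ s≤k → <⇒≱ kn<x (≤-trans (support-upper x (x≤n t 0<g)) (scaleʳ n s≤k))

    build : (∃[ l ] 0 < x l × (∀ j → 0 < x j → x l ≤ x j)) → x i < n → Extreme k g n x z
    build (l , 0<x , least) x<n = record
      { i = l ; 0<x = 0<x ; least = least
      ; 0<z = lin (z l ∷ x i ∷ n ∷ x l ∷ []) 0 (κ 1 ≼ # 0)
                (1 · κ 1 :+ # 1 ≼ # 2 by x<n ⊹ 1 · # 3 ≼ # 1 by least i p
                 ⊹ 1 · # 2 ≼ # 3 :+ # 0 by ≡⇒≥ sum-n) ; sum-n = sum-n
      ; g≤kz = lin (g ∷ k ∷ z l ∷ sum x ∷ n ∷ x l ∷ support x ∷ []) 0 (# 0 ≼ # 1 :* # 2)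
                 (1 · # 0 :+ # 3 ≼ # 1 :* # 4 :+ # 5 by boundˣ l 0<x
                  ⊹ 1 · (κ 1 :+ # 1) :* # 5 ≼ # 6 :* # 5 by scaleʳ (x l) k<s
                  ⊹ 1 · # 6 :* # 5 ≼ # 3 by support-lower x least
                  ⊹ 1 · # 1 :* # 4 ≼ # 1 :* (# 5 :+ # 2) by scaleˡ k (≡⇒≥ sum-n)) }
      where
      sum-n : x l + z l ≡ n
      sum-n = trans (cong (_+ z l) (trans (sym (+-identityʳ (x l))) (cong (x l +_) (sym (apart l 0<x))))) (rows l)

  -- For r = 3k + 1 the first field says g ≤ kn / r. When n = rq + 3h + 1, the largest such integer
  -- is kq + h, and the second field is a necessary condition for attaining it.
  record Slack (k g n : ℕ) : Set where
    field
      bound     : (3 * k + 1) * g ≤ k * n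
      divisible : ∀ q h → 1 ≤ h → h ≤ k → g ≡ k * q + h → n ≡ (3 * k + 1) * q + 3 * h + 1 → suc q ∣ (k ∸ h)

  module _ {r k g n : ℕ} {x y z : Fin r → ℕ} (t : Table r k g n 0 x y z) (0<g : 0 < g) (0<n : 0 < n) (0<k : 0 < k) where
    open Table t

    -- The three sizes, added and compared with `total`, give 6g ≤ n. This is too far from equality
    -- for the hypotheses of `divisible` to hold.
    three-big : k * n + 2 * g ≤ sum x → k * n + 2 * g ≤ sum y → k * n + 2 * g ≤ sum z → Slack k g n
    three-big bˣ bʸ bᶻ = record
      { bound = lin (k ∷ g ∷ n ∷ []) 0 ((κ 3 :* # 0 :+ κ 1) :* # 1 ≼ # 0 :* # 2)
                  (1 · # 0 :* (κ 6 :* # 1) ≼ # 0 :* # 2 by scaleˡ k 6g≤n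
                   ⊹ 3 · κ 1 :* # 1 ≼ # 0 :* # 1 by scaleʳ g 0<k)
      ; divisible = λ q h 1≤h h≤k eg en → absurd
          (lin (g ∷ n ∷ k ∷ q ∷ h ∷ []) 0 (κ 1 ≼ κ 0)
             (1 · κ 6 :* # 0 ≼ # 1 by 6g≤n ⊹ 6 · # 2 :* # 3 :+ # 4 ≼ # 0 by ≡⇒≥ eg
              ⊹ 1 · # 1 ≼ (κ 3 :* # 2 :+ κ 1) :* # 3 :+ κ 3 :* # 4 :+ κ 1 by ≡⇒≤ en
              ⊹ 3 · κ 1 :* # 3 ≼ # 2 :* # 3 by scaleʳ q 0<k ⊹ 3 · κ 1 ≼ # 4 by 1≤h)) }
      where
      6g≤n : 6 * g ≤ n
      6g≤n = lin (g ∷ n ∷ k ∷ sum x ∷ sum y ∷ sum z ∷ []) 0 (κ 6 :* # 0 ≼ # 1)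
               (1 · # 2 :* # 1 :+ κ 2 :* # 0 ≼ # 3 by bˣ ⊹ 1 · # 2 :* # 1 :+ κ 2 :* # 0 ≼ # 4 by bʸ
                ⊹ 1 · # 2 :* # 1 :+ κ 2 :* # 0 ≼ # 5 by bᶻ
                ⊹ 1 · # 3 :+ # 4 :+ # 5 ≼ κ 3 :* (# 2 :* # 1) :+ # 1 :+ κ 0 :* # 1 by ≡⇒≤ total)

    module _ (X : Extreme k g n x z) (Y : Extreme k g n y z) (apart : ∀ i → 0 < x i → y i ≡ 0) where
      private
        module X = Extreme X
        module Y = Extreme Y

      -- Add the bounds at the extreme parts of x and y and at any part that meets z.
      tight : ∀ i → 0 < z i → 3 * g + z X.i + z Y.i ≤ n + z i
      tight i p = lin (g ∷ z X.i ∷ z Y.i ∷ n ∷ z i ∷ sum x ∷ k ∷ x X.i ∷ sum y ∷ y Y.i ∷ sum z ∷ []) 0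
          (κ 3 :* # 0 :+ # 1 :+ # 2 ≼ # 3 :+ # 4)
                    (1 · # 0 :+ # 5 ≼ # 6 :* # 3 :+ # 7 by boundˣ X.i X.0<x
                     ⊹ 1 · # 0 :+ # 8 ≼ # 6 :* # 3 :+ # 9 by boundʸ Y.i Y.0<x
                     ⊹ 1 · # 0 :+ # 10 ≼ # 6 :* # 3 :+ # 4 by boundᶻ i p
                     ⊹ 1 · κ 3 :* (# 6 :* # 3) :+ # 3 :+ κ 0 :* # 3 ≼ # 5 :+ # 8 :+ # 10 by ≡⇒≥ total
                     ⊹ 1 · # 7 :+ # 1 ≼ # 3 by ≡⇒≤ X.sum-n ⊹ 1 · # 9 :+ # 2 ≼ # 3 by ≡⇒≤ Y.sum-n)

      module _ (q h : ℕ) (1≤h : 1 ≤ h) (h≤k : h ≤ k) (eg : g ≡ k * q + h) (en : n ≡ (3 * k + 1) * q + 3 * h + 1) where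

        -- The bound g ≤ kz exceeds kq because h is positive. Together with `zX≤` this pins the
        -- third colour at the extreme part to exactly q + 1 vertices.
        q<zX : q < z X.i
        q<zX = *-cancelˡ-< k q (z X.i) (lin (k ∷ q ∷ z X.i ∷ g ∷ h ∷ []) 0 (κ 1 :+ # 0 :* # 1 ≼ # 0 :* # 2)
            (1 · # 3 ≼ # 0 :* # 2 by X.g≤kz ⊹ 1 · # 0 :* # 1 :+ # 4 ≼ # 3 by ≡⇒≥ eg
             ⊹ 1 · κ 1 ≼ # 4 by 1≤h))

        q<zY : q < z Y.i
        q<zY = *-cancelˡ-< k q (z Y.i) (lin (k ∷ q ∷ z Y.i ∷ g ∷ h ∷ []) 0 (κ 1 :+ # 0 :* # 1 ≼ # 0 :* # 2)
            (1 · # 3 ≼ # 0 :* # 2 by Y.g≤kz ⊹ 1 · # 0 :* # 1 :+ # 4 ≼ # 3 by ≡⇒≥ eg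
             ⊹ 1 · κ 1 ≼ # 4 by 1≤h))

        zX≤ : z X.i ≤ suc q
        zX≤ = lin (z X.i ∷ q ∷ g ∷ z Y.i ∷ n ∷ k ∷ h ∷ []) 0 (# 0 ≼ κ 1 :+ # 1)
                (1 · κ 3 :* # 2 :+ # 0 :+ # 3 ≼ # 4 :+ # 3 by tight Y.i Y.0<z
                 ⊹ 3 · # 5 :* # 1 :+ # 6 ≼ # 2 by ≡⇒≥ eg
                 ⊹ 1 · # 4 ≼ (κ 3 :* # 5 :+ κ 1) :* # 1 :+ κ 3 :* # 6 :+ κ 1 by ≡⇒≤ en)

        n≡ : 3 * g + suc q ≡ n
        n≡ = ≤-antisym (lin (g ∷ q ∷ n ∷ k ∷ h ∷ []) 0 (κ 3 :* # 0 :+ (κ 1 :+ # 1) ≼ # 2)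
                          (3 · # 0 ≼ # 3 :* # 1 :+ # 4 by ≡⇒≤ eg
                           ⊹ 1 · (κ 3 :* # 3 :+ κ 1) :* # 1 :+ κ 3 :* # 4 :+ κ 1 ≼ # 2
                               by ≡⇒≥ en)) (lin (n ∷ g ∷ q ∷ k ∷ h ∷ []) 0 (# 0 ≼ κ 3 :* # 1 :+ (κ 1 :+ # 2))
                               (3 · # 3 :* # 2 :+ # 4 ≼ # 1 by ≡⇒≥ eg
                                ⊹ 1 · # 0 ≼ (κ 3 :* # 3 :+ κ 1) :* # 2 :+ κ 3 :* # 4 :+ κ 1 by ≡⇒≤ en))

        z≥ : ∀ i → 0 < z i → suc q ≤ z i
        z≥ i p = lin (q ∷ z i ∷ g ∷ z X.i ∷ z Y.i ∷ n ∷ []) 0 (κ 1 :+ # 0 ≼ # 1)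
                   (1 · κ 3 :* # 2 :+ # 3 :+ # 4 ≼ # 5 :+ # 1 by tight i p
                    ⊹ 1 · # 5 ≼ κ 3 :* # 2 :+ (κ 1 :+ # 0) by ≡⇒≥ n≡
                    ⊹ 1 · κ 1 :+ # 0 ≼ # 3 by q<zX ⊹ 1 · κ 1 :+ # 0 ≼ # 4 by q<zY)

        xX≡ : x X.i ≡ 3 * g
        xX≡ = ≤-antisym (lin (x X.i ∷ g ∷ z X.i ∷ n ∷ q ∷ []) 0 (# 0 ≼ κ 3 :* # 1)
            (1 · # 0 :+ # 2 ≼ # 3 by ≡⇒≤ X.sum-n ⊹ 1 · # 3 ≼ κ 3 :* # 1 :+ (κ 1 :+ # 4) by ≡⇒≥ n≡
             ⊹ 1 · κ 1 :+ # 4 ≼ # 2 by q<zX))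
                        (lin (g ∷ x X.i ∷ n ∷ z X.i ∷ q ∷ []) 0 (κ 3 :* # 0 ≼ # 1)
                            (1 · # 2 ≼ # 1 :+ # 3 by ≡⇒≥ X.sum-n
                             ⊹ 1 · κ 3 :* # 0 :+ (κ 1 :+ # 4) ≼ # 2 by ≡⇒≤ n≡
                             ⊹ 1 · # 3 ≼ κ 1 :+ # 4 by zX≤))

        -- Every positive entry of x is n or n - (q + 1), and n = 3 g + (q + 1).
        entry : ∀ i → ∃[ ε ] x i ≡ pos (x i) * (3 * g) + suc q * ε
        entry i with x i | rows i | X.least i | apart i
        ... | zero  | _  | _ | _ = 0 , sym (*-zeroʳ q)
        ... | suc c | eq | l | a with z i | z≥ i | a z<s
        -- With the third colour absent the part is whole and counts n = 3g + (q + 1). In the other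
        -- case `z≥` and minimality leave exactly 3g.
        ...   | zero  | _ | y≡0 = 1 , ≤-antisym (lin (c ∷ g ∷ q ∷ y i ∷ n ∷ []) 0 (κ 1 :+ # 0
            ≼ # 1 :+ (# 1 :+ (# 1 :+ κ 0)) :+ κ 0 :+ (κ 1 :+ # 2 :* κ 1))
            (1 · κ 1 :+ (# 0 :+ # 3 :+ κ 0) ≼ # 4 by ≡⇒≤ eq
             ⊹ 1 · # 4 ≼ κ 3 :* # 1 :+ (κ 1 :+ # 2) by ≡⇒≥ n≡))
                                       (lin (g ∷ q ∷ c ∷ n ∷ y i ∷ []) 0
                                           (# 0 :+ (# 0 :+ (# 0 :+ κ 0)) :+ κ 0 :+ (κ 1 :+ # 1 :* κ 1) ≼ κ 1 :+ # 2)
                                           (1 · # 3 ≼ κ 1 :+ (# 2 :+ # 4 :+ κ 0) by ≡⇒≥ eq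
                                            ⊹ 1 · κ 3 :* # 0 :+ (κ 1 :+ # 1) ≼ # 3 by ≡⇒≤ n≡
                                            ⊹ 1 · # 4 ≼ κ 0 by ≡⇒≤ y≡0))
        ...   | suc d | z> | y≡0 = 0 , ≤-antisym (lin (c ∷ g ∷ q ∷ y i ∷ d ∷ n ∷ []) 0 (κ 1 :+ # 0
            ≼ # 1 :+ (# 1 :+ (# 1 :+ κ 0)) :+ κ 0 :+ (κ 0 :+ # 2 :* κ 0))
            (1 · κ 1 :+ (# 0 :+ # 3 :+ (κ 1 :+ # 4)) ≼ # 5 by ≡⇒≤ eq
             ⊹ 1 · # 5 ≼ κ 3 :* # 1 :+ (κ 1 :+ # 2) by ≡⇒≥ n≡
             ⊹ 1 · κ 1 :+ # 2 ≼ κ 1 :+ # 4 by z> z<s))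
                                        (lin (g ∷ q ∷ c ∷ x X.i ∷ []) 0
                                            (# 0 :+ (# 0 :+ (# 0 :+ κ 0)) :+ κ 0 :+ (κ 0 :+ # 1 :* κ 0)
                                            ≼ κ 1 :+ # 2)
                                            (1 · # 3 ≼ κ 1 :+ # 2 by l z<s ⊹ 1 · κ 3 :* # 0 ≼ # 3 by ≡⇒≥ xX≡))

        E : ℕ
        E = sum (λ i → proj₁ (entry i))

        sum-x≡ : sum x ≡ support x * (3 * g) + suc q * E
        sum-x≡ = trans (sum-cong-≗ (λ i → proj₂ (entry i)))
          (trans (∑-distrib-+ (λ i → pos (x i) * (3 * g)) (λ i → suc q * proj₁ (entry i)))
                 (cong₂ _+_ (sum-*ʳ (λ i → pos (x i)) (3 * g)) (sum-*ˡ (suc q) (λ i → proj₁ (entry i)))))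

        -- The bound at the extreme part and `bˣ` force `sum x` to be kn + 2g. If exactly k + 1
        -- parts meet the colour, comparison with `sum-x≡` leaves (q + 1) E + h = k. More parts are
        -- possible only for q = 0, where the divisor is 1.
        divides-k∸h : k * n + 2 * g ≤ sum x → k < support x → suc q ∣ (k ∸ h)
        divides-k∸h bˣ k<s = decide (support x ≤? suc k)
          where
          few : ∀ p → 4 * g ≤ k * suc p → p ≡ q → suc p ∣ (k ∸ h)
          few zero    _   _    = 1∣ (k ∸ h)
          few (suc p) 4g≤ refl = absurd (lin (g ∷ k ∷ p ∷ h ∷ []) 0 (κ 1 ≼ κ 0)
              (1 · κ 4 :* # 0 ≼ # 1 :* (κ 2 :+ # 2) by 4g≤
               ⊹ 4 · # 1 :* (κ 1 :+ # 2) :+ # 3 ≼ # 0 by ≡⇒≥ eg ⊹ 4 · κ 1 ≼ # 3 by 1≤h))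

          decide : Dec (support x ≤ suc k) → suc q ∣ (k ∸ h)
          decide (yes s≤) = divides E
            (trans (cong (_∸ h) (sym eq)) (trans (m+n∸n≡m (suc q * E) h) (*-comm (suc q) E)))
            where
            eq : suc q * E + h ≡ k
            eq = ≤-antisym
              (lin (q ∷ E ∷ h ∷ k ∷ g ∷ sum x ∷ n ∷ x X.i ∷ support x ∷ []) 0 ((κ 1 :+ # 0) :* # 1 :+ # 2 ≼ # 3)
                 (1 · # 4 :+ # 5 ≼ # 3 :* # 6 :+ # 7 by boundˣ X.i X.0<x ⊹ 1 · # 7 ≼ κ 3 :* # 4 by ≡⇒≤ xX≡
                  ⊹ 1 · # 8 :* (κ 3 :* # 4) :+ (κ 1 :+ # 0) :* # 1 ≼ # 5 by ≡⇒≥ sum-x≡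
                  ⊹ 1 · (κ 1 :+ # 3) :* (κ 3 :* # 4) ≼ # 8 :* (κ 3 :* # 4) by scaleʳ (3 * g) k<s
                  ⊹ 1 · # 3 :* # 6 ≼ # 3 :* (κ 3 :* # 4 :+ (κ 1 :+ # 0)) by scaleˡ k (≡⇒≥ n≡)
                  ⊹ 1 · # 3 :* # 0 :+ # 2 ≼ # 4 by ≡⇒≥ eg))
              (lin (k ∷ q ∷ E ∷ h ∷ n ∷ g ∷ sum x ∷ support x ∷ []) 0 (# 0 ≼ (κ 1 :+ # 1) :* # 2 :+ # 3)
                 (1 · # 0 :* # 4 :+ κ 2 :* # 5 ≼ # 6 by bˣ
                  ⊹ 1 · # 6 ≼ # 7 :* (κ 3 :* # 5) :+ (κ 1 :+ # 1) :* # 2 by ≡⇒≤ sum-x≡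
                  ⊹ 1 · # 7 :* (κ 3 :* # 5) ≼ (κ 1 :+ # 0) :* (κ 3 :* # 5) by scaleʳ (3 * g) s≤
                  ⊹ 1 · # 0 :* (κ 3 :* # 5 :+ (κ 1 :+ # 1)) ≼ # 0 :* # 4 by scaleˡ k (≡⇒≤ n≡)
                  ⊹ 1 · # 5 ≼ # 0 :* # 1 :+ # 3 by ≡⇒≤ eg))
          decide (no s>) = few q
            (lin (g ∷ k ∷ q ∷ sum x ∷ n ∷ x X.i ∷ support x ∷ E ∷ []) 0 (κ 4 :* # 0 ≼ # 1 :* (κ 1 :+ # 2))
               (1 · # 0 :+ # 3 ≼ # 1 :* # 4 :+ # 5 by boundˣ X.i X.0<x ⊹ 1 · # 5 ≼ κ 3 :* # 0 by ≡⇒≤ xX≡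
                ⊹ 1 · # 6 :* (κ 3 :* # 0) :+ (κ 1 :+ # 2) :* # 7 ≼ # 3 by ≡⇒≥ sum-x≡
                ⊹ 1 · (κ 2 :+ # 1) :* (κ 3 :* # 0) ≼ # 6 :* (κ 3 :* # 0) by scaleʳ (3 * g) (≰⇒> s>)
                ⊹ 1 · # 1 :* # 4 ≼ # 1 :* (κ 3 :* # 0 :+ (κ 1 :+ # 2)) by scaleˡ k (≡⇒≥ n≡))) refl

      -- At the extreme part of x, `tight` reduces to 3g + z ≤ n with z taken at the extreme part of
      -- y. Multiplying by `k` and inserting g ≤ kz there gives the bound.
      slack : k * n + 2 * g ≤ sum x → k < support x → Slack k g n
      slack bˣ k<s = record
        { bound = lin (k ∷ g ∷ n ∷ z X.i ∷ z Y.i ∷ []) 0 ((κ 3 :* # 0 :+ κ 1) :* # 1 ≼ # 0 :* # 2)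
                    (1 · # 0 :* (κ 3 :* # 1 :+ # 3 :+ # 4) ≼ # 0 :* (# 2 :+ # 3) by scaleˡ k (tight X.i X.0<z)
                     ⊹ 1 · # 1 ≼ # 0 :* # 4 by Y.g≤kz)
        ; divisible = λ q h 1≤h h≤k eg en → divides-k∸h q h 1≤h h≤k eg en bˣ k<s }

  -- If the third colour is not big, then by `big` the first two share no part, which is what their
  -- extreme parts require.
  two-big : ∀ {r k g n} {x y z : Fin r → ℕ} → Table r k g n 0 x y z → 0 < g → 0 < n → 0 < k →
            k * n + 2 * g ≤ sum x → k * n + 2 * g ≤ sum y → Slack k g n
  two-big {r} {k} {g} {n} {x} {y} {z} t 0<g 0<n 0<k bˣ bʸ = decide (k * n + 2 * g ≤? sum z)
    where
    k<s : k < support x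
    k<s = ≰⇒> λ s≤k → absurd (lin (k ∷ n ∷ g ∷ sum x ∷ support x ∷ []) 0 (κ 1 ≼ κ 0)
        (1 · # 0 :* # 1 :+ κ 2 :* # 2 ≼ # 3 by bˣ ⊹ 2 · κ 1 ≼ # 2 by 0<g
         ⊹ 1 · # 3 ≼ # 4 :* # 1 by support-upper x (x≤n t 0<g)
         ⊹ 1 · # 4 :* # 1 ≼ # 0 :* # 1 by scaleʳ n s≤k))

    decide : Dec (k * n + 2 * g ≤ sum z) → Slack k g n
    decide (yes bᶻ) = three-big t 0<g 0<n 0<k bˣ bʸ bᶻ
    decide (no ¬bᶻ) = slack t 0<g 0<n 0<k (extreme t 0<g 0<n bˣ apart) (extreme (swapᵗ t) 0<g 0<n bʸ apart′) apart bˣ k<s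
      where
      disjoint : ∀ i → 0 < x i → ¬ 0 < y i
      disjoint i p q = ¬bᶻ (lin (k ∷ n ∷ g ∷ sum z ∷ []) 0 (# 0 :* # 1 :+ κ 2 :* # 2 ≼ # 3)
          (1 · # 0 :* # 1 :+ κ 2 :* # 2 :+ κ 0 :* # 1 ≼ # 3 by big t 0<g i p q))
      apart : ∀ i → 0 < x i → y i ≡ 0
      apart i p = n≤0⇒n≡0 (≮⇒≥ (disjoint i p))
      apart′ : ∀ i → 0 < y i → x i ≡ 0
      apart′ i q = n≤0⇒n≡0 (≮⇒≥ (λ p → disjoint i p q))

  module _ {r k g n e : ℕ} where

    some-partial : ∀ {x y z : Fin r → ℕ} → Table r k g n e x y z → 0 < g → 0 < n →
      ¬ (sum x ≤ k * n × sum y ≤ k * n × sum z ≤ k * n)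
    some-partial {x} {y} {z} t 0<g 0<n (p , q , s) = absurd (lin (sum x ∷ k ∷ n ∷ sum y ∷ sum z ∷ e ∷ []) 0 (κ 1
        ≼ κ 0)
        (1 · # 0 ≼ # 1 :* # 2 by p ⊹ 1 · # 3 ≼ # 1 :* # 2 by q
         ⊹ 1 · # 4 ≼ # 1 :* # 2 by s
         ⊹ 1 · κ 3 :* (# 1 :* # 2) :+ # 2 :+ # 5 :* # 2 ≼ # 0 :+ # 3 :+ # 4 by ≡⇒≥ total
         ⊹ 1 · κ 1 ≼ # 2 by 0<n))
      where open Table t

    -- A colour exceeding k n has a part it shares with a second colour, and then the third colour is big.
    large⇒big : ∀ {x y z : Fin r → ℕ} → Table r k g n e x y z → 0 < g → 0 < n → k * n < sum x →
      k * n + 2 * g + e * n ≤ sum y ⊎ k * n + 2 * g + e * n ≤ sum z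
    large⇒big {x} {y} {z} t 0<g 0<n lt =
      let (i , p , q) = partial t 0<g 0<n lt in go i p (partner t 0<g i q)
      where
      go : ∀ i → 0 < x i → 0 < y i ⊎ 0 < z i → k * n + 2 * g + e * n ≤ sum y ⊎ k * n + 2 * g + e * n ≤ sum z
      go i p (inj₁ q) = inj₂ (big t 0<g i p q)
      go i p (inj₂ q) = inj₁ (big (rotateᵗ (rotateᵗ t)) 0<g i q p)

    some-large : ∀ {x y z : Fin r → ℕ} → Table r k g n e x y z → 0 < g → 0 < n →
      k * n < sum x ⊎ k * n < sum y ⊎ k * n < sum z
    some-large {x} {y} {z} t 0<g 0<n with k * n <? sum x | k * n <? sum y | k * n <? sum z
    ... | yes p | _ | _ = inj₁ p
    ... | no _ | yes p | _ = inj₂ (inj₁ p)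
    ... | no _ | no _ | yes p = inj₂ (inj₂ p)
    ... | no p | no q | no s = ⊥-elim (some-partial t 0<g 0<n (≮⇒≥ p , ≮⇒≥ q , ≮⇒≥ s))

  -- Some colour exceeds kn, which makes another one big. That one exceeds kn as well and makes a
  -- further colour big, so two are big.
  table⇒slack : ∀ {r k g n} {x y z : Fin r → ℕ} → Table r k g n 0 x y z → 0 < g → 0 < n → 0 < k → Slack k g n
  table⇒slack {r} {k} {g} {n} t 0<g 0<n 0<k = start (some-large t 0<g 0<n)
    where
    b⇒ : ∀ {s} → k * n + 2 * g + 0 * n ≤ s → k * n + 2 * g ≤ s
    b⇒ {s} b = lin (k ∷ n ∷ g ∷ s ∷ []) 0 (# 0 :* # 1 :+ κ 2 :* # 2
        ≼ # 3) (1 · # 0 :* # 1 :+ κ 2 :* # 2 :+ κ 0 :* # 1 ≼ # 3 by b)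

    second : ∀ {x y z} → Table r k g n 0 x y z → k * n + 2 * g ≤ sum x → Slack k g n
    second {x} {y} {z} t b with large⇒big t 0<g 0<n (lin (k ∷ n ∷ sum x ∷ g ∷ []) 0 (κ 1 :+ # 0 :* # 1 ≼ # 2)
        (1 · # 0 :* # 1 :+ κ 2 :* # 3 ≼ # 2 by b ⊹ 2 · κ 1 ≼ # 3 by 0<g))
    ... | inj₁ bʸ = two-big t 0<g 0<n 0<k b (b⇒ bʸ)
    ... | inj₂ bᶻ = two-big (swapᵗ (rotateᵗ (rotateᵗ t))) 0<g 0<n 0<k b (b⇒ bᶻ)

    first : ∀ {x y z} → Table r k g n 0 x y z → k * n < sum x → Slack k g n
    first t lt with large⇒big t 0<g 0<n lt
    ... | inj₁ b = second (rotateᵗ t) (b⇒ b)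
    ... | inj₂ b = second (rotateᵗ (rotateᵗ t)) (b⇒ b)

    start : _ → Slack k g n
    start (inj₁ p) = first t p
    start (inj₂ (inj₁ p)) = first (rotateᵗ t) p
    start (inj₂ (inj₂ p)) = first (rotateᵗ (rotateᵗ t)) p

  -- With r = 3k + 2 a big colour has at least (k + 1) n + 2g vertices, more than `present` allows.
  no-table₁ : ∀ {r k g n} {x y z : Fin r → ℕ} → Table r k g n 1 x y z → 0 < g → 0 < n → ⊥
  no-table₁ {r} {k} {g} {n} t 0<g 0<n = start (some-large t 0<g 0<n)
    where
    clash : ∀ {x y z} → Table r k g n 1 x y z → k * n + 2 * g + 1 * n ≤ sum x → ⊥
    clash {x} {y} {z} t b = absurd (lin (k ∷ n ∷ g ∷ sum x ∷ []) 0 (κ 1 ≼ κ 0)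
                          (1 · # 0 :* # 1 :+ κ 2 :* # 2 :+ κ 1 :* # 1 ≼ # 3 by b
                           ⊹ 1 · # 2 :+ # 3 ≼ # 0 :* # 1 :+ # 1
                               by present t 0<g (lin (sum x ∷ k ∷ n ∷ g ∷ []) 0 (κ 1
                                   ≼ # 0) (1 · # 1 :* # 2 :+ κ 2 :* # 3 :+ κ 1 :* # 2 ≼ # 0 by b
                           ⊹ 1 · κ 1 ≼ # 2 by 0<n))
                           ⊹ 3 · κ 1 ≼ # 2 by 0<g))

    first : ∀ {x y z} → Table r k g n 1 x y z → k * n < sum x → ⊥
    first t lt with large⇒big t 0<g 0<n lt
    ... | inj₁ b = clash (rotateᵗ t) b
    ... | inj₂ b = clash (rotateᵗ (rotateᵗ t)) b

    start : _ → ⊥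
    start (inj₁ p) = first t p
    start (inj₂ (inj₁ p)) = first (rotateᵗ t) p
    start (inj₂ (inj₂ p)) = first (rotateᵗ (rotateᵗ t)) p

-- Independent classes in partite graphs, and the exclusion of hubs for r = 5 and r = 7.

module Wheels where

  open import Data.Empty using (⊥; ⊥-elim)
  open import Data.Fin.Base using (Fin)
  open import Data.Fin.Patterns
  import Data.Fin.Properties as Fin
  open import Data.List.Base using ([]; _∷_)
  open import Data.List.Relation.Unary.All using ([]; _∷_)
  open import Data.Nat
  open import Data.Nat.Properties hiding (_≟_)
  open import Data.Product using (_×_; _,_; ∃-syntax; proj₁)
  open import Data.Vec.Base using ([]; _∷_)
  open import Relation.Binary.PropositionalEquality using (_≡_; _≢_; refl; trans; cong; cong₂)
  import Relation.Binary.PropositionalEquality as ≡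
  open import Relation.Nullary using (¬_; Dec; yes; no)
  open import Relation.Nullary.Decidable using (¬?)
  open LinearArithmetic
  open Sums
  open Saturation
  open Tables

  module _ {n r : ℕ} where

    inPart : Fin r → Vertex n r → ℕ
    inPart j z = ⟦ proj₁ z Fin.≟ j ⟧

    ∑-inPart : ∀ j → ∑ (inPart j) ≡ n
    ∑-inPart j = trans (sum-cong-≗ (λ i → trans (sum-const n ⟦ i Fin.≟ j ⟧) (*-comm n ⟦ i Fin.≟ j ⟧)))
                       (sum-single j (λ _ → n))

    ∑-one : ∑ {n} {r} (λ _ → 1) ≡ r * n
    ∑-one = trans (∑-const {n} {r} 1) (*-identityʳ (r * n))

  module Partite {n r δ : ℕ} (G : BalancedPartiteGraph n r)
                 (δ≤ : ∀ v → δ ≤ Counting.deg (BalancedPartiteGraph.graph G) v) where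
    open BalancedPartiteGraph G
    open Counting graph

    private
      at : Fin r → Vertex n r → ℕ
      at = inPart

    adj⇒parts : ∀ {u v} → Adj u v → proj₁ v ≢ proj₁ u
    adj⇒parts {i , x} {.i , y} e refl = independent i x y e

    -- A vertex sees neither its class nor its part; the right side adds back their overlap.
    class-bound : {P : V → Set} (P? : ∀ v → Dec (P v)) → (∀ {u v} → P u → P v → ¬ Adj u v) →
      ∀ {v} → P v → δ + ∑ (λ z → ⟦ P? z ⟧) + n ≤ r * n + sum (λ x → ⟦ P? (proj₁ v , x) ⟧)
    class-bound {P} P? indep {v} Pv = begin
      δ + ∑ (λ z → ⟦ P? z ⟧) + n
        ≤⟨ +-mono-≤ (+-monoˡ-≤ _ (δ≤ v)) (≤-reflexive (≡.sym (∑-inPart j))) ⟩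
      deg v + ∑ (λ z → ⟦ P? z ⟧) + ∑ (at j)
        ≡⟨ cong (_+ ∑ (at j)) (∑-+ (λ z → ⟦ adj? v z ⟧) (λ z → ⟦ P? z ⟧)) ⟨
      ∑ (λ z → ⟦ adj? v z ⟧ + ⟦ P? z ⟧) + ∑ (at j)
        ≡⟨ ∑-+ (λ z → ⟦ adj? v z ⟧ + ⟦ P? z ⟧) (at j) ⟨
      ∑ (λ z → ⟦ adj? v z ⟧ + ⟦ P? z ⟧ + at j z)
        ≤⟨ ∑-mono pointwise ⟩
      ∑ (λ z → 1 + at j z * ⟦ P? z ⟧)
        ≡⟨ ∑-+ (λ _ → 1) (λ z → at j z * ⟦ P? z ⟧) ⟩
      ∑ {n} {r} (λ _ → 1) + ∑ (λ z → at j z * ⟦ P? z ⟧)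
        ≡⟨ cong₂ _+_ (∑-one {n} {r}) (∑-part j (λ z → ⟦ P? z ⟧)) ⟩
      r * n + sum (λ x → ⟦ P? (j , x) ⟧) ∎
      where
      open ≤-Reasoning
      j = proj₁ v
      pointwise : ∀ z → ⟦ adj? v z ⟧ + ⟦ P? z ⟧ + at j z ≤ 1 + at j z * ⟦ P? z ⟧
      pointwise z with adj? v z | P? z | proj₁ z Fin.≟ j
      ... | yes e | yes p | _     = ⊥-elim (indep Pv p e)
      ... | yes e | no _  | yes s = ⊥-elim (adj⇒parts e s)
      ... | yes e | no _  | no _  = ≤-refl
      ... | no _  | yes _ | yes _ = ≤-refl
      ... | no _  | yes _ | no _  = ≤-refl
      ... | no _  | no _  | yes _ = ≤-refl
      ... | no _  | no _  | no _  = z≤n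

    coloured⇒table : ∀ {k g e} (col : V → Fin 3) → (∀ {u v} → Adj u v → col u ≢ col v) →
      2 * (k * n) + g + e * n ≤ δ → r * n ≡ 3 * (k * n) + n + e * n →
      let a = λ c i → sum (λ x → ⟦ col (i , x) Fin.≟ c ⟧) in Table r k g n e (a 0F) (a 1F) (a 2F)
    coloured⇒table {k} {g} {e} col proper ≤δ rn≡ = record
      { rows   = rows
      ; total  = trans (≡.sym (trans (∑-distrib-+ (λ i → a 0F i + a 1F i) (a 2F))
                         (cong (_+ sum (a 2F)) (∑-distrib-+ (a 0F) (a 1F)))))
                       (trans (trans (sum-cong-≗ rows) (sum-const r n)) rn≡)
      ; boundˣ = bound 0F ; boundʸ = bound 1F ; boundᶻ = bound 2F }
      where
      a : Fin 3 → Fin r → ℕ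
      a c i = sum (λ x → ⟦ col (i , x) Fin.≟ c ⟧)

      one : ∀ c → ⟦ c Fin.≟ 0F ⟧ + ⟦ c Fin.≟ 1F ⟧ + ⟦ c Fin.≟ 2F ⟧ ≡ 1
      one 0F = refl
      one 1F = refl
      one 2F = refl

      rows : ∀ i → a 0F i + a 1F i + a 2F i ≡ n
      rows i = begin
        a 0F i + a 1F i + a 2F i
          ≡⟨ cong (_+ a 2F i) (∑-distrib-+ (λ x → ⟦ col (i , x) Fin.≟ 0F ⟧) (λ x → ⟦ col (i , x) Fin.≟ 1F ⟧)) ⟨
        sum (λ x → ⟦ col (i , x) Fin.≟ 0F ⟧ + ⟦ col (i , x) Fin.≟ 1F ⟧) + a 2F i
          ≡⟨ ∑-distrib-+ (λ x → ⟦ col (i , x) Fin.≟ 0F ⟧ + ⟦ col (i , x) Fin.≟ 1F ⟧) (λ x → ⟦ col (i , x) Fin.≟ 2F ⟧) ⟨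
        sum (λ x → ⟦ col (i , x) Fin.≟ 0F ⟧ + ⟦ col (i , x) Fin.≟ 1F ⟧ + ⟦ col (i , x) Fin.≟ 2F ⟧)
          ≡⟨ sum-cong-≗ (λ x → one (col (i , x))) ⟩
        sum {n} (λ _ → 1)
          ≡⟨ trans (sum-const n 1) (*-identityʳ n) ⟩
        n ∎
        where open ≡.≡-Reasoning

      bound : ∀ c i → 0 < a c i → g + sum (a c) ≤ k * n + a c i
      bound c i p with 0<sum⇒∃ (λ x → ⟦ col (i , x) Fin.≟ c ⟧) p
      ... | x , q = arith (class-bound (λ v → col v Fin.≟ c) (λ p q e → proper e (trans p (≡.sym q)))
                                      {i , x} (⟦⟧-pos (col (i , x) Fin.≟ c) q))
        where
        arith : ∀ {s t} → δ + s + n ≤ r * n + t → g + s ≤ k * n + t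
        arith {s} {t} le = lin (g ∷ s ∷ k ∷ n ∷ t ∷ δ ∷ r ∷ e ∷ []) 0 (# 0 :+ # 1 ≼ # 2 :* # 3 :+ # 4)
                     (1 · # 5 :+ # 1 :+ # 3 ≼ # 6 :* # 3 :+ # 4 by le
                      ⊹ 1 · κ 2 :* (# 2 :* # 3) :+ # 0 :+ # 7 :* # 3 ≼ # 5 by ≤δ
                      ⊹ 1 · # 6 :* # 3 ≼ κ 3 :* (# 2 :* # 3) :+ # 3 :+ # 7 :* # 3 by ≡⇒≤ rn≡)

  module HubCase {n r δ : ℕ} (G : BalancedPartiteGraph n r)
                 (δ≤ : ∀ v → δ ≤ Counting.deg (BalancedPartiteGraph.graph G) v)
                 (H : SimpleGraph (Vertex n r)) (G⊆H : BalancedPartiteGraph.graph G ⊆ᵍ H) (k₄ : K₄-free H)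
                 {h c₀ c₁ c₂ c₃ c₄ : Vertex n r} (W : Wheel H h c₀ c₁ c₂ c₃ c₄)
                 (indep : ∀ {w w′} → ¬ SimpleGraph.Adj H h w → ¬ SimpleGraph.Adj H h w′ → ¬ SimpleGraph.Adj H w w′)
                 where
    open BalancedPartiteGraph G using (Adj; adj?; graph)
    open Counting graph
    open SimpleGraph H using () renaming (Adj to _~_; adj? to _~?_; sym to ~-sym; irrefl to ~-irrefl)
    open Partite G δ≤

    private
      at : Fin r → Vertex n r → ℕ
      at = inPart

      L : Vertex n r → ℕ
      L z = ⟦ h ~? z ⟧

      B : Vertex n r → ℕ
      B z = ⟦ ¬? (h ~? z) ⟧

      ℓ b : ℕ
      ℓ = ∑ L
      b = ∑ B

      b⟨_⟩ : Fin r → ℕ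
      b⟨ j ⟩ = sum (λ x → B (j , x))

      -- Degrees inside the neighbourhood of `h`, which is triangle-free because `H` has no K₄.
      deg′ : Vertex n r → ℕ
      deg′ v = ∑ (λ z → L z * ⟦ v ~? z ⟧)

    ℓ+b : ℓ + b ≡ r * n
    ℓ+b = trans (≡.sym (∑-+ L B)) (trans (sum-cong-≗ (λ i → sum-cong-≗ (λ x → one (i , x)))) (∑-one {n} {r}))
      where
      one : ∀ z → L z + B z ≡ 1
      one z with h ~? z
      ... | yes _ = refl
      ... | no _  = refl

    touched : ∀ {w} → ¬ h ~ w → δ + b + n ≤ r * n + b⟨ proj₁ w ⟩
    touched = class-bound (λ z → ¬? (h ~? z)) (λ p q e → indep p q (G⊆H e))

    -- The neighbours of `v` in `G` avoid its own part, so at most `b` minus `b⟨ j ⟩` of them are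
    -- missed by `h`.
    deg′-lower : ∀ v → δ + b⟨ proj₁ v ⟩ ≤ deg′ v + b
    deg′-lower v = begin
      δ + b⟨ j ⟩                                        ≤⟨ +-monoˡ-≤ _ (δ≤ v) ⟩
      deg v + b⟨ j ⟩                                    ≡⟨ cong (deg v +_) (∑-part j B) ⟨
      deg v + ∑ (λ z → at j z * B z)                    ≡⟨ ∑-+ (λ z → ⟦ adj? v z ⟧) (λ z → at j z * B z) ⟨
      ∑ (λ z → ⟦ adj? v z ⟧ + at j z * B z)             ≤⟨ ∑-mono pointwise ⟩
      ∑ (λ z → L z * ⟦ v ~? z ⟧ + B z)                  ≡⟨ ∑-+ (λ z → L z * ⟦ v ~? z ⟧) B ⟩
      deg′ v + b                                        ∎
      where
      open ≤-Reasoning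
      j = proj₁ v
      pointwise : ∀ z → ⟦ adj? v z ⟧ + at j z * B z ≤ L z * ⟦ v ~? z ⟧ + B z
      pointwise z with adj? v z | proj₁ z Fin.≟ j | h ~? z | v ~? z
      ... | yes e | yes s | _     | _     = ⊥-elim (adj⇒parts e s)
      ... | yes e | no _  | _     | no ¬e = ⊥-elim (¬e (G⊆H e))
      ... | yes _ | no _  | yes _ | yes _ = ≤-refl
      ... | yes _ | no _  | no _  | yes _ = ≤-refl
      ... | no _  | no _  | _     | _     = z≤n
      ... | no _  | yes _ | yes _ | _     = z≤n
      ... | no _  | yes _ | no _  | _     = ≤-refl

    Disjoint : Vertex n r → Vertex n r → Set
    Disjoint u v = ∀ z → L z * ⟦ u ~? z ⟧ + L z * ⟦ v ~? z ⟧ ≤ L z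

    disjoint : ∀ {u v} → (∀ {z} → h ~ z → u ~ z → v ~ z → ⊥) → Disjoint u v
    disjoint {u} {v} f z with h ~? z | u ~? z | v ~? z
    ... | no _  | _     | _     = z≤n
    ... | yes a | yes p | yes q = ⊥-elim (f a p q)
    ... | yes _ | yes _ | no _  = ≤-refl
    ... | yes _ | no _  | yes _ = ≤-refl
    ... | yes _ | no _  | no _  = z≤n

    edge-disjoint : ∀ {u v} → h ~ u → h ~ v → u ~ v → Disjoint u v
    edge-disjoint hu hv uv = disjoint (λ hz uz vz → k₄ hu hv hz uv uz vz)

    private
      ∑-L* : ∀ c → ∑ (λ z → c * L z) ≡ c * ℓ
      ∑-L* c = ∑-* c L

      N : Vertex n r → Vertex n r → ℕ
      N v z = L z * ⟦ v ~? z ⟧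

      L≤1 : ∀ z → L z ≤ 1
      L≤1 z = ⟦⟧≤1 (h ~? z)

    pair : ∀ {u v} → Disjoint u v → deg′ u + deg′ v ≤ ℓ
    pair {u} {v} uv = ≤-trans (≤-reflexive (≡.sym (∑-+ (N u) (N v)))) (∑-mono uv)

    triple : ∀ {u v w} → Disjoint u v → Disjoint u w → Disjoint v w → deg′ u + deg′ v + deg′ w ≤ ℓ
    triple {u} {v} {w} uv uw vw = begin
      deg′ u + deg′ v + deg′ w             ≡⟨ cong (_+ deg′ w) (∑-+ (N u) (N v)) ⟨
      ∑ (λ z → N u z + N v z) + deg′ w     ≡⟨ ∑-+ (λ z → N u z + N v z) (N w) ⟨
      ∑ (λ z → N u z + N v z + N w z)      ≤⟨ ∑-mono pointwise ⟩
      ℓ                                    ∎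
      where
      open ≤-Reasoning
      -- At a single vertex the pair bounds add up to 2 (p + q + s) ≤ 3l ≤ 2l + 1, since l ≤ 1;
      -- rounding does the rest.
      round : ∀ l p q s → l ≤ 1 → p + q ≤ l → p + s ≤ l → q + s ≤ l → p + q + s ≤ l
      round l p q s a b c d = lin (p ∷ q ∷ s ∷ l ∷ []) 1 (# 0 :+ # 1 :+ # 2 ≼ # 3)
          (1 · # 3 ≼ κ 1 by a ⊹ 1 · # 0 :+ # 1 ≼ # 3 by b ⊹ 1 · # 0 :+ # 2 ≼ # 3 by c
           ⊹ 1 · # 1 :+ # 2 ≼ # 3 by d)
      pointwise : ∀ z → N u z + N v z + N w z ≤ L z
      pointwise z = round (L z) (N u z) (N v z) (N w z) (L≤1 z) (uv z) (uw z) (vw z)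

    -- Consecutive neighbourhoods are disjoint around a cycle of length five, so a vertex lies in at
    -- most two of them. The five vertices may repeat: closed walks of length five serve as well.
    pentagon : ∀ {u v w x y} → Disjoint u v → Disjoint v w → Disjoint w x → Disjoint x y → Disjoint y u →
               deg′ u + deg′ v + deg′ w + deg′ x + deg′ y ≤ 2 * ℓ
    pentagon {u} {v} {w} {x} {y} uv vw wx xy yu = begin
      deg′ u + deg′ v + deg′ w + deg′ x + deg′ y
        ≡⟨ cong (λ s → s + deg′ w + deg′ x + deg′ y) (∑-+ (N u) (N v)) ⟨
      ∑ (λ z → N u z + N v z) + deg′ w + deg′ x + deg′ y
        ≡⟨ cong (λ s → s + deg′ x + deg′ y) (∑-+ (λ z → N u z + N v z) (N w)) ⟨
      ∑ (λ z → N u z + N v z + N w z) + deg′ x + deg′ y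
        ≡⟨ cong (_+ deg′ y) (∑-+ (λ z → N u z + N v z + N w z) (N x)) ⟨
      ∑ (λ z → N u z + N v z + N w z + N x z) + deg′ y
        ≡⟨ ∑-+ (λ z → N u z + N v z + N w z + N x z) (N y) ⟨
      ∑ (λ z → N u z + N v z + N w z + N x z + N y z)
        ≤⟨ ∑-mono pointwise ⟩
      ∑ (λ z → 2 * L z)
        ≡⟨ ∑-L* 2 ⟩
      2 * ℓ ∎
      where
      open ≤-Reasoning
      round : ∀ l p q s t u → l ≤ 1 → p + q ≤ l → q + s ≤ l → s + t ≤ l → t + u ≤ l → u + p ≤ l →
              p + q + s + t + u ≤ 2 * l
      round l p q s t u a b c d e f = lin (p ∷ q ∷ s ∷ t ∷ u ∷ l ∷ []) 1 (# 0 :+ # 1 :+ # 2 :+ # 3 :+ # 4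
          ≼ κ 2 :* # 5)
          (1 · # 5 ≼ κ 1 by a ⊹ 1 · # 0 :+ # 1 ≼ # 5 by b ⊹ 1 · # 1 :+ # 2 ≼ # 5 by c
           ⊹ 1 · # 2 :+ # 3 ≼ # 5 by d ⊹ 1 · # 3 :+ # 4 ≼ # 5 by e ⊹ 1 · # 4 :+ # 0 ≼ # 5 by f)
      pointwise : ∀ z → N u z + N v z + N w z + N x z + N y z ≤ 2 * L z
      pointwise z = round (L z) (N u z) (N v z) (N w z) (N x z) (N y z) (L≤1 z) (uv z) (vw z) (wx z) (xy z) (yu z)

    b⟨⟩≤n : ∀ j → b⟨ j ⟩ ≤ n
    b⟨⟩≤n j = ≤-trans (sum-mono (λ x → ⟦⟧≤1 (¬? (h ~? (j , x))))) (≤-reflexive (trans (sum-const n 1) (*-identityʳ n)))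

    neighbour-in : ∀ j → b⟨ j ⟩ < n → ∃[ x ] h ~ (j , x)
    neighbour-in j lt with sum-<⇒∃ {f = λ x → B (j , x)} {λ _ → 1}
      (<-≤-trans lt (≤-reflexive (≡.sym (trans (sum-const n 1) (*-identityʳ n)))))
    ... | x , p = x , outside p
      where
      outside : ∀ {z} → B z < 1 → h ~ z
      outside {z} p with h ~? z
      ... | yes q = q
      ... | no _ = ⊥-elim (<-irrefl refl p)

    missed-outside : ∀ i j → b⟨ i ⟩ + b⟨ j ⟩ < b → ∃[ w ] ¬ h ~ w × proj₁ w ≢ i × proj₁ w ≢ j
    missed-outside i j lt with ∑-<⇒∃ {n} {r} {λ z → at i z * B z + at j z * B z} {B} (≤-<-trans (≤-reflexive eq) lt)
      where
      eq : ∑ (λ z → at i z * B z + at j z * B z) ≡ b⟨ i ⟩ + b⟨ j ⟩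
      eq = trans (∑-+ (λ z → at i z * B z) (λ z → at j z * B z)) (cong₂ _+_ (∑-part i B) (∑-part j B))
    ... | w , p = w , split p
      where
      split : at i w * B w + at j w * B w < B w → ¬ h ~ w × proj₁ w ≢ i × proj₁ w ≢ j
      split p with h ~? w | proj₁ w Fin.≟ i | proj₁ w Fin.≟ j
      ... | no q | no s  | no t  = q , s , t
      ... | no q | yes s | _     = ⊥-elim (<⇒≱ p (s≤s z≤n))
      ... | no q | no s  | yes t = ⊥-elim (<⇒≱ p (s≤s z≤n))
      ... | yes q | yes s | yes t = ⊥-elim (<⇒≱ p z≤n)
      ... | yes q | yes s | no t  = ⊥-elim (<⇒≱ p z≤n)
      ... | yes q | no s  | yes t = ⊥-elim (<⇒≱ p z≤n)
      ... | yes q | no s  | no t  = ⊥-elim (<⇒≱ p z≤n)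

    missed-outside₁ : ∀ j → b⟨ j ⟩ < b → ∃[ w ] ¬ h ~ w × proj₁ w ≢ j
    missed-outside₁ j lt with ∑-<⇒∃ {n} {r} {λ z → at j z * B z} {B} (≤-<-trans (≤-reflexive (∑-part j B)) lt)
    ... | w , p = w , split p
      where
      split : at j w * B w < B w → ¬ h ~ w × proj₁ w ≢ j
      split p with h ~? w | proj₁ w Fin.≟ j
      ... | no q  | no s  = q , s
      ... | no q  | yes s = ⊥-elim (<⇒≱ p (s≤s z≤n))
      ... | yes q | yes s = ⊥-elim (<⇒≱ p z≤n)
      ... | yes q | no s  = ⊥-elim (<⇒≱ p z≤n)

    three-parts : ∀ {i j l} → i ≢ j → i ≢ l → j ≢ l → b⟨ i ⟩ + b⟨ j ⟩ + b⟨ l ⟩ ≤ b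
    three-parts {i} {j} {l} i≢j i≢l j≢l = begin
      b⟨ i ⟩ + b⟨ j ⟩ + b⟨ l ⟩
        ≡⟨ cong₂ _+_ (cong₂ _+_ (∑-part i B) (∑-part j B)) (∑-part l B) ⟨
      ∑ (λ z → at i z * B z) + ∑ (λ z → at j z * B z) + ∑ (λ z → at l z * B z)
        ≡⟨ cong (_+ ∑ (λ z → at l z * B z)) (∑-+ (λ z → at i z * B z) (λ z → at j z * B z)) ⟨
      ∑ (λ z → at i z * B z + at j z * B z) + ∑ (λ z → at l z * B z)
        ≡⟨ ∑-+ (λ z → at i z * B z + at j z * B z) (λ z → at l z * B z) ⟨
      ∑ (λ z → at i z * B z + at j z * B z + at l z * B z)
        ≤⟨ ∑-mono pointwise ⟩
      b ∎
      where
      open ≤-Reasoning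
      pointwise : ∀ z → at i z * B z + at j z * B z + at l z * B z ≤ B z
      pointwise z with proj₁ z Fin.≟ i | proj₁ z Fin.≟ j | proj₁ z Fin.≟ l
      ... | yes p | yes q | _     = ⊥-elim (i≢j (trans (≡.sym p) q))
      ... | yes p | no _  | yes q = ⊥-elim (i≢l (trans (≡.sym p) q))
      ... | no _  | yes p | yes q = ⊥-elim (j≢l (trans (≡.sym p) q))
      ... | yes _ | no _  | no _  = ≤-reflexive (trans (+-identityʳ _) (trans (+-identityʳ _) (+-identityʳ _)))
      ... | no _  | yes _ | no _  = ≤-reflexive (trans (+-identityʳ _) (+-identityʳ _))
      ... | no _  | no _  | yes _ = ≤-reflexive (+-identityʳ _)
      ... | no _  | no _  | no _  = z≤n

    two-parts : ∀ {i j} → i ≢ j → b⟨ i ⟩ + b⟨ j ⟩ ≤ b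
    two-parts {i} {j} i≢j = begin
      b⟨ i ⟩ + b⟨ j ⟩                               ≡⟨ cong₂ _+_ (∑-part i B) (∑-part j B) ⟨
      ∑ (λ z → at i z * B z) + ∑ (λ z → at j z * B z) ≡⟨ ∑-+ (λ z → at i z * B z) (λ z → at j z * B z) ⟨
      ∑ (λ z → at i z * B z + at j z * B z)         ≤⟨ ∑-mono pointwise ⟩
      b                                             ∎
      where
      open ≤-Reasoning
      pointwise : ∀ z → at i z * B z + at j z * B z ≤ B z
      pointwise z with proj₁ z Fin.≟ i | proj₁ z Fin.≟ j
      ... | yes p | yes q = ⊥-elim (i≢j (trans (≡.sym p) q))
      ... | yes _ | no _  = ≤-reflexive (trans (+-identityʳ _) (+-identityʳ _))
      ... | no _  | yes _ = ≤-reflexive (+-identityʳ _)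
      ... | no _  | no _  = z≤n

    neighbour : ∀ v → 0 < deg′ v → ∃[ z ] h ~ z × v ~ z
    neighbour v lt with ∑-<⇒∃ {n} {r} {λ _ → 0} {N v}
      (≤-<-trans (≤-reflexive (trans (∑-const {n} {r} 0) (*-zeroʳ (r * n)))) lt)
    ... | z , p = z , split p
      where
      split : 0 < N v z → h ~ z × v ~ z
      split p with h ~? z | v ~? z
      ... | yes q | yes s = q , s
      ... | yes q | no _ = ⊥-elim (<-irrefl refl p)
      ... | no _  | yes _ = ⊥-elim (<-irrefl refl p)
      ... | no _  | no _  = ⊥-elim (<-irrefl refl p)

    lower : ∀ j x → δ + b⟨ j ⟩ ≤ deg′ (j , x) + b
    lower j x = deg′-lower (j , x)

    open Wheel W

    -- An edge in the neighbourhood of `h` forces `b` to be at least n + 2 plus the numbers missed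
    -- in the parts of its ends, while `bh` allows less than n + `b⟨ i ⟩`. So an edge with an end in
    -- the part of `h` itself is contradictory; only saturation can make that end a neighbour of
    -- `h`.
    five-parts : r * n ≡ 5 * n → ¬ (3 * n + 1 ≤ δ)
    five-parts rn≡ ≤δ = step₁ (missed-outside₁ i (lin (b⟨ i ⟩ ∷ b ∷ n ∷ b⟨ proj₁ c₀ ⟩ ∷ b⟨ proj₁ c₁ ⟩ ∷ []) 0
        (κ 1 :+ # 0 ≼ # 1)
        (1 · # 2 :+ κ 2 :+ # 3 :+ # 4 ≼ # 1 by edge s₀ s₁ r₀
         ⊹ 1 · # 0 ≼ # 2 by b⟨⟩≤n i)))
      where
      i = proj₁ h
      bh : δ + b + n ≤ r * n + b⟨ i ⟩
      bh = touched (~-irrefl {h} refl)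

      edge : ∀ {u v} → h ~ u → h ~ v → u ~ v → n + 2 + b⟨ proj₁ u ⟩ + b⟨ proj₁ v ⟩ ≤ b
      edge {u} {v} hu hv uv = lin (n ∷ b⟨ proj₁ u ⟩ ∷ b⟨ proj₁ v ⟩ ∷ b ∷ deg′ u ∷ deg′ v ∷ ℓ ∷ δ ∷ r ∷ []) 0
          (# 0 :+ κ 2 :+ # 1 :+ # 2 ≼ # 3)
          (1 · # 4 :+ # 5 ≼ # 6 by pair (edge-disjoint hu hv uv)
           ⊹ 1 · # 7 :+ # 1 ≼ # 4 :+ # 3 by deg′-lower u ⊹ 1 · # 7 :+ # 2 ≼ # 5 :+ # 3 by deg′-lower v
           ⊹ 2 · κ 3 :* # 0 :+ κ 1 ≼ # 7 by ≤δ ⊹ 1 · # 6 :+ # 3 ≼ # 8 :* # 0 by ≡⇒≤ ℓ+b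
           ⊹ 1 · # 8 :* # 0 ≼ κ 5 :* # 0 by ≡⇒≤ rn≡)

      step₃ : ∀ {j} → n + 2 + b⟨ i ⟩ + b⟨ j ⟩ ≤ b → ⊥
      step₃ {j} e = absurd (lin (n ∷ b⟨ i ⟩ ∷ b⟨ j ⟩ ∷ b ∷ δ ∷ r ∷ []) 0 (κ 1 ≼ κ 0)
                          (1 · # 0 :+ κ 2 :+ # 1 :+ # 2 ≼ # 3 by e
                           ⊹ 1 · # 4 :+ # 3 :+ # 0 ≼ # 5 :* # 0 :+ # 1 by bh
                           ⊹ 1 · κ 3 :* # 0 :+ κ 1 ≼ # 4 by ≤δ ⊹ 1 · # 5 :* # 0 ≼ κ 5 :* # 0 by ≡⇒≤ rn≡))

      step₂ : (∃[ x ] h ~ (i , x)) → ⊥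
      step₂ (x , hx) = let (y , hy , xy) = neighbour (i , x) (lin (deg′ (i , x) ∷ δ ∷ b ∷ n ∷ r ∷ b⟨ i ⟩ ∷ []) 0
                               (κ 1 ≼ # 0)
                                                                (1 · # 1 :+ # 2 :+ # 3 ≼ # 4 :* # 3 :+ # 5 by bh
                                                                 ⊹ 2 · κ 3 :* # 3 :+ κ 1 ≼ # 1 by ≤δ
                                                                 ⊹ 1 · # 4 :* # 3 ≼ κ 5 :* # 3 by ≡⇒≤ rn≡
                                                                 ⊹ 1 · # 1 :+ # 5 ≼ # 0 :+ # 2 by lower i x))
                       in step₃ (edge hx hy xy)

      step₁ : (∃[ w ] ¬ h ~ w × proj₁ w ≢ i) → ⊥
      -- A missed vertex in another part gives `b⟨ i ⟩` + `b⟨ proj₁ w ⟩` ≤ `b` < n + `b⟨ proj₁ w ⟩`,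
      -- so the part of `h` is not missed entirely.
      step₁ (w , hw , w≢i) = step₂ (neighbour-in i
        (lin (b⟨ i ⟩ ∷ n ∷ δ ∷ b ∷ r ∷ b⟨ proj₁ w ⟩ ∷ []) 0 (κ 1 :+ # 0 ≼ # 1)
           (1 · # 2 :+ # 3 :+ # 1 ≼ # 4 :* # 1 :+ # 5 by touched hw ⊹ 1 · κ 3 :* # 1 :+ κ 1 ≼ # 2 by ≤δ
            ⊹ 1 · # 4 :* # 1 ≼ κ 5 :* # 1 by ≡⇒≤ rn≡
            ⊹ 1 · # 0 :+ # 5 ≼ # 3 by two-parts (λ e → w≢i (≡.sym e)))))

    module _ {g : ℕ} (rn≡ : r * n ≡ 7 * n) (≤δ : 4 * n + g ≤ δ) (dense : 2 * n < 9 * g) where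

      private
        -- Around the rim, `pentagon` gives 5δ - 5b ≤ 2ℓ = 14n - 2b, where δ ≥ 4n + g.
        6n≤3b : 6 * n + 5 * g ≤ 3 * b
        6n≤3b = lin (n ∷ g ∷ b ∷ deg′ c₀ ∷ deg′ c₁ ∷ deg′ c₂ ∷ deg′ c₃ ∷ deg′ c₄ ∷ ℓ ∷ δ ∷ b⟨ proj₁ c₀ ⟩ ∷ b⟨ proj₁ c₁ ⟩ ∷ b⟨ proj₁ c₂ ⟩ ∷ b⟨ proj₁ c₃ ⟩ ∷ b⟨ proj₁ c₄ ⟩ ∷ r ∷ []) 0 (κ 6 :* # 0 :+ κ 5 :* # 1 ≼ κ 3 :* # 2)
                  (1 · # 3 :+ # 4 :+ # 5 :+ # 6 :+ # 7 ≼ κ 2 :* # 8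
                      by pentagon (edge-disjoint s₀ s₁ r₀) (edge-disjoint s₁ s₂ r₁) (edge-disjoint s₂ s₃ r₂) (edge-disjoint s₃ s₄ r₃) (edge-disjoint s₄ s₀ r₄)
                   ⊹ 1 · # 9 :+ # 10 ≼ # 3 :+ # 2 by deg′-lower c₀
                   ⊹ 1 · # 9 :+ # 11 ≼ # 4 :+ # 2 by deg′-lower c₁
                   ⊹ 1 · # 9 :+ # 12 ≼ # 5 :+ # 2 by deg′-lower c₂
                   ⊹ 1 · # 9 :+ # 13 ≼ # 6 :+ # 2 by deg′-lower c₃
                   ⊹ 1 · # 9 :+ # 14 ≼ # 7 :+ # 2 by deg′-lower c₄ ⊹ 5 · κ 4 :* # 0 :+ # 1 ≼ # 9 by ≤δ
                   ⊹ 2 · # 8 :+ # 2 ≼ # 15 :* # 0 by ≡⇒≤ ℓ+b ⊹ 2 · # 15 :* # 0 ≼ κ 7 :* # 0 by ≡⇒≤ rn≡)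

        touched₇ : ∀ {w} → ¬ h ~ w → b + g ≤ 2 * n + b⟨ proj₁ w ⟩
        touched₇ {w} hw = lin (b ∷ g ∷ n ∷ b⟨ proj₁ w ⟩ ∷ δ ∷ r ∷ []) 0 (# 0 :+ # 1 ≼ κ 2 :* # 2 :+ # 3)
                        (1 · # 4 :+ # 0 :+ # 2 ≼ # 5 :* # 2 :+ # 3 by touched hw
                         ⊹ 1 · κ 4 :* # 2 :+ # 1 ≼ # 4 by ≤δ
                         ⊹ 1 · # 5 :* # 2 ≼ κ 7 :* # 2 by ≡⇒≤ rn≡)

        -- x has so many neighbours in N(h) that exactly one end of each edge in N(h)
        -- has a common neighbour with x there; hence N(h) contains no odd closed walk.
        bipartite : ∀ {x} → h ~ x → 2 * n + 2 * g ≤ deg′ x → 2 * b + 3 * g ≤ 6 * n → ⊥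
        bipartite {x} hx x≥ b≤ = ¬¬even (λ p → ¬even p p)
          where
          P : Vertex n r → Set
          P u = ∃[ y ] h ~ y × x ~ y × u ~ y

          low : ∀ u → 4 * n + g ≤ deg′ u + b
          low u = lin (n ∷ g ∷ deg′ u ∷ b ∷ δ ∷ b⟨ proj₁ u ⟩ ∷ []) 0 (κ 4 :* # 0 :+ # 1 ≼ # 2 :+ # 3)
                    (1 · # 4 :+ # 5 ≼ # 2 :+ # 3 by deg′-lower u ⊹ 1 · κ 4 :* # 0 :+ # 1 ≼ # 4 by ≤δ)

          -- Otherwise x, y, u, v, y′ is a closed walk of length five in the neighbourhood of `h`.
          -- With the high degree of `x`, `pentagon` yields 4n + 6g ≤ 2b, against 2b + 3g ≤ 6n and
          -- 2n < 9g.
          alternate : ∀ {u v} → h ~ u → h ~ v → u ~ v → P u → ¬ P v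
          alternate {u} {v} hu hv uv (y , hy , xy , uy) (y′ , hy′ , xy′ , vy′) = absurd
            (lin (deg′ x ∷ deg′ y ∷ deg′ u ∷ deg′ v ∷ deg′ y′ ∷ ℓ ∷ n ∷ g ∷ b ∷ r ∷ []) 0 (κ 1 ≼ κ 0)
               (1 · # 0 :+ # 1 :+ # 2 :+ # 3 :+ # 4 ≼ κ 2 :* # 5
                   by pentagon (edge-disjoint hx hy xy) (edge-disjoint hy hu (~-sym uy)) (edge-disjoint hu hv uv) (edge-disjoint hv hy′ vy′) (edge-disjoint hy′ hx (~-sym xy′))
                ⊹ 1 · κ 2 :* # 6 :+ κ 2 :* # 7 ≼ # 0 by x≥ ⊹ 1 · κ 4 :* # 6 :+ # 7 ≼ # 1 :+ # 8 by low y
                ⊹ 1 · κ 4 :* # 6 :+ # 7 ≼ # 2 :+ # 8 by low u ⊹ 1 · κ 4 :* # 6 :+ # 7 ≼ # 3 :+ # 8 by low v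
                ⊹ 1 · κ 4 :* # 6 :+ # 7 ≼ # 4 :+ # 8 by low y′ ⊹ 2 · # 5 :+ # 8 ≼ # 9 :* # 6 by ≡⇒≤ ℓ+b
                ⊹ 2 · # 9 :* # 6 ≼ κ 7 :* # 6 by ≡⇒≤ rn≡ ⊹ 1 · κ 2 :* # 8 :+ κ 3 :* # 7 ≼ κ 6 :* # 6 by b≤
                ⊹ 1 · κ 1 :+ κ 2 :* # 6 ≼ κ 9 :* # 7 by dense))

          -- Otherwise `x`, `u` and `v` have pairwise disjoint neighbourhoods there, which requires
          -- 3n + 4g ≤ `b`, more than `b≤` permits.
          alternate′ : ∀ {u v} → h ~ u → h ~ v → u ~ v → ¬ P u → ¬ ¬ P v
          alternate′ {u} {v} hu hv uv ¬Pu ¬Pv = absurd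
            (lin (deg′ x ∷ deg′ u ∷ deg′ v ∷ ℓ ∷ n ∷ g ∷ b ∷ r ∷ []) 1 (κ 1 ≼ κ 0)
               (2 · # 0 :+ # 1 :+ # 2 ≼ # 3
                   by triple (disjoint {x} {u} (λ hz xz uz → ¬Pu (_ , hz , xz , uz))) (disjoint {x} {v} (λ hz xz vz → ¬Pv (_ , hz , xz , vz))) (edge-disjoint hu hv uv)
                ⊹ 2 · κ 2 :* # 4 :+ κ 2 :* # 5 ≼ # 0 by x≥ ⊹ 2 · κ 4 :* # 4 :+ # 5 ≼ # 1 :+ # 6 by low u
                ⊹ 2 · κ 4 :* # 4 :+ # 5 ≼ # 2 :+ # 6 by low v ⊹ 2 · # 3 :+ # 6 ≼ # 7 :* # 4 by ≡⇒≤ ℓ+b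
                ⊹ 2 · # 7 :* # 4 ≼ κ 7 :* # 4 by ≡⇒≤ rn≡ ⊹ 1 · κ 2 :* # 6 :+ κ 3 :* # 5 ≼ κ 6 :* # 4 by b≤
                ⊹ 1 · κ 1 :+ κ 2 :* # 4 ≼ κ 9 :* # 5 by dense))

          ¬even : P c₀ → ¬ P c₀
          ¬even p₀ q₀ = alternate′ s₁ s₂ r₁ (alternate s₀ s₁ r₀ p₀) λ p₂ →
            alternate′ s₃ s₄ r₃ (alternate s₂ s₃ r₂ p₂) λ p₄ → alternate s₄ s₀ r₄ p₄ q₀

          ¬¬even : ¬ ¬ P c₀
          ¬¬even q₀ = alternate′ s₀ s₁ r₀ q₀ λ p₁ →
            alternate′ s₂ s₃ r₂ (alternate s₁ s₂ r₁ p₁) λ p₃ →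
            alternate′ s₄ s₀ r₄ (alternate s₃ s₄ r₃ p₃) q₀

        finish : ∀ j → b⟨ j ⟩ < n → b + g ≤ 2 * n + b⟨ j ⟩ → 2 * b + 3 * g ≤ 6 * n → ⊥
        finish j lt t b≤ =
          let (x , hx) = neighbour-in j lt
          in bipartite hx (lin (n ∷ g ∷ deg′ (j , x) ∷ δ ∷ b⟨ j ⟩ ∷ b ∷ []) 0 (κ 2 :* # 0 :+ κ 2 :* # 1 ≼ # 2)
                  (1 · # 3 :+ # 4 ≼ # 2 :+ # 5 by lower j x ⊹ 1 · κ 4 :* # 0 :+ # 1 ≼ # 3 by ≤δ
                   ⊹ 1 · # 5 :+ # 1 ≼ κ 2 :* # 0 :+ # 4 by t)) b≤

      -- By `6n≤3b` more than 2n vertices are missed, so they meet three parts. The first two of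
      -- these cannot both be missed entirely, and one that is not contains a neighbour of `h` with
      -- the degree that `bipartite` asks for.
      seven-parts : ⊥
      seven-parts =
        let i = proj₁ h
            t₁ = touched₇ (~-irrefl {h} refl)
            (w₂ , hw₂ , w₂≢) = missed-outside₁ i (lin (b⟨ i ⟩ ∷ b ∷ n ∷ g ∷ []) 2 (κ 1 :+ # 0 ≼ # 1)
                (1 · κ 6 :* # 2 :+ κ 5 :* # 3 ≼ κ 3 :* # 1 by 6n≤3b
                 ⊹ 3 · # 0 ≼ # 2 by b⟨⟩≤n i ⊹ 5 · κ 1 ≼ # 3 by 0<g))
            j = proj₁ w₂
            t₂ = touched₇ hw₂
            (w₃ , hw₃ , w₃≢i , w₃≢j) = missed-outside i j (lin (b⟨ i ⟩ ∷ b⟨ j ⟩ ∷ b ∷ n ∷ g ∷ []) 2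
                (κ 1 :+ (# 0 :+ # 1) ≼ # 2)
                (1 · κ 6 :* # 3 :+ κ 5 :* # 4 ≼ κ 3 :* # 2 by 6n≤3b
                 ⊹ 3 · # 0 ≼ # 3 by b⟨⟩≤n i ⊹ 3 · # 1 ≼ # 3 by b⟨⟩≤n j
                 ⊹ 5 · κ 1 ≼ # 4 by 0<g))
            t₃ = touched₇ hw₃
            i≢j = λ e → w₂≢ (≡.sym e)
            s = three-parts i≢j (λ e → w₃≢i (≡.sym e)) (λ e → w₃≢j (≡.sym e))
            b≤ = spread t₁ t₂ t₃ s
        in choose t₁ t₂ t₃ s b≤ (b⟨ i ⟩ <? n) (b⟨ j ⟩ <? n)
        where
        0<g : 0 < g
        0<g = lin (g ∷ n ∷ []) 8 (κ 1 ≼ # 0) (1 · κ 1 :+ κ 2 :* # 1 ≼ κ 9 :* # 0 by dense)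

        spread : ∀ {p q s} → b + g ≤ 2 * n + p → b + g ≤ 2 * n + q → b + g ≤ 2 * n + s → p + q + s ≤ b → 2 * b + 3 * g ≤ 6 * n
        spread {p} {q} {s} t₁ t₂ t₃ h = lin (b ∷ g ∷ n ∷ p ∷ q ∷ s ∷ []) 0 (κ 2 :* # 0 :+ κ 3 :* # 1 ≼ κ 6 :* # 2)
            (1 · # 0 :+ # 1 ≼ κ 2 :* # 2 :+ # 3 by t₁ ⊹ 1 · # 0 :+ # 1 ≼ κ 2 :* # 2 :+ # 4 by t₂
             ⊹ 1 · # 0 :+ # 1 ≼ κ 2 :* # 2 :+ # 5 by t₃ ⊹ 1 · # 3 :+ # 4 :+ # 5 ≼ # 0 by h)

        choose : ∀ {i j l} → b + g ≤ 2 * n + b⟨ i ⟩ → b + g ≤ 2 * n + b⟨ j ⟩ → b + g ≤ 2 * n + b⟨ l ⟩ →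
          b⟨ i ⟩ + b⟨ j ⟩ + b⟨ l ⟩ ≤ b → 2 * b + 3 * g ≤ 6 * n → Dec (b⟨ i ⟩ < n) → Dec (b⟨ j ⟩ < n) → ⊥
        choose {i} t₁ _ _ _ b≤ (yes lt) _ = finish i lt t₁ b≤
        choose {j = j} _ t₂ _ _ b≤ (no _) (yes lt) = finish j lt t₂ b≤
        choose _ _ t₃ s b≤ (no p) (no q) = full (≮⇒≥ p) (≮⇒≥ q) t₃ s
          where
          full : ∀ {p q s} → n ≤ p → n ≤ q → b + g ≤ 2 * n + s → p + q + s ≤ b → ⊥
          full {p} {q} {s} p≥ q≥ t h = absurd (lin (b ∷ g ∷ n ∷ s ∷ p ∷ q ∷ []) 0 (κ 1 ≼ κ 0)
              (1 · # 0 :+ # 1 ≼ κ 2 :* # 2 :+ # 3 by t ⊹ 1 · # 4 :+ # 5 :+ # 3 ≼ # 0 by h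
               ⊹ 1 · # 2 ≼ # 4 by p≥ ⊹ 1 · # 2 ≼ # 5 by q≥ ⊹ 1 · κ 1 ≼ # 1 by 0<g))

-- Upper bounds for the residues of r modulo 3.

module UpperBounds where

  open import Data.Empty using (⊥; ⊥-elim)
  open import Data.Fin.Base using (Fin; zero; suc)
  open import Data.Fin.Patterns
  import Data.Fin.Properties as Fin
  open import Data.List.Base using ([]; _∷_)
  open import Data.Nat
  open import Data.Nat.Divisibility using (_∣_; 1∣_)
  open import Data.Nat.Tactic.RingSolver using (solve)
  open import Data.Nat.Properties hiding (_≟_)
  open import Data.Product using (_×_; _,_; ∃-syntax; Σ-syntax)
  open import Data.Sum using (_⊎_; inj₁; inj₂)
  open import Relation.Binary.PropositionalEquality using (_≡_; _≢_; refl; trans)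
  open import Relation.Nullary using (¬_; yes; no)
  open LinearArithmetic
  open Sums
  open Saturation
  open Tables
  open Wheels

  module _ {n r : ℕ} (G : BalancedPartiteGraph n r) where
    open BalancedPartiteGraph G

    ¬K₄⇒K₄-free : ¬ ContainsK 4 → K₄-free graph
    ¬K₄⇒K₄-free ¬K {a} {b} {c} {d} ab ac ad bc bd cd = ¬K (φ , injective , adjacent)
      where
      φ : Fin 4 → Vertex n r
      φ 0F = a
      φ 1F = b
      φ 2F = c
      φ 3F = d

      adjacent : ∀ i j → i ≢ j → Adj (φ i) (φ j)
      adjacent 0F 0F p = ⊥-elim (p refl)
      adjacent 0F 1F _ = ab
      adjacent 0F 2F _ = ac
      adjacent 0F 3F _ = ad
      adjacent 1F 0F _ = sym ab
      adjacent 1F 1F p = ⊥-elim (p refl)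
      adjacent 1F 2F _ = bc
      adjacent 1F 3F _ = bd
      adjacent 2F 0F _ = sym ac
      adjacent 2F 1F _ = sym bc
      adjacent 2F 2F p = ⊥-elim (p refl)
      adjacent 2F 3F _ = cd
      adjacent 3F 0F _ = sym ad
      adjacent 3F 1F _ = sym bd
      adjacent 3F 2F _ = sym cd
      adjacent 3F 3F p = ⊥-elim (p refl)

      injective : ∀ {i j} → φ i ≡ φ j → i ≡ j
      injective {i} {j} eq with i Fin.≟ j
      ... | yes p = p
      ... | no p  = ⊥-elim (irrefl eq (adjacent i j p))

    module _ {δ : ℕ} (δ≤ : ∀ v → δ ≤ Counting.deg graph v) (k₄ : K₄-free graph) (v₀ : Vertex n r) where

      private
        NoHub : SimpleGraph (Vertex n r) → Set
        NoHub H = ∀ {h c₀ c₁ c₂ c₃ c₄} → Wheel H h c₀ c₁ c₂ c₃ c₄ →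
          ¬ (∀ {w w′} → ¬ SimpleGraph.Adj H h w → ¬ SimpleGraph.Adj H h w′ → ¬ SimpleGraph.Adj H w w′)

      colouring : 3 * (r * n) < 5 * δ →
        (∀ H → graph ⊆ᵍ H → K₄-free H → (∀ v → δ ≤ Counting.deg H v) → NoHub H) →
        Σ[ col ∈ (Vertex n r → Fin 3) ] (∀ {u v} → Adj u v → col u ≢ col v)
      colouring dense noHub =
        let (H , G⊆H , k₄′ , sat) = saturate graph k₄
        in go H (λ {_} {_} → G⊆H) k₄′ (λ {_} {_} → sat)
        where
        go : ∀ H → graph ⊆ᵍ H → K₄-free H → Saturated H →
          Σ[ col ∈ (Vertex n r → Fin 3) ] (∀ {u v} → Adj u v → col u ≢ col v)
        go H G⊆H k₄′ sat = use (Dense.structure H k₄′ δ≤′ sat dense v₀)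
          where
          δ≤′ : ∀ v → δ ≤ Counting.deg H v
          δ≤′ v = ≤-trans (δ≤ v) (∑-mono (λ z → ⟦⟧-mono (adj? v z) (SimpleGraph.adj? H v z) G⊆H))
          use : Structure H → Σ[ col ∈ (Vertex n r → Fin 3) ] (∀ {u v} → Adj u v → col u ≢ col v)
          use (coloured col proper) = col , λ e → proper (G⊆H e)
          use (hub W indep) = ⊥-elim (noHub H G⊆H k₄′ δ≤′ W indep)

      sparse⇒noHub : 5 * (r * n) < 8 * δ → ∀ H → graph ⊆ᵍ H → K₄-free H → (∀ v → δ ≤ Counting.deg H v) → NoHub H
      sparse⇒noHub lt H _ k₄′ δ≤′ W _ = <⇒≱ lt (Dense.wheel-sparse H k₄′ δ≤′ W)

      upper₀ : ∀ {k} → r * n ≡ 3 * (k * n) → ¬ (2 * (k * n) < δ)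
      upper₀ {k} rn≡ lt = Dense.turán graph k₄ δ≤ v₀ (lin (r ∷ n ∷ δ ∷ k ∷ []) 0 (κ 1 :+ κ 2 :* (# 0 :* # 1)
          ≼ κ 3 :* # 2)
          (3 · κ 1 :+ κ 2 :* (# 3 :* # 1) ≼ # 2 by lt
           ⊹ 2 · # 0 :* # 1 ≼ κ 3 :* (# 3 :* # 1) by ≡⇒≤ rn≡))

      upper₂ : ∀ {k} → 1 ≤ k → 0 < n → r * n ≡ 3 * (k * n) + n + 1 * n → ¬ (2 * (k * n) + 1 + 1 * n ≤ δ)
      upper₂ {k} 1≤k 0<n rn≡ ≤δ =
        let (col , proper) = colour k refl in
        no-table₁ (Partite.coloured⇒table G δ≤ {k} {1} {1} col proper ≤δ rn≡) z<s 0<n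
        where
        colour : ∀ k′ → k′ ≡ k → Σ[ col ∈ (Vertex n r → Fin 3) ] (∀ {u v} → Adj u v → col u ≢ col v)
        colour 0 refl = absurd 1≤k
        -- For r = 5 the degree 3n + 1 need not exceed 5N / 8, so the parts have to be used.
        colour 1 refl = colouring (lin (r ∷ n ∷ δ ∷ []) 0 (κ 1 :+ κ 3 :* (# 0 :* # 1) ≼ κ 5 :* # 2)
            (5 · κ 2 :* (κ 1 :* # 1) :+ κ 1 :+ κ 1 :* # 1 ≼ # 2 by ≤δ
             ⊹ 3 · # 0 :* # 1 ≼ κ 3 :* (κ 1 :* # 1) :+ # 1 :+ κ 1 :* # 1 by ≡⇒≤ rn≡)) λ H G⊆H k₄′ _ W indep →
          HubCase.five-parts G δ≤ H G⊆H k₄′ W indep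
            (trans rn≡ (solve (n ∷ []))) (lin (n ∷ δ ∷ []) 0 (κ 3 :* # 0 :+ κ 1 ≼ # 1)
                (1 · κ 2 :* (κ 1 :* # 0) :+ κ 1 :+ κ 1 :* # 0 ≼ # 1 by ≤δ))
        -- From k = 2 on, 8 (2k + 1) ≥ 5 (3k + 2), so the density alone excludes wheels.
        colour (suc (suc k)) refl = colouring (lin (r ∷ n ∷ δ ∷ k ∷ []) 0 (κ 1 :+ κ 3 :* (# 0 :* # 1) ≼ κ 5 :* # 2)
            (5 · κ 2 :* ((κ 2 :+ # 3) :* # 1) :+ κ 1 :+ κ 1 :* # 1 ≼ # 2 by ≤δ
             ⊹ 3 · # 0 :* # 1 ≼ κ 3 :* ((κ 2 :+ # 3) :* # 1) :+ # 1 :+ κ 1 :* # 1 by ≡⇒≤ rn≡))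
          (sparse⇒noHub (lin (r ∷ n ∷ δ ∷ k ∷ []) 0 (κ 1 :+ κ 5 :* (# 0 :* # 1) ≼ κ 8 :* # 2)
              (8 · κ 2 :* ((κ 2 :+ # 3) :* # 1) :+ κ 1 :+ κ 1 :* # 1 ≼ # 2 by ≤δ
               ⊹ 5 · # 0 :* # 1 ≼ κ 3 :* ((κ 2 :+ # 3) :* # 1) :+ # 1 :+ κ 1 :* # 1 by ≡⇒≤ rn≡)))

      -- The two ways to violate `Slack`: `g` above kn / r, or `g` equal to the floor while the
      -- divisibility fails.
      Excess : (k g : ℕ) → Set
      Excess k g = (k * n < (3 * k + 1) * g)
        ⊎ (∃[ q ] ∃[ h ] 1 ≤ h × h ≤ k × g ≡ k * q + h × n ≡ (3 * k + 1) * q + 3 * h + 1 × ¬ (suc q ∣ (k ∸ h)))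

      private
        excess-pos : ∀ {k g} → Excess k g → 0 < g
        excess-pos {k} {zero} (inj₁ lt) = ⊥-elim (<⇒≱ lt (≤-trans (≤-reflexive (*-zeroʳ (3 * k + 1))) z≤n))
        excess-pos {k} {suc g} (inj₁ lt) = z<s
        excess-pos {k} {g} (inj₂ (q , h , 1≤h , _ , eg , _)) = lin (g ∷ h ∷ k ∷ q ∷ []) 0 (κ 1 ≼ # 0)
            (1 · κ 1 ≼ # 1 by 1≤h ⊹ 1 · # 2 :* # 3 :+ # 1 ≼ # 0 by ≡⇒≥ eg)

        -- The second alternative does not give 2n < 7g: for h = 1, 7g is 2n - 1. The weaker bound
        -- with 9 holds in both alternatives and is what `alternate` consumes.
        excess₂ : ∀ {g} → Excess 2 g → 2 * n < 9 * g
        excess₂ {g} (inj₁ lt) = lin (n ∷ g ∷ []) 0 (κ 1 :+ κ 2 :* # 0 ≼ κ 9 :* # 1)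
            (1 · κ 1 :+ κ 2 :* # 0 ≼ (κ 3 :* κ 2 :+ κ 1) :* # 1 by lt)
        excess₂ {g} (inj₂ (q , h , 1≤h , _ , eg , en , _)) = lin (n ∷ g ∷ q ∷ h ∷ []) 0 (κ 1 :+ κ 2 :* # 0
            ≼ κ 9 :* # 1)
            (9 · κ 2 :* # 2 :+ # 3 ≼ # 1 by ≡⇒≥ eg
             ⊹ 2 · # 0 ≼ (κ 3 :* κ 2 :+ κ 1) :* # 2 :+ κ 3 :* # 3 :+ κ 1 by ≡⇒≤ en
             ⊹ 3 · κ 1 ≼ # 3 by 1≤h)

        -- With K = 3 + k, this is 5N < 8δ rearranged for δ = 2Kn + g and r = 3K + 1.
        excess₃ : ∀ k {g} → Excess (3 + k) g → 5 * n < (3 + k) * n + 8 * g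
        excess₃ k {g} (inj₁ lt) = small k {g} lt
          where
          small : ∀ k {g} → (3 + k) * n < (3 * (3 + k) + 1) * g → 5 * n < (3 + k) * n + 8 * g
          small 0 {g} lt = lin (n ∷ g ∷ []) 4 (κ 1 :+ κ 5 :* # 0 ≼ κ 3 :* # 0 :+ κ 8 :* # 1)
                         (4 · κ 1 :+ κ 3 :* # 0 ≼ (κ 3 :* κ 3 :+ κ 1) :* # 1 by lt)
          small 1 {g} lt = lin (n ∷ g ∷ []) 3 (κ 1 :+ κ 5 :* # 0 ≼ (κ 3 :+ κ 1) :* # 0 :+ κ 8 :* # 1)
                         (1 · κ 1 :+ (κ 3 :+ κ 1) :* # 0 ≼ (κ 3 :* (κ 3 :+ κ 1) :+ κ 1) :* # 1 by lt)
          small (suc (suc k)) {g} lt = lin (n ∷ k ∷ g ∷ []) 0 (κ 1 :+ κ 5 :* # 0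
              ≼ (κ 5 :+ # 1) :* # 0 :+ κ 8 :* # 2)
              (8 · κ 1 ≼ # 2 by excess-pos {5 + k} {g} (inj₁ lt))
        -- For q = 0 the divisor is 1, so divisibility cannot fail.
        excess₃ k (inj₂ (zero , h , 1≤h , _ , eg , en , ¬d)) = ⊥-elim (¬d (1∣ _))
        excess₃ k (inj₂ (suc q , h , 1≤h , _ , eg , en , _)) = small k eg en
          where
          small : ∀ k {g} → g ≡ (3 + k) * suc q + h → n ≡ (3 * (3 + k) + 1) * suc q + 3 * h + 1 → 5 * n < (3 + k) * n + 8 * g
          small 0 {g} eg en = lin (n ∷ g ∷ q ∷ h ∷ []) 0 (κ 1 :+ κ 5 :* # 0 ≼ κ 3 :* # 0 :+ κ 8 :* # 1)
              (8 · κ 3 :* (κ 1 :+ # 2) :+ # 3 ≼ # 1 by ≡⇒≥ eg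
               ⊹ 2 · # 0 ≼ (κ 3 :* κ 3 :+ κ 1) :* (κ 1 :+ # 2) :+ κ 3 :* # 3 :+ κ 1 by ≡⇒≤ en
               ⊹ 1 · κ 1 ≼ # 3 by 1≤h)
          small 1 {g} eg en = lin (n ∷ g ∷ q ∷ h ∷ []) 0 (κ 1 :+ κ 5 :* # 0 ≼ (κ 3 :+ κ 1) :* # 0 :+ κ 8 :* # 1)
              (8 · (κ 3 :+ κ 1) :* (κ 1 :+ # 2) :+ # 3 ≼ # 1 by ≡⇒≥ eg
               ⊹ 1 · # 0 ≼ (κ 3 :* (κ 3 :+ κ 1) :+ κ 1) :* (κ 1 :+ # 2) :+ κ 3 :* # 3 :+ κ 1 by ≡⇒≤ en)
          small (suc (suc k)) {g} eg en = lin (n ∷ k ∷ g ∷ q ∷ h ∷ []) 0 (κ 1 :+ κ 5 :* # 0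
              ≼ (κ 5 :+ # 1) :* # 0 :+ κ 8 :* # 2)
              (8 · (κ 5 :+ # 1) :* (κ 1 :+ # 3) :+ # 4 ≼ # 2 by ≡⇒≥ eg)

      upper₁ : ∀ {k g} → 2 ≤ k → 0 < n → r * n ≡ 3 * (k * n) + n + 0 * n → Excess k g → ¬ (2 * (k * n) + g + 0 * n ≤ δ)
      upper₁ {k} {g} 2≤k 0<n rn≡ ex ≤δ =
        let (col , proper) = colour k refl
        in contradict ex (table⇒slack (Partite.coloured⇒table G δ≤ {k} {g} {0} col proper ≤δ rn≡)
                                      (excess-pos ex) 0<n (≤-trans (s≤s z≤n) 2≤k))
        where
        colour : ∀ k′ → k′ ≡ k → Σ[ col ∈ (Vertex n r → Fin 3) ] (∀ {u v} → Adj u v → col u ≢ col v)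
        colour 0 refl = absurd (≤-trans (s≤s z≤n) 2≤k)
        colour 1 refl = ⊥-elim (<⇒≱ 2≤k ≤-refl)
        colour 2 refl = colouring (lin (r ∷ n ∷ δ ∷ g ∷ []) 1 (κ 1 :+ κ 3 :* (# 0 :* # 1) ≼ κ 5 :* # 2)
            (10 · κ 2 :* ((κ 1 :+ κ 1) :* # 1) :+ # 3 :+ κ 0 :* # 1 ≼ # 2 by ≤δ
             ⊹ 6 · # 0 :* # 1 ≼ κ 3 :* ((κ 1 :+ κ 1) :* # 1) :+ # 1 :+ κ 0 :* # 1 by ≡⇒≤ rn≡
             ⊹ 1 · κ 1 :+ κ 2 :* # 1 ≼ κ 9 :* # 3 by excess₂ ex
             ⊹ 1 · κ 1 ≼ # 3 by excess-pos ex)) λ H G⊆H k₄′ _ W indep →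
          HubCase.seven-parts G δ≤ H G⊆H k₄′ W indep {g}
            (trans rn≡ (solve (n ∷ []))) (lin (n ∷ g ∷ δ ∷ []) 0 (κ 4 :* # 0 :+ # 1 ≼ # 2)
                (1 · κ 2 :* ((κ 1 :+ κ 1) :* # 0) :+ # 1 :+ κ 0 :* # 0 ≼ # 2 by ≤δ)) (excess₂ ex)
        colour (suc (suc (suc k))) refl =
          let lt : 5 * (r * n) < 8 * δ
              lt = lin (r ∷ n ∷ δ ∷ k ∷ g ∷ []) 0 (κ 1 :+ κ 5 :* (# 0 :* # 1) ≼ κ 8 :* # 2)
                     (8 · κ 2 :* ((κ 3 :+ # 3) :* # 1) :+ # 4 :+ κ 0 :* # 1 ≼ # 2 by ≤δ
                      ⊹ 5 · # 0 :* # 1 ≼ κ 3 :* ((κ 3 :+ # 3) :* # 1) :+ # 1 :+ κ 0 :* # 1 by ≡⇒≤ rn≡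
                      ⊹ 1 · κ 1 :+ κ 5 :* # 1 ≼ (κ 3 :+ # 3) :* # 1 :+ κ 8 :* # 4 by excess₃ k ex)
          in colouring (lin (r ∷ n ∷ δ ∷ []) 7 (κ 1 :+ κ 3 :* (# 0 :* # 1) ≼ κ 5 :* # 2)
                          (5 · κ 1 :+ κ 5 :* (# 0 :* # 1) ≼ κ 8 :* # 2 by lt)) (sparse⇒noHub lt)

        contradict : Excess k g → Slack k g n → ⊥
        contradict (inj₁ lt) s = <⇒≱ lt (Slack.bound s)
        contradict (inj₂ (q , h , 1≤h , h≤k , eg , en , ¬d)) s = ¬d (Slack.divisible s q h 1≤h h≤k eg en)

-- The upper bound for four parts.

module FourPartite where

  open import Data.Empty using (⊥; ⊥-elim)
  open import Data.Fin.Base using (Fin; suc)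
  open import Data.Fin.Patterns
  import Data.Fin.Properties as Fin
  open import Data.List.Base using (List; []; _∷_; length)
  open import Data.List.Membership.Propositional using (_∈_)
  open import Data.List.Relation.Unary.All using (All; []; _∷_)
  import Data.List.Relation.Unary.All as All
  open import Data.List.Relation.Unary.AllPairs using ([]; _∷_)
  open import Data.List.Relation.Unary.Any using (here; there)
  open import Data.List.Relation.Unary.Unique.Propositional using (Unique)
  open import Data.Nat
  open import Data.Nat.Properties hiding (_≟_)
  open import Data.Product using (_×_; _,_; ∃-syntax; proj₁)
  open import Data.Sum using (_⊎_; inj₁; inj₂)
  open import Relation.Binary.PropositionalEquality using (_≡_; _≢_; refl; trans; cong; cong₂; ≢-sym)
  import Relation.Binary.PropositionalEquality as ≡
  open import Relation.Nullary using (yes; no)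
  open LinearArithmetic
  open Sums
  open Saturation
  open Wheels

  module Selection {n r δ : ℕ} (G : BalancedPartiteGraph n r)
                   (δ≤ : ∀ v → δ ≤ Counting.deg (BalancedPartiteGraph.graph G) v) where
    open BalancedPartiteGraph G
    open Counting graph
    open Partite G δ≤

    Compatible : Vertex n r → Vertex n r → Set
    Compatible u z = proj₁ z ≡ proj₁ u ⊎ Adj u z

    private
      at : Fin r → Vertex n r → ℕ
      at = inPart

      inParts : List (Fin r) → Vertex n r → ℕ
      inParts []      z = 0
      inParts (j ∷ S) z = at j z + inParts S z

      ∑-inParts : ∀ S → ∑ (inParts S) ≡ length S * n
      ∑-inParts []      = trans (∑-const {n} {r} 0) (*-zeroʳ (r * n))
      ∑-inParts (j ∷ S) = trans (∑-+ (at j) (inParts S)) (cong₂ _+_ (∑-inPart j) (∑-inParts S))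

      inParts-pos : ∀ S {z} → 0 < inParts S z → proj₁ z ∈ S
      inParts-pos (j ∷ S) {z} p with proj₁ z Fin.≟ j
      ... | yes s = here s
      ... | no _  = there (inParts-pos S p)

      inParts≤1 : ∀ {S} → Unique S → ∀ z → inParts S z ≤ 1
      inParts≤1 [] z = z≤n
      inParts≤1 {j ∷ S} (j∉ ∷ uniq) z with proj₁ z Fin.≟ j
      ... | no _  = inParts≤1 uniq z
      ... | yes s = s≤s (≮⇒≥ λ p → All.lookup j∉ (inParts-pos S {z} p) (≡.sym s))

      friends : List (Vertex n r) → Vertex n r → ℕ
      friends []      z = 0
      friends (u ∷ D) z = (⟦ adj? u z ⟧ + at (proj₁ u) z) + friends D z

      ∑-friends : ∀ D → length D * (δ + n) ≤ ∑ (friends D)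
      ∑-friends []      = z≤n
      ∑-friends (u ∷ D) = begin
        (δ + n) + length D * (δ + n)
          ≤⟨ +-mono-≤ (+-mono-≤ (δ≤ u) (≤-reflexive (≡.sym (∑-inPart (proj₁ u))))) (∑-friends D) ⟩
        (deg u + ∑ (at (proj₁ u))) + ∑ (friends D)
          ≡⟨ cong (_+ ∑ (friends D)) (∑-+ (λ z → ⟦ adj? u z ⟧) (at (proj₁ u))) ⟨
        ∑ (λ z → ⟦ adj? u z ⟧ + at (proj₁ u) z) + ∑ (friends D)
          ≡⟨ ∑-+ (λ z → ⟦ adj? u z ⟧ + at (proj₁ u) z) (friends D) ⟨
        ∑ (friends (u ∷ D)) ∎
        where open ≤-Reasoning

      friend≤1 : ∀ u z → ⟦ adj? u z ⟧ + at (proj₁ u) z ≤ 1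
      friend≤1 u z with adj? u z | proj₁ z Fin.≟ proj₁ u
      ... | yes e | yes s = ⊥-elim (adj⇒parts e s)
      ... | yes _ | no _  = ≤-refl
      ... | no _  | yes _ = ≤-refl
      ... | no _  | no _  = z≤n

      friend-pos : ∀ u z → 0 < ⟦ adj? u z ⟧ + at (proj₁ u) z → Compatible u z
      friend-pos u z p with adj? u z | proj₁ z Fin.≟ proj₁ u
      ... | yes e | _     = inj₂ e
      ... | no _  | yes s = inj₁ s

      friends≤ : ∀ D z → friends D z ≤ length D
      friends≤ []      z = z≤n
      friends≤ (u ∷ D) z = +-mono-≤ (friend≤1 u z) (friends≤ D z)

      friends-all : ∀ D {z} → length D ≤ friends D z → All (λ u → Compatible u z) D
      friends-all []      _ = []
      friends-all (u ∷ D) {z} p =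
        friend-pos u z (first (friends≤ D z) p) ∷ friends-all D (rest (friend≤1 u z) p)
        where
        first : ∀ {l a f} → f ≤ l → suc l ≤ a + f → 0 < a
        first {l} {a} {f} h p = lin (a ∷ l ∷ f ∷ []) 0 (κ 1 ≼ # 0) (1 · κ 1 :+ # 1 ≼ # 0 :+ # 2 by p ⊹ 1 · # 2
            ≼ # 1 by h)
        rest : ∀ {l a f} → a ≤ 1 → suc l ≤ a + f → l ≤ f
        rest {l} {a} {f} h p = lin (l ∷ f ∷ a ∷ []) 0 (# 0 ≼ # 1) (1 · κ 1 :+ # 0 ≼ # 2 :+ # 1 by p ⊹ 1 · # 2
            ≼ κ 1 by h)

    abstract
      -- A vertex of `D` is incompatible with at most rn - (δ + n) vertices. If all of `D` together
      -- rule out fewer than the parts in `S` contain, some vertex there is compatible with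
      -- everything in `D`.
      select : ∀ D S → Unique S → r * n * length D < length D * (δ + n) + length S * n →
               ∃[ z ] proj₁ z ∈ S × All (λ u → Compatible u z) D
      select D S uniq lt with ∑-<⇒∃ {n} {r} {λ _ → length D} {λ z → friends D z + inParts S z} (begin-strict
        ∑ {n} {r} (λ _ → length D)                ≡⟨ ∑-const {n} {r} (length D) ⟩
        r * n * length D                          <⟨ lt ⟩
        length D * (δ + n) + length S * n         ≤⟨ +-mono-≤ (∑-friends D) (≤-reflexive (≡.sym (∑-inParts S))) ⟩
        ∑ (friends D) + ∑ (inParts S)             ≡⟨ ∑-+ (friends D) (inParts S) ⟨
        ∑ (λ z → friends D z + inParts S z)       ∎)
        where open ≤-Reasoning
      ... | z , p = z , inParts-pos S (positive (friends≤ D z) p) , friends-all D (full (inParts≤1 uniq z) p)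
        where
        positive : ∀ {a b c} → b ≤ a → a < b + c → 0 < c
        positive {a} {b} {c} p q = lin (c ∷ b ∷ a ∷ []) 0 (κ 1 ≼ # 0) (1 · # 1 ≼ # 2 by p ⊹ 1 · κ 1 :+ # 2
            ≼ # 1 :+ # 0 by q)
        full : ∀ {a b c} → c ≤ 1 → a < b + c → a ≤ b
        full {a} {b} {c} p q = lin (a ∷ b ∷ c ∷ []) 0 (# 0 ≼ # 1) (1 · # 2 ≼ κ 1 by p ⊹ 1 · κ 1 :+ # 0
            ≼ # 1 :+ # 2 by q)

  -- Haxell's argument for independent transversals, read in the complement:
  -- a triangle that does not extend is modified until it does.
  module FourParts {n δ : ℕ} (G : BalancedPartiteGraph n 4)
                   (δ≤ : ∀ v → δ ≤ Counting.deg (BalancedPartiteGraph.graph G) v)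
                   (k₄ : K₄-free (BalancedPartiteGraph.graph G)) (dense : 7 * n < 3 * δ) where
    open BalancedPartiteGraph G
    open Selection G δ≤

    record Parts (p₁ p₂ p₃ p₄ : Fin 4) : Set where
      constructor parts
      field
        d₁₂ : p₁ ≢ p₂
        d₁₃ : p₁ ≢ p₃
        d₁₄ : p₁ ≢ p₄
        d₂₃ : p₂ ≢ p₃
        d₂₄ : p₂ ≢ p₄
        d₃₄ : p₃ ≢ p₄

    swap₁₂ : ∀ {p₁ p₂ p₃ p₄} → Parts p₁ p₂ p₃ p₄ → Parts p₂ p₁ p₃ p₄
    swap₁₂ (parts a b c d e f) = parts (≢-sym a) d e b c f

    swap₂₃ : ∀ {p₁ p₂ p₃ p₄} → Parts p₁ p₂ p₃ p₄ → Parts p₁ p₃ p₂ p₄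
    swap₂₃ (parts a b c d e f) = parts b a c (≢-sym d) f e

    private
      -- Since 3δ > 7n, a vertex rules out fewer than 2n / 3 others, so `d` vertices cannot block
      -- `s` parts when 2d ≤ 3s. The extreme instances have d = 2 (s - 1), and for s = 4 they meet
      -- this condition with equality.
      few : ∀ d s → Set
      few d s = 4 * n * d < d * (δ + n) + s * n

      few₁₁ : few 1 1
      few₁₁ = lin (n ∷ δ ∷ []) 2 (κ 1 :+ κ 4 :* # 0 :* κ 1 ≼ κ 1 :* (# 1 :+ # 0) :+ κ 1 :* # 0)
                (1 · κ 1 :+ κ 7 :* # 0 ≼ κ 3 :* # 1 by dense)
      few₂₂ : few 2 2
      few₂₂ = lin (n ∷ δ ∷ []) 2 (κ 1 :+ κ 4 :* # 0 :* κ 2 ≼ κ 2 :* (# 1 :+ # 0) :+ κ 2 :* # 0)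
                (2 · κ 1 :+ κ 7 :* # 0 ≼ κ 3 :* # 1 by dense)
      few₃₃ : few 3 3
      few₃₃ = lin (n ∷ δ ∷ []) 2 (κ 1 :+ κ 4 :* # 0 :* κ 3 ≼ κ 3 :* (# 1 :+ # 0) :+ κ 3 :* # 0)
                (3 · κ 1 :+ κ 7 :* # 0 ≼ κ 3 :* # 1 by dense)
      few₄₃ : few 4 3
      few₄₃ = lin (n ∷ δ ∷ []) 2 (κ 1 :+ κ 4 :* # 0 :* κ 4 ≼ κ 4 :* (# 1 :+ # 0) :+ κ 3 :* # 0)
                (4 · κ 1 :+ κ 7 :* # 0 ≼ κ 3 :* # 1 by dense)
      few₄₄ : few 4 4
      few₄₄ = lin (n ∷ δ ∷ []) 2 (κ 1 :+ κ 4 :* # 0 :* κ 4 ≼ κ 4 :* (# 1 :+ # 0) :+ κ 4 :* # 0)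
                (4 · κ 1 :+ κ 7 :* # 0 ≼ κ 3 :* # 1 by dense)
      few₅₄ : few 5 4
      few₅₄ = lin (n ∷ δ ∷ []) 2 (κ 1 :+ κ 4 :* # 0 :* κ 5 ≼ κ 5 :* (# 1 :+ # 0) :+ κ 4 :* # 0)
                (5 · κ 1 :+ κ 7 :* # 0 ≼ κ 3 :* # 1 by dense)
      few₆₄ : few 6 4
      few₆₄ = lin (n ∷ δ ∷ []) 0 (κ 1 :+ κ 4 :* # 0 :* κ 6 ≼ κ 6 :* (# 1 :+ # 0) :+ κ 4 :* # 0)
                (2 · κ 1 :+ κ 7 :* # 0 ≼ κ 3 :* # 1 by dense)

      adj : ∀ {p q a b} → p ≢ q → Compatible (p , a) (q , b) → Adj (p , a) (q , b)
      adj p≢q (inj₁ e) = ⊥-elim (p≢q (≡.sym e))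
      adj p≢q (inj₂ e) = e

      infix 4 _∼_
      _∼_ : Vertex n 4 → Vertex n 4 → Set
      _∼_ = Adj

    -- Both `a` and `x` can complete the same edge to a triangle; `y` lies in the part of one of
    -- them and sees the other.
    Second : Vertex n 4 → Vertex n 4 → Vertex n 4 → Set
    Second (p₁ , a) (p₄ , x) y = (∃[ y′ ] y ≡ (p₁ , y′) × y ∼ (p₄ , x)) ⊎ (∃[ y′ ] y ≡ (p₄ , y′) × y ∼ (p₁ , a))

    module _ {p₁ p₂ p₃ p₄ : Fin 4} (P : Parts p₁ p₂ p₃ p₄) where
      open Parts P

      S₂ : Unique (p₁ ∷ p₄ ∷ [])
      S₂ = (d₁₄ ∷ []) ∷ [] ∷ []

      S₃ : Unique (p₁ ∷ p₂ ∷ p₄ ∷ [])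
      S₃ = (d₁₂ ∷ d₁₄ ∷ []) ∷ (d₂₄ ∷ []) ∷ [] ∷ []

      S₄ : Unique (p₁ ∷ p₂ ∷ p₃ ∷ p₄ ∷ [])
      S₄ = (d₁₂ ∷ d₁₃ ∷ d₁₄ ∷ []) ∷ (d₂₃ ∷ d₂₄ ∷ []) ∷ (d₃₄ ∷ []) ∷ [] ∷ []

      module _ {a b c x : Fin n} (t₁₂ : (p₁ , a) ∼ (p₂ , b)) (t₁₃ : (p₁ , a) ∼ (p₃ , c)) (t₂₃ : (p₂ , b) ∼ (p₃ , c)) where

        module _ (x₂ : (p₄ , x) ∼ (p₂ , b)) (x₃ : (p₄ , x) ∼ (p₃ , c)) where

          private
            D₄ : Vertex n 4 → List (Vertex n 4)
            D₄ y = (p₄ , x) ∷ (p₁ , a) ∷ y ∷ (p₂ , b) ∷ []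

            D₆ : Vertex n 4 → Vertex n 4 → List (Vertex n 4)
            D₆ y z = (p₄ , x) ∷ (p₁ , a) ∷ y ∷ (p₂ , b) ∷ z ∷ (p₃ , c) ∷ []

            -- Outside `p₃`, the vertex `u` completes one of the triangles xbc, yxc, abc. Inside
            -- `p₃` it completes the triangle through `z`: with x and b, with y and x, or with a and
            -- b, according to the part of `z`.
            last₁ : ∀ {y z u} → (p₁ , y) ∼ (p₄ , x) → (p₁ , y) ∼ (p₃ , c) →
              proj₁ z ∈ p₁ ∷ p₂ ∷ p₄ ∷ [] → All (λ v → Compatible v z) (D₄ (p₁ , y)) →
              proj₁ u ∈ p₁ ∷ p₂ ∷ p₃ ∷ p₄ ∷ [] → All (λ v → Compatible v u) (D₆ (p₁ , y) z) → ⊥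
            last₁ yx y₃ _ _ (here refl) (ux ∷ u₁ ∷ uy ∷ u₂ ∷ uz ∷ u₃ ∷ []) =
              k₄ x₂ x₃ (adj (≢-sym d₁₄) ux) t₂₃ (adj (≢-sym d₁₂) u₂) (adj (≢-sym d₁₃) u₃)
            last₁ yx y₃ _ _ (there (here refl)) (ux ∷ u₁ ∷ uy ∷ u₂ ∷ uz ∷ u₃ ∷ []) =
              k₄ yx y₃ (adj d₁₂ uy) x₃ (adj (≢-sym d₂₄) ux) (adj (≢-sym d₂₃) u₃)
            last₁ yx y₃ _ _ (there (there (there (here refl)))) (ux ∷ u₁ ∷ uy ∷ u₂ ∷ uz ∷ u₃ ∷ []) =
              k₄ t₁₂ t₁₃ (adj d₁₄ u₁) t₂₃ (adj d₂₄ u₂) (adj d₃₄ u₃)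
            last₁ yx y₃ (here refl) (zx ∷ z₁ ∷ zy ∷ z₂ ∷ []) (there (there (here refl))) (ux ∷ u₁ ∷ uy ∷ u₂ ∷ uz ∷ u₃ ∷ []) =
              k₄ x₂ (adj (≢-sym d₁₄) zx) (adj (≢-sym d₃₄) ux) (adj (≢-sym d₁₂) z₂) (adj d₂₃ u₂) (adj d₁₃ uz)
            last₁ yx y₃ (there (here refl)) (zx ∷ z₁ ∷ zy ∷ z₂ ∷ []) (there (there (here refl))) (ux ∷ u₁ ∷ uy ∷ u₂ ∷ uz ∷ u₃ ∷ []) =
              k₄ yx (adj d₁₂ zy) (adj d₁₃ uy) (adj (≢-sym d₂₄) zx) (adj (≢-sym d₃₄) ux) (adj d₂₃ uz)
            last₁ yx y₃ (there (there (here refl))) (zx ∷ z₁ ∷ zy ∷ z₂ ∷ []) (there (there (here refl))) (ux ∷ u₁ ∷ uy ∷ u₂ ∷ uz ∷ u₃ ∷ []) =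
              k₄ t₁₂ (adj d₁₄ z₁) (adj d₁₃ u₁) (adj d₂₄ z₂) (adj d₂₃ u₂) (adj (≢-sym d₃₄) uz)

            last₂ : ∀ {y z u} → (p₄ , y) ∼ (p₁ , a) → (p₄ , y) ∼ (p₃ , c) →
              proj₁ z ∈ p₁ ∷ p₂ ∷ p₄ ∷ [] → All (λ v → Compatible v z) (D₄ (p₄ , y)) →
              proj₁ u ∈ p₁ ∷ p₂ ∷ p₃ ∷ p₄ ∷ [] → All (λ v → Compatible v u) (D₆ (p₄ , y) z) → ⊥
            last₂ y₁ y₃ _ _ (here refl) (ux ∷ u₁ ∷ uy ∷ u₂ ∷ uz ∷ u₃ ∷ []) =
              k₄ x₂ x₃ (adj (≢-sym d₁₄) ux) t₂₃ (adj (≢-sym d₁₂) u₂) (adj (≢-sym d₁₃) u₃)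
            last₂ y₁ y₃ _ _ (there (here refl)) (ux ∷ u₁ ∷ uy ∷ u₂ ∷ uz ∷ u₃ ∷ []) =
              k₄ y₁ y₃ (adj (≢-sym d₂₄) uy) t₁₃ (adj d₁₂ u₁) (adj (≢-sym d₂₃) u₃)
            last₂ y₁ y₃ _ _ (there (there (there (here refl)))) (ux ∷ u₁ ∷ uy ∷ u₂ ∷ uz ∷ u₃ ∷ []) =
              k₄ t₁₂ t₁₃ (adj d₁₄ u₁) t₂₃ (adj d₂₄ u₂) (adj d₃₄ u₃)
            last₂ y₁ y₃ (here refl) (zx ∷ z₁ ∷ zy ∷ z₂ ∷ []) (there (there (here refl))) (ux ∷ u₁ ∷ uy ∷ u₂ ∷ uz ∷ u₃ ∷ []) =
              k₄ x₂ (adj (≢-sym d₁₄) zx) (adj (≢-sym d₃₄) ux) (adj (≢-sym d₁₂) z₂) (adj d₂₃ u₂) (adj d₁₃ uz)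
            last₂ y₁ y₃ (there (here refl)) (zx ∷ z₁ ∷ zy ∷ z₂ ∷ []) (there (there (here refl))) (ux ∷ u₁ ∷ uy ∷ u₂ ∷ uz ∷ u₃ ∷ []) =
              k₄ y₁ (adj (≢-sym d₂₄) zy) (adj (≢-sym d₃₄) uy) (adj d₁₂ z₁) (adj d₁₃ u₁) (adj d₂₃ uz)
            last₂ y₁ y₃ (there (there (here refl))) (zx ∷ z₁ ∷ zy ∷ z₂ ∷ []) (there (there (here refl))) (ux ∷ u₁ ∷ uy ∷ u₂ ∷ uz ∷ u₃ ∷ []) =
              k₄ t₁₂ (adj d₁₄ z₁) (adj d₁₃ u₁) (adj d₂₄ z₂) (adj d₂₃ u₂) (adj (≢-sym d₃₄) uz)

          second-seen : ∀ {y} → Second (p₁ , a) (p₄ , x) y → y ∼ (p₃ , c) → ⊥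
          second-seen (inj₁ (y , refl , yx)) y₃ =
            let (z , z∈ , zs) = select (D₄ (p₁ , y)) _ S₃ few₄₃
                (u , u∈ , us) = select (D₆ (p₁ , y) z) _ S₄ few₆₄
            in last₁ yx y₃ z∈ zs u∈ us
          second-seen (inj₂ (y , refl , y₁)) y₃ =
            let (z , z∈ , zs) = select (D₄ (p₄ , y)) _ S₃ few₄₃
                (u , u∈ , us) = select (D₆ (p₄ , y) z) _ S₄ few₆₄
            in last₂ y₁ y₃ z∈ zs u∈ us

    module _ {p₁ p₂ p₃ p₄ : Fin 4} (P : Parts p₁ p₂ p₃ p₄) where
      open Parts P

      -- A vertex compatible with all five either completes a K₄, or replaces b or c by a vertex
      -- that `y` sees too, where `second-seen` applies.
      second : ∀ {a b c x} (t₁₂ : (p₁ , a) ∼ (p₂ , b)) (t₁₃ : (p₁ , a) ∼ (p₃ , c)) (t₂₃ : (p₂ , b) ∼ (p₃ , c))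
        (x₂ : (p₄ , x) ∼ (p₂ , b)) (x₃ : (p₄ , x) ∼ (p₃ , c)) → ∀ {y} → Second (p₁ , a) (p₄ , x) y → ⊥
      second {a} {b} {c} {x} t₁₂ t₁₃ t₂₃ x₂ x₃ {y} s =
        let (u , u∈ , us) = select D _ (S₄ P) few₅₄ in go u∈ us
        where
        D = (p₄ , x) ∷ (p₁ , a) ∷ y ∷ (p₂ , b) ∷ (p₃ , c) ∷ []

        see : ∀ {u} → Second (p₁ , a) (p₄ , x) y → proj₁ u ≢ p₁ → proj₁ u ≢ p₄ → Compatible y u → y ∼ u
        see _ _ _ (inj₂ e) = e
        see (inj₁ (_ , refl , _)) q _ (inj₁ e) = ⊥-elim (q e)
        see (inj₂ (_ , refl , _)) _ q (inj₁ e) = ⊥-elim (q e)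

        go : ∀ {u} → proj₁ u ∈ p₁ ∷ p₂ ∷ p₃ ∷ p₄ ∷ [] → All (λ v → Compatible v u) D → ⊥
        go (here refl) (ux ∷ u₁ ∷ uy ∷ u₂ ∷ u₃ ∷ []) =
          k₄ x₂ x₃ (adj (≢-sym d₁₄) ux) t₂₃ (adj (≢-sym d₁₂) u₂) (adj (≢-sym d₁₃) u₃)
        go {u} (there (here refl)) (ux ∷ u₁ ∷ uy ∷ u₂ ∷ u₃ ∷ []) =
          second-seen (swap₂₃ P) t₁₃ (adj d₁₂ u₁) (adj (≢-sym d₂₃) u₃) x₃ (adj (≢-sym d₂₄) ux) s
            (see {u} s (≢-sym d₁₂) d₂₄ uy)
        go {u} (there (there (here refl))) (ux ∷ u₁ ∷ uy ∷ u₂ ∷ u₃ ∷ []) =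
          second-seen P t₁₂ (adj d₁₃ u₁) (adj d₂₃ u₂) x₂ (adj (≢-sym d₃₄) ux) s
            (see {u} s (≢-sym d₁₃) d₃₄ uy)
        go (there (there (there (here refl)))) (ux ∷ u₁ ∷ uy ∷ u₂ ∷ u₃ ∷ []) =
          k₄ t₁₂ t₁₃ (adj d₁₄ u₁) t₂₃ (adj d₂₄ u₂) (adj d₃₄ u₃)

      sees-two : ∀ {a b c x} → (p₁ , a) ∼ (p₂ , b) → (p₁ , a) ∼ (p₃ , c) → (p₂ , b) ∼ (p₃ , c) →
        (p₄ , x) ∼ (p₂ , b) → (p₄ , x) ∼ (p₃ , c) → ⊥
      sees-two {a} {b} {c} {x} t₁₂ t₁₃ t₂₃ x₂ x₃ =
        let (y , y∈ , ys) = select D _ (S₂ P) few₂₂ in second t₁₂ t₁₃ t₂₃ x₂ x₃ (go y∈ ys)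
        where
        D = (p₄ , x) ∷ (p₁ , a) ∷ []
        go : ∀ {y} → proj₁ y ∈ p₁ ∷ p₄ ∷ [] → All (λ v → Compatible v y) D → Second (p₁ , a) (p₄ , x) y
        go (here refl) (yx ∷ _ ∷ []) = inj₁ (_ , refl , sym (adj (≢-sym d₁₄) yx))
        go (there (here refl)) (_ ∷ y₁ ∷ []) = inj₂ (_ , refl , sym (adj d₁₄ y₁))

    -- A compatible vertex in `p₁` or `p₂` replaces the vertex of the triangle there, after which
    -- `x` sees two vertices of the new triangle; in `p₄` it completes a K₄.
    sees-one : ∀ {p₁ p₂ p₃ p₄ a b c x} → Parts p₁ p₂ p₃ p₄ →
      (p₁ , a) ∼ (p₂ , b) → (p₁ , a) ∼ (p₃ , c) → (p₂ , b) ∼ (p₃ , c) → (p₄ , x) ∼ (p₃ , c) → ⊥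
    sees-one {p₁} {p₂} {p₃} {p₄} {a} {b} {c} {x} P t₁₂ t₁₃ t₂₃ x₃ =
      let (u , u∈ , us) = select D _ (S₃ P) few₄₃ in go u∈ us
      where
      open Parts P
      D = (p₄ , x) ∷ (p₁ , a) ∷ (p₂ , b) ∷ (p₃ , c) ∷ []
      go : ∀ {u} → proj₁ u ∈ p₁ ∷ p₂ ∷ p₄ ∷ [] → All (λ v → Compatible v u) D → ⊥
      go (here refl) (ux ∷ u₁ ∷ u₂ ∷ u₃ ∷ []) =
        sees-two (swap₁₂ P) (adj (≢-sym d₁₂) u₂) t₂₃ (sym (adj (≢-sym d₁₃) u₃)) (adj (≢-sym d₁₄) ux) x₃
      go (there (here refl)) (ux ∷ u₁ ∷ u₂ ∷ u₃ ∷ []) =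
        sees-two P (adj d₁₂ u₁) t₁₃ (sym (adj (≢-sym d₂₃) u₃)) (adj (≢-sym d₂₄) ux) x₃
      go (there (there (here refl))) (ux ∷ u₁ ∷ u₂ ∷ u₃ ∷ []) =
        k₄ t₁₂ t₁₃ (adj d₁₄ u₁) t₂₃ (adj d₂₄ u₂) (adj d₃₄ u₃)

    -- For an arbitrary `x` in the fourth part, a compatible vertex replaces a vertex of the
    -- triangle by one that `x` sees, or completes a K₄.
    no-triangle : ∀ {p₁ p₂ p₃ p₄ a b c} → Parts p₁ p₂ p₃ p₄ → Fin n →
      (p₁ , a) ∼ (p₂ , b) → (p₁ , a) ∼ (p₃ , c) → (p₂ , b) ∼ (p₃ , c) → ⊥
    no-triangle {p₁} {p₂} {p₃} {p₄} {a} {b} {c} P x t₁₂ t₁₃ t₂₃ =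
      let (u , u∈ , us) = select D _ (S₄ P) few₄₄ in go u∈ us
      where
      open Parts P
      D = (p₄ , x) ∷ (p₁ , a) ∷ (p₂ , b) ∷ (p₃ , c) ∷ []
      go : ∀ {u} → proj₁ u ∈ p₁ ∷ p₂ ∷ p₃ ∷ p₄ ∷ [] → All (λ v → Compatible v u) D → ⊥
      go (here refl) (ux ∷ u₁ ∷ u₂ ∷ u₃ ∷ []) =
        sees-one (swap₂₃ (swap₁₂ P)) t₂₃ (adj (≢-sym d₁₂) u₂) (adj (≢-sym d₁₃) u₃) (adj (≢-sym d₁₄) ux)
      go (there (here refl)) (ux ∷ u₁ ∷ u₂ ∷ u₃ ∷ []) =
        sees-one (swap₂₃ P) t₁₃ (adj d₁₂ u₁) (adj (≢-sym d₂₃) u₃) (adj (≢-sym d₂₄) ux)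
      go (there (there (here refl))) (ux ∷ u₁ ∷ u₂ ∷ u₃ ∷ []) =
        sees-one P t₁₂ (adj d₁₃ u₁) (adj d₂₃ u₂) (adj (≢-sym d₃₄) ux)
      go (there (there (there (here refl)))) (ux ∷ u₁ ∷ u₂ ∷ u₃ ∷ []) =
        k₄ t₁₂ t₁₃ (adj d₁₄ u₁) t₂₃ (adj d₂₄ u₂) (adj d₃₄ u₃)

    -- The same argument one part lower: p₄ is the part in which the edge is to be extended.
    edge-sees-one : ∀ {p₁ p₂ p₃ p₄ a b x} → Parts p₁ p₂ p₃ p₄ → Fin n →
      (p₁ , a) ∼ (p₂ , b) → (p₄ , x) ∼ (p₂ , b) → ⊥
    edge-sees-one {p₁} {p₂} {p₃} {p₄} {a} {b} {x} P o t₁₂ x₂ =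
      let (y , y∈ , ys) = select ((p₄ , x) ∷ (p₁ , a) ∷ []) _ (S₂ P) few₂₂
          (w , w∈ , ws) = select (D y) _ (S₃ P) few₄₃
      in go y∈ ys w∈ ws
      where
      open Parts P
      D = λ (y : Vertex n 4) → (p₄ , x) ∷ (p₁ , a) ∷ y ∷ (p₂ , b) ∷ []
      Q : Parts p₁ p₂ p₄ p₃
      Q = parts d₁₂ d₁₄ d₁₃ d₂₄ d₂₃ (≢-sym d₃₄)

      go : ∀ {y w} → proj₁ y ∈ p₁ ∷ p₄ ∷ [] → All (λ v → Compatible v y) ((p₄ , x) ∷ (p₁ , a) ∷ []) →
        proj₁ w ∈ p₁ ∷ p₂ ∷ p₄ ∷ [] → All (λ v → Compatible v w) (D y) → ⊥
      go _ _ (here refl) (wx ∷ w₁ ∷ wy ∷ w₂ ∷ []) =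
        no-triangle Q o (sym (adj (≢-sym d₁₂) w₂)) (sym (adj (≢-sym d₁₄) wx)) (sym x₂)
      go (here refl) (yx ∷ _ ∷ []) (there (here refl)) (wx ∷ w₁ ∷ wy ∷ w₂ ∷ []) =
        no-triangle Q o (adj d₁₂ wy) (sym (adj (≢-sym d₁₄) yx)) (sym (adj (≢-sym d₂₄) wx))
      go (there (here refl)) (_ ∷ y₁ ∷ []) (there (here refl)) (wx ∷ w₁ ∷ wy ∷ w₂ ∷ []) =
        no-triangle Q o (adj d₁₂ w₁) (adj d₁₄ y₁) (sym (adj (≢-sym d₂₄) wy))
      go _ _ (there (there (here refl))) (wx ∷ w₁ ∷ wy ∷ w₂ ∷ []) =
        no-triangle Q o t₁₂ (adj d₁₄ w₁) (adj d₂₄ w₂)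

    no-edge : ∀ {p₁ p₂ p₃ p₄ a b} → Parts p₁ p₂ p₃ p₄ → Fin n → (p₁ , a) ∼ (p₂ , b) → ⊥
    no-edge {p₁} {p₂} {p₃} {p₄} {a} {b} P x t₁₂ =
      let (u , u∈ , us) = select D _ (S₃ P) few₃₃ in go u∈ us
      where
      open Parts P
      D = (p₄ , x) ∷ (p₁ , a) ∷ (p₂ , b) ∷ []
      go : ∀ {u} → proj₁ u ∈ p₁ ∷ p₂ ∷ p₄ ∷ [] → All (λ v → Compatible v u) D → ⊥
      go (here refl) (ux ∷ u₁ ∷ u₂ ∷ []) =
        edge-sees-one (swap₁₂ P) x (adj (≢-sym d₁₂) u₂) (adj (≢-sym d₁₄) ux)
      go (there (here refl)) (ux ∷ u₁ ∷ u₂ ∷ []) =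
        edge-sees-one P x (adj d₁₂ u₁) (adj (≢-sym d₂₄) ux)
      go (there (there (here refl))) (ux ∷ u₁ ∷ u₂ ∷ []) =
        no-triangle (parts d₁₂ d₁₄ d₁₃ d₂₄ d₂₃ (≢-sym d₃₄)) x t₁₂ (adj d₁₄ u₁) (adj d₂₄ u₂)

    upper₄ : Fin n → ⊥
    upper₄ x = let (u , u∈ , us) = select ((0F , x) ∷ []) (1F ∷ []) ([] ∷ []) few₁₁ in go u∈ us
      where
      P : Parts 0F 1F 2F 3F
      P = parts (λ ()) (λ ()) (λ ()) (λ ()) (λ ()) (λ ())
      go : ∀ {u} → proj₁ u ∈ 1F ∷ [] → All (λ v → Compatible v u) ((0F , x) ∷ []) → ⊥
      go (here refl) (e ∷ []) = no-edge P x (adj (λ ()) e)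

-- Graphs defined by a 3-colouring in blocks of parts.

module BlockColourings where

  open import Data.Bool.Base using (true; false; if_then_else_)
  open import Data.Empty using (⊥-elim)
  open import Data.Fin.Base using (Fin; zero; suc; toℕ; splitAt; _↑ˡ_; _↑ʳ_)
  open import Data.Fin.Patterns
  import Data.Fin.Properties as Fin
  open import Data.List.Base using ([]; _∷_)
  open import Data.Nat
  open import Data.Nat.Properties hiding (_≟_)
  open import Data.Product using (_×_; _,_; proj₁; proj₂)
  open import Data.Sum using (inj₁; inj₂)
  open import Function using (_∘_)
  open import Relation.Binary.PropositionalEquality using (_≡_; _≢_; refl; trans; cong; cong₂; subst; ≢-sym)
  import Relation.Binary.PropositionalEquality as ≡
  open import Relation.Nullary using (¬_; yes; no)
  open import Relation.Nullary.Decidable using (_×-dec_; ¬?)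
  open LinearArithmetic
  open Sums
  open Wheels using (inPart; ∑-inPart; ∑-one)

  open BalancedPartiteGraph using (ContainsK; degree)

  sum-++ : ∀ a {b} (f : Fin (a + b) → ℕ) → sum f ≡ sum (λ i → f (i ↑ˡ b)) + sum (λ i → f (a ↑ʳ i))
  sum-++ zero    f = refl
  sum-++ (suc a) f = trans (cong (f zero +_) (sum-++ a (f ∘ suc))) (≡.sym (+-assoc (f zero) _ _))

  step : ℕ → ℕ → ℕ → ∀ {M} → Fin M → ℕ
  step p β α s = if toℕ s <ᵇ p then β else α

  sum-step : ∀ {M} p β α → p ≤ M → sum {M} (step p β α) ≡ p * β + (M ∸ p) * α
  sum-step {M} zero β α _ = sum-const M α
  sum-step {suc M} (suc p) β α (s≤s h) =
    trans (cong (β +_) (sum-step p β α h)) (≡.sym (+-assoc β (p * β) _))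

  module _ {n r : ℕ} (col : Vertex n r → Fin 3) where

    colourGraph : BalancedPartiteGraph n r
    colourGraph = record
      { graph = record
        { Adj    = λ u v → proj₁ u ≢ proj₁ v × col u ≢ col v
        ; adj?   = λ u v → ¬? (proj₁ u Fin.≟ proj₁ v) ×-dec ¬? (col u Fin.≟ col v)
        ; sym    = λ (p , q) → ≢-sym p , ≢-sym q
        ; irrefl = λ { refl (p , _) → p refl } }
      ; independent = λ _ _ _ (p , _) → p refl }

    colourGraph-¬K₄ : ¬ ContainsK colourGraph 4
    colourGraph-¬K₄ (φ , _ , adjacent) = <⇒≱ (s≤s (s≤s (s≤s (s≤s z≤n)))) (Fin.injective⇒≤ {f = col ∘ φ} injective)
      where
      injective : ∀ {i j} → col (φ i) ≡ col (φ j) → i ≡ j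
      injective {i} {j} eq with i Fin.≟ j
      ... | yes p = p
      ... | no p  = ⊥-elim (proj₂ (adjacent i j p) eq)

    colourGraph-degree : ∀ v → r * n + sum (λ x → ⟦ col (proj₁ v , x) Fin.≟ col v ⟧)
                             ≤ degree colourGraph v + ∑ (λ z → ⟦ col z Fin.≟ col v ⟧) + n
    colourGraph-degree v = begin
      r * n + sum (λ x → ⟦ col (i , x) Fin.≟ c ⟧)
        ≡⟨ cong₂ _+_ (∑-one {n} {r}) (∑-part i same) ⟨
      ∑ {n} {r} (λ _ → 1) + ∑ (λ z → at z * same z)
        ≡⟨ ∑-+ (λ _ → 1) (λ z → at z * same z) ⟨
      ∑ (λ z → 1 + at z * same z)
        ≤⟨ ∑-mono pointwise ⟩
      ∑ (λ z → nbr z + same z + at z)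
        ≡⟨ ∑-+ (λ z → nbr z + same z) at ⟩
      ∑ (λ z → nbr z + same z) + ∑ at
        ≡⟨ cong₂ _+_ (∑-+ nbr same) (∑-inPart i) ⟩
      ∑ nbr + ∑ same + n
        ≡⟨ cong (λ d → d + ∑ same + n) (degree-∑ colourGraph v) ⟨
      degree colourGraph v + ∑ same + n ∎
      where
      open ≤-Reasoning
      i = proj₁ v
      c = col v
      at same nbr : Vertex n r → ℕ
      at = inPart i
      same z = ⟦ col z Fin.≟ c ⟧
      nbr z = ⟦ BalancedPartiteGraph.adj? colourGraph v z ⟧
      pointwise : ∀ z → 1 + at z * same z ≤ nbr z + same z + at z
      pointwise z with proj₁ z Fin.≟ i | col z Fin.≟ c | i Fin.≟ proj₁ z | c Fin.≟ col z
      ... | yes _ | yes _ | yes _ | _     = ≤-refl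
      ... | yes _ | yes _ | no _  | yes _ = ≤-refl
      ... | yes _ | yes _ | no _  | no _  = n≤1+n 2
      ... | yes _ | no _  | yes _ | _     = ≤-refl
      ... | yes _ | no _  | no _  | yes _ = ≤-refl
      ... | yes _ | no _  | no _  | no _  = n≤1+n 1
      ... | no _  | yes _ | yes _ | _     = ≤-refl
      ... | no _  | yes _ | no _  | yes _ = ≤-refl
      ... | no _  | yes _ | no _  | no _  = n≤1+n 1
      ... | no p  | no _  | yes q | _     = ⊥-elim (p (≡.sym q))
      ... | no _  | no p  | no _  | yes q = ⊥-elim (p (≡.sym q))
      ... | no _  | no _  | no _  | no _  = ≤-refl

  -- `A` parts of colour 0 and `B` parts of colour 1, each with an initial segment recoloured 2,
  -- followed by `C` parts wholly of colour 2. Recolouring shifts vertices from the first two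
  -- classes to the third.
  module Block {n A B C : ℕ} (yᴬ : Fin A → ℕ) (yᴮ : Fin B → ℕ) (yᴬ≤n : ∀ s → yᴬ s ≤ n) (yᴮ≤n : ∀ s → yᴮ s ≤ n) where

    r : ℕ
    r = A + (B + C)

    cut : ℕ → Fin 3 → Fin n → Fin 3
    cut y c x = if toℕ x <ᵇ y then 2F else c

    partCol : Fin r → Fin n → Fin 3
    partCol i with splitAt A i
    ... | inj₁ s = cut (yᴬ s) 0F
    ... | inj₂ t with splitAt B t
    ...   | inj₁ s = cut (yᴮ s) 1F
    ...   | inj₂ _ = λ _ → 2F

    col : Vertex n r → Fin 3
    col (i , x) = partCol i x

    amount : Fin 3 → Fin r → ℕ
    amount c i = sum (λ x → ⟦ col (i , x) Fin.≟ c ⟧)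

    private
      tally : Fin 3 → (Fin n → Fin 3) → ℕ
      tally c f = sum (λ x → ⟦ f x Fin.≟ c ⟧)

      tally-cut : ∀ {y} c d → y ≤ n → tally d (cut y c) ≡ y * ⟦ 2F Fin.≟ d ⟧ + (n ∸ y) * ⟦ c Fin.≟ d ⟧
      tally-cut {y} c d y≤n = trans (sum-cong-≗ point) (sum-step y ⟦ 2F Fin.≟ d ⟧ ⟦ c Fin.≟ d ⟧ y≤n)
        where
        point : ∀ x → ⟦ cut y c x Fin.≟ d ⟧ ≡ step y ⟦ 2F Fin.≟ d ⟧ ⟦ c Fin.≟ d ⟧ x
        point x with toℕ x <ᵇ y
        ... | true  = refl
        ... | false = refl

      colᴬ : ∀ s → partCol (s ↑ˡ (B + C)) ≡ cut (yᴬ s) 0F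
      colᴬ s rewrite Fin.splitAt-↑ˡ A s (B + C) = refl

      colᴮ : ∀ s → partCol (A ↑ʳ (s ↑ˡ C)) ≡ cut (yᴮ s) 1F
      colᴮ s rewrite Fin.splitAt-↑ʳ A (B + C) (s ↑ˡ C) | Fin.splitAt-↑ˡ B s C = refl

      colᶜ : ∀ s → partCol (A ↑ʳ (B ↑ʳ s)) ≡ λ _ → 2F
      colᶜ s rewrite Fin.splitAt-↑ʳ A (B + C) (B ↑ʳ s) | Fin.splitAt-↑ʳ B C s = refl

      size-split : ∀ c → ∑ (λ z → ⟦ col z Fin.≟ c ⟧) ≡
        sum (λ s → tally c (cut (yᴬ s) 0F)) + (sum (λ s → tally c (cut (yᴮ s) 1F)) + sum {C} (λ _ → tally c (λ _ → 2F)))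
      size-split c = trans (sum-++ A (amount c)) (cong₂ _+_ (sum-cong-≗ (λ s → cong (tally c) (colᴬ s)))
        (trans (sum-++ B (λ i → amount c (A ↑ʳ i)))
               (cong₂ _+_ (sum-cong-≗ (λ s → cong (tally c) (colᴮ s))) (sum-cong-≗ (λ s → cong (tally c) (colᶜ s))))))

      keep : ∀ y → y * 0 + (n ∸ y) * 1 ≡ n ∸ y
      keep y = trans (cong (_+ (n ∸ y) * 1) (*-zeroʳ y)) (*-identityʳ (n ∸ y))

      drop : ∀ y → y * 1 + (n ∸ y) * 0 ≡ y
      drop y = trans (cong (y * 1 +_) (*-zeroʳ (n ∸ y))) (trans (+-identityʳ _) (*-identityʳ y))

      none : ∀ y → y * 0 + (n ∸ y) * 0 ≡ 0
      none y = cong₂ _+_ (*-zeroʳ y) (*-zeroʳ (n ∸ y))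

      tally-2 : ∀ {y} c → c ≢ 2F → y ≤ n → tally 2F (cut y c) ≡ y
      tally-2 {y} 0F _ h = trans (tally-cut 0F 2F h) (drop y)
      tally-2 {y} 1F _ h = trans (tally-cut 1F 2F h) (drop y)
      tally-2 {y} 2F p h = ⊥-elim (p refl)

      complement : ∀ {M} (y : Fin M → ℕ) → (∀ s → y s ≤ n) → sum (λ s → n ∸ y s) + sum y ≡ M * n
      complement {M} y h = trans (≡.sym (∑-distrib-+ (λ s → n ∸ y s) y))
        (trans (sum-cong-≗ (λ s → m∸n+n≡m (h s))) (sum-const M n))

      zeros : ∀ {M} (f : Fin M → ℕ) → (∀ s → f s ≡ 0) → sum f ≡ 0
      zeros {M} f h = trans (sum-cong-≗ h) (trans (sum-const M 0) (*-zeroʳ M))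

      Yᴬ Yᴮ : ℕ
      Yᴬ = sum yᴬ
      Yᴮ = sum yᴮ

      size : Fin 3 → ℕ
      size c = ∑ (λ z → ⟦ col z Fin.≟ c ⟧)

    size-0 : size 0F + Yᴬ ≡ A * n
    size-0 = trans (cong (_+ Yᴬ) (trans (size-split 0F) (trans (cong₂ _+_
        (sum-cong-≗ (λ s → trans (tally-cut 0F 0F (yᴬ≤n s)) (keep (yᴬ s))))
        (cong₂ _+_ (zeros _ (λ s → trans (tally-cut 1F 0F (yᴮ≤n s)) (none (yᴮ s)))) (zeros {C} _ (λ _ → zeros {n} _ (λ _ → refl)))))
        (+-identityʳ _))))
      (complement yᴬ yᴬ≤n)

    size-1 : size 1F + Yᴮ ≡ B * n
    size-1 = trans (cong (_+ Yᴮ) (trans (size-split 1F) (trans (cong₂ _+_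
        (zeros _ (λ s → trans (tally-cut 0F 1F (yᴬ≤n s)) (none (yᴬ s))))
        (cong₂ _+_ (sum-cong-≗ (λ s → trans (tally-cut 1F 1F (yᴮ≤n s)) (keep (yᴮ s)))) (zeros {C} _ (λ _ → zeros {n} _ (λ _ → refl)))))
        (+-identityʳ _))))
      (complement yᴮ yᴮ≤n)

    size-2 : size 2F ≡ Yᴬ + (Yᴮ + C * n)
    size-2 = trans (size-split 2F) (cong₂ _+_
        (sum-cong-≗ (λ s → tally-2 0F (λ ()) (yᴬ≤n s)))
        (cong₂ _+_ (sum-cong-≗ (λ s → tally-2 1F (λ ()) (yᴮ≤n s))) (trans (sum-const C _) (cong (C *_) (trans (sum-const n 1) (*-identityʳ n))))))

    -- A vertex has degree rn - n, less the size of its class, plus the share of that class in its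
    -- part. The fields demand at least `d` for each kind of vertex: kept ones in the first two
    -- blocks, recoloured ones there, and those of the last block.
    record Degrees (d : ℕ) : Set where
      field
        first   : ∀ s → d + yᴬ s ≤ (B + C) * n + Yᴬ
        second  : ∀ s → d + yᴮ s ≤ (A + C) * n + Yᴮ
        cutᴬ    : ∀ s → 0 < yᴬ s → d + Yᴬ + Yᴮ + n ≤ (A + B) * n + yᴬ s
        cutᴮ    : ∀ s → 0 < yᴮ s → d + Yᴬ + Yᴮ + n ≤ (A + B) * n + yᴮ s
        third   : d + Yᴬ + Yᴮ ≤ (A + B) * n

    module _ {d : ℕ} (D : Degrees d) where
      open Degrees D

      private
        Good : Fin r → (Fin n → Fin 3) → Set
        Good i f = ∀ x → d + size (f x) + n ≤ r * n + tally (f x) f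

        good-cutᴬ : ∀ i s → Good i (cut (yᴬ s) 0F)
        good-cutᴬ i s x with toℕ x <ᵇ yᴬ s in eq
        ... | true  = arith (cutᴬ s (≤-trans (s≤s z≤n) (<ᵇ⇒< _ _ (subst Data.Bool.Base.T (≡.sym eq) _)))) size-2
                        (tally-2 0F (λ ()) (yᴬ≤n s))
          where
          arith : ∀ {S t y} → d + Yᴬ + Yᴮ + n ≤ (A + B) * n + y → S ≡ Yᴬ + (Yᴮ + C * n) → t ≡ y → d + S + n ≤ (A + (B + C)) * n + t
          arith {S} {t} {y} c e f = lin (d ∷ S ∷ n ∷ A ∷ B ∷ C ∷ t ∷ Yᴬ ∷ Yᴮ ∷ y ∷ []) 0 (# 0 :+ # 1 :+ # 2
              ≼ (# 3 :+ (# 4 :+ # 5)) :* # 2 :+ # 6)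
                          (1 · # 0 :+ # 7 :+ # 8 :+ # 2 ≼ (# 3 :+ # 4) :* # 2 :+ # 9 by c
                           ⊹ 1 · # 1 ≼ # 7 :+ (# 8 :+ # 5 :* # 2) by ≡⇒≤ e ⊹ 1 · # 9 ≼ # 6 by ≡⇒≥ f)
        ... | false = arith (first s) size-0 (trans (tally-cut 0F 0F (yᴬ≤n s)) (keep (yᴬ s))) (m∸n+n≡m (yᴬ≤n s))
          where
          arith : ∀ {S t y m} → d + y ≤ (B + C) * n + Yᴬ → S + Yᴬ ≡ A * n → t ≡ m → m + y ≡ n → d + S + n ≤ (A + (B + C)) * n + t
          arith {S} {t} {y} {m} c e f g = lin (d ∷ S ∷ n ∷ A ∷ B ∷ C ∷ t ∷ y ∷ Yᴬ ∷ m ∷ []) 0 (# 0 :+ # 1 :+ # 2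
              ≼ (# 3 :+ (# 4 :+ # 5)) :* # 2 :+ # 6)
              (1 · # 0 :+ # 7 ≼ (# 4 :+ # 5) :* # 2 :+ # 8 by c ⊹ 1 · # 1 :+ # 8 ≼ # 3 :* # 2 by ≡⇒≤ e
               ⊹ 1 · # 9 ≼ # 6 by ≡⇒≥ f ⊹ 1 · # 2 ≼ # 9 :+ # 7 by ≡⇒≥ g)

        good-cutᴮ : ∀ i s → Good i (cut (yᴮ s) 1F)
        good-cutᴮ i s x with toℕ x <ᵇ yᴮ s in eq
        ... | true  = arith (cutᴮ s (≤-trans (s≤s z≤n) (<ᵇ⇒< _ _ (subst Data.Bool.Base.T (≡.sym eq) _)))) size-2
                        (tally-2 1F (λ ()) (yᴮ≤n s))
          where
          arith : ∀ {S t y} → d + Yᴬ + Yᴮ + n ≤ (A + B) * n + y → S ≡ Yᴬ + (Yᴮ + C * n) → t ≡ y → d + S + n ≤ (A + (B + C)) * n + t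
          arith {S} {t} {y} c e f = lin (d ∷ S ∷ n ∷ A ∷ B ∷ C ∷ t ∷ Yᴬ ∷ Yᴮ ∷ y ∷ []) 0 (# 0 :+ # 1 :+ # 2
              ≼ (# 3 :+ (# 4 :+ # 5)) :* # 2 :+ # 6)
                          (1 · # 0 :+ # 7 :+ # 8 :+ # 2 ≼ (# 3 :+ # 4) :* # 2 :+ # 9 by c
                           ⊹ 1 · # 1 ≼ # 7 :+ (# 8 :+ # 5 :* # 2) by ≡⇒≤ e ⊹ 1 · # 9 ≼ # 6 by ≡⇒≥ f)
        ... | false = arith (second s) size-1 (trans (tally-cut 1F 1F (yᴮ≤n s)) (keep (yᴮ s))) (m∸n+n≡m (yᴮ≤n s))
          where
          arith : ∀ {S t y m} → d + y ≤ (A + C) * n + Yᴮ → S + Yᴮ ≡ B * n → t ≡ m → m + y ≡ n → d + S + n ≤ (A + (B + C)) * n + t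
          arith {S} {t} {y} {m} c e f g = lin (d ∷ S ∷ n ∷ A ∷ B ∷ C ∷ t ∷ y ∷ Yᴮ ∷ m ∷ []) 0 (# 0 :+ # 1 :+ # 2
              ≼ (# 3 :+ (# 4 :+ # 5)) :* # 2 :+ # 6)
              (1 · # 0 :+ # 7 ≼ (# 3 :+ # 5) :* # 2 :+ # 8 by c ⊹ 1 · # 1 :+ # 8 ≼ # 4 :* # 2 by ≡⇒≤ e
               ⊹ 1 · # 9 ≼ # 6 by ≡⇒≥ f ⊹ 1 · # 2 ≼ # 9 :+ # 7 by ≡⇒≥ g)

        good-full : ∀ i → Good i (λ _ → 2F)
        good-full i x = arith third size-2 (trans (sum-const n 1) (*-identityʳ n))
          where
          arith : ∀ {S t} → d + Yᴬ + Yᴮ ≤ (A + B) * n → S ≡ Yᴬ + (Yᴮ + C * n) → t ≡ n → d + S + n ≤ (A + (B + C)) * n + t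
          arith {S} {t} c e f = lin (d ∷ S ∷ n ∷ A ∷ B ∷ C ∷ t ∷ Yᴬ ∷ Yᴮ ∷ []) 0 (# 0 :+ # 1 :+ # 2
              ≼ (# 3 :+ (# 4 :+ # 5)) :* # 2 :+ # 6)
                          (1 · # 0 :+ # 7 :+ # 8 ≼ (# 3 :+ # 4) :* # 2 by c
                           ⊹ 1 · # 1 ≼ # 7 :+ (# 8 :+ # 5 :* # 2) by ≡⇒≤ e
                           ⊹ 1 · # 2 ≼ # 6 by ≡⇒≥ f)

        good : ∀ i → Good i (partCol i)
        good i with splitAt A i
        ... | inj₁ s = good-cutᴬ i s
        ... | inj₂ t with splitAt B t
        ...   | inj₁ s = good-cutᴮ i s
        ...   | inj₂ _ = good-full i

      block-degree : ∀ v → d ≤ degree (colourGraph col) v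
      block-degree (i , x) = arith (good i x) (colourGraph-degree col (i , x))
        where
        arith : ∀ {S a e} → d + S + n ≤ (A + (B + C)) * n + a → (A + (B + C)) * n + a ≤ e + S + n → d ≤ e
        arith {S} {a} {e} p q = lin (d ∷ e ∷ S ∷ n ∷ A ∷ B ∷ C ∷ a ∷ []) 0 (# 0 ≼ # 1)
                      (1 · # 0 :+ # 2 :+ # 3 ≼ (# 4 :+ (# 5 :+ # 6)) :* # 3 :+ # 7 by p
                       ⊹ 1 · (# 4 :+ (# 5 :+ # 6)) :* # 3 :+ # 7 ≼ # 1 :+ # 2 :+ # 3 by q)

-- The extremal constructions.

module LowerBounds where

  open import Data.Bool.Base using (Bool; true; false; if_then_else_; not; _∧_; _∨_; T)
  open import Data.Bool.Properties using (T?)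
  open import Data.Empty using (⊥; ⊥-elim)
  open import Data.Fin.Base using (Fin; suc; toℕ)
  open import Data.Fin.Patterns
  import Data.Fin.Properties as Fin
  open import Data.List.Base using ([]; _∷_)
  open import Data.Nat
  open import Data.Nat.Tactic.RingSolver using (solve-∀)
  open import Data.Nat.Properties hiding (_≟_)
  open import Data.Product using (_×_; _,_; Σ-syntax; proj₁; proj₂)
  open import Data.Unit.Base using (tt)
  open import Data.Vec.Base using (Vec; []; _∷_)
  open import Relation.Binary.PropositionalEquality using (_≡_; _≢_; refl; trans; cong₂; subst; ≢-sym)
  import Relation.Binary.PropositionalEquality as ≡
  open import Relation.Nullary using (¬_)
  open import Relation.Nullary.Decidable using (_×-dec_; ¬?)
  open LinearArithmetic
  open Sums
  open BlockColourings

  open BalancedPartiteGraph using (ContainsK; degree)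

  Witness : (n r d : ℕ) → Set₁
  Witness n r d = Σ[ G ∈ BalancedPartiteGraph n r ] ¬ ContainsK G 4 × (∀ v → d ≤ degree G v)

  plain : ∀ n d A B C → d ≤ (B + C) * n → d ≤ (A + C) * n → d ≤ (A + B) * n → Witness n (A + (B + C)) d
  plain n d A B C p q s = colourGraph col , colourGraph-¬K₄ col , block-degree record
    { first  = λ _ → lin (d ∷ B ∷ C ∷ n ∷ sum {A} (λ _ → 0) ∷ []) 0 (# 0 :+ κ 0 ≼ (# 1 :+ # 2) :* # 3 :+ # 4)
                       (1 · # 0 ≼ (# 1 :+ # 2) :* # 3 by p)
    ; second = λ _ → lin (d ∷ A ∷ C ∷ n ∷ sum {B} (λ _ → 0) ∷ []) 0 (# 0 :+ κ 0 ≼ (# 1 :+ # 2) :* # 3 :+ # 4)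
                       (1 · # 0 ≼ (# 1 :+ # 2) :* # 3 by q)
    ; cutᴬ   = λ _ ()
    ; cutᴮ   = λ _ ()
    ; third  = third (zero-sum A) (zero-sum B) }
    where
    open Block {n} {A} {B} {C} (λ _ → 0) (λ _ → 0) (λ _ → z≤n) (λ _ → z≤n)
    zero-sum : ∀ M → sum {M} (λ _ → 0) ≡ 0
    zero-sum M = trans (sum-const M 0) (*-zeroʳ M)
    third : ∀ {a b} → a ≡ 0 → b ≡ 0 → d + a + b ≤ (A + B) * n
    third refl refl = lin (d ∷ A ∷ B ∷ n ∷ []) 0 (# 0 :+ κ 0 :+ κ 0 ≼ (# 1 :+ # 2) :* # 3) (1 · # 0
        ≼ (# 1 :+ # 2) :* # 3 by s)

  -- k′ + 1 = k; each of the first two colours loses β vertices in p of its parts and α in the others.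
  stepped : ∀ {n} k′ g p β α → let k = suc k′; Y = p * β + (suc k ∸ p) * α in
    p ≤ suc k → β ≤ n → α ≤ n → g + β ≤ Y → g + α ≤ Y →
    (0 < β → g + 2 * Y ≤ n + β) → (0 < α → g + 2 * Y ≤ n + α) → g + 2 * Y ≤ 2 * n →
    Witness n (suc k + (suc k + k′)) (2 * (k * n) + g)
  stepped {n} k′ g p β α p≤ β≤n α≤n gβ gα cβ cα g2 = colourGraph col , colourGraph-¬K₄ col , block-degree record
    { first  = λ s → side s (value s) Y≡
    ; second = λ s → side s (value s) Y≡
    ; cutᴬ   = λ s pos → third s pos (value s) Y≡
    ; cutᴮ   = λ s pos → third s pos (value s) Y≡
    ; third  = full Y≡ }
    where
    k = suc k′
    Y = p * β + (suc k ∸ p) * α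
    y : Fin (suc k) → ℕ
    y = step p β α

    open import Data.Sum using (_⊎_; inj₁; inj₂)

    value : ∀ s → y s ≡ β ⊎ y s ≡ α
    value s with toℕ s <ᵇ p
    ... | true  = inj₁ refl
    ... | false = inj₂ refl

    y≤n : ∀ s → y s ≤ n
    y≤n s with value s
    ... | inj₁ e = ≤-trans (≤-reflexive e) β≤n
    ... | inj₂ e = ≤-trans (≤-reflexive e) α≤n

    open Block {n} {suc k} {suc k} {k′} y y y≤n y≤n

    Y≡ : sum y ≡ Y
    Y≡ = sum-step p β α p≤

    gβ′ : g + β ≤ Y
    gβ′ = gβ
    gα′ : g + α ≤ Y
    gα′ = gα
    cβ′ : 0 < β → g + 2 * Y ≤ n + β
    cβ′ = cβ
    cα′ : 0 < α → g + 2 * Y ≤ n + α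
    cα′ = cα
    g2′ : g + 2 * Y ≤ 2 * n
    g2′ = g2

    side : ∀ s {S} → y s ≡ β ⊎ y s ≡ α → S ≡ Y → 2 * (suc k′ * n) + g + y s ≤ (suc (suc k′) + k′) * n + S
    side s (inj₁ e) refl = lin (k′ ∷ n ∷ g ∷ y s ∷ Y ∷ β ∷ []) 0 (κ 2 :* ((κ 1 :+ # 0) :* # 1) :+ # 2 :+ # 3
        ≼ (κ 2 :+ # 0 :+ # 0) :* # 1 :+ # 4)
        (1 · # 2 :+ # 5 ≼ # 4 by gβ′ ⊹ 1 · # 3 ≼ # 5 by ≡⇒≤ e)
    side s (inj₂ e) refl = lin (k′ ∷ n ∷ g ∷ y s ∷ Y ∷ α ∷ []) 0 (κ 2 :* ((κ 1 :+ # 0) :* # 1) :+ # 2 :+ # 3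
        ≼ (κ 2 :+ # 0 :+ # 0) :* # 1 :+ # 4)
        (1 · # 2 :+ # 5 ≼ # 4 by gα′ ⊹ 1 · # 3 ≼ # 5 by ≡⇒≤ e)

    third : ∀ s {S} → 0 < y s → y s ≡ β ⊎ y s ≡ α → S ≡ Y →
      2 * (suc k′ * n) + g + S + S + n ≤ (suc (suc k′) + suc (suc k′)) * n + y s
    third s pos (inj₁ e) refl = lin (k′ ∷ n ∷ g ∷ Y ∷ y s ∷ β ∷ []) 0
        (κ 2 :* ((κ 1 :+ # 0) :* # 1) :+ # 2 :+ # 3 :+ # 3 :+ # 1 ≼ (κ 2 :+ # 0 :+ (κ 2 :+ # 0)) :* # 1 :+ # 4)
        (1 · # 2 :+ κ 2 :* # 3 ≼ # 1 :+ # 5 by cβ′ (subst (0 <_) e pos) ⊹ 1 · # 5 ≼ # 4 by ≡⇒≥ e)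
    third s pos (inj₂ e) refl = lin (k′ ∷ n ∷ g ∷ Y ∷ y s ∷ α ∷ []) 0
        (κ 2 :* ((κ 1 :+ # 0) :* # 1) :+ # 2 :+ # 3 :+ # 3 :+ # 1 ≼ (κ 2 :+ # 0 :+ (κ 2 :+ # 0)) :* # 1 :+ # 4)
        (1 · # 2 :+ κ 2 :* # 3 ≼ # 1 :+ # 5 by cα′ (subst (0 <_) e pos) ⊹ 1 · # 5 ≼ # 4 by ≡⇒≥ e)

    full : ∀ {S} → S ≡ Y → 2 * (suc k′ * n) + g + S + S ≤ (suc (suc k′) + suc (suc k′)) * n
    full refl = lin (k′ ∷ n ∷ g ∷ Y ∷ []) 0 (κ 2 :* ((κ 1 :+ # 0) :* # 1) :+ # 2 :+ # 3 :+ # 3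
        ≼ (κ 2 :+ # 0 :+ (κ 2 :+ # 0)) :* # 1)
                  (1 · # 2 :+ κ 2 :* # 3 ≼ κ 2 :* # 1 by g2′)

  -- Parts 0, 1 and parts 2, 3 form two blocks. Non-adjacent are, across parts, the first Δ vertices
  -- within a block and the remaining ones across blocks.
  module Four (n Δ : ℕ) (Δ≤n : Δ ≤ n) (2n≤3Δ : 2 * n ≤ 3 * Δ) where

    edge : Bool → Bool → Bool → Bool → Bool
    edge true  true  p q = not (p ∧ q)
    edge false false p q = not (p ∧ q)
    edge true  false p q = p ∨ q
    edge false true  p q = p ∨ q

    low odd : Fin 4 → Bool
    low 0F = true
    low 1F = true
    low 2F = false
    low 3F = false
    odd 0F = true
    odd 1F = false
    odd 2F = true
    odd 3F = false

    inner : Fin n → Bool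
    inner x = toℕ x <ᵇ Δ

    edge-sym : ∀ b c p q → T (edge b c p q) → T (edge c b q p)
    edge-sym true  true  true  false = λ t → t
    edge-sym true  true  false true  = λ t → t
    edge-sym true  true  false false = λ t → t
    edge-sym false false true  false = λ t → t
    edge-sym false false false true  = λ t → t
    edge-sym false false false false = λ t → t
    edge-sym true  false true  true  = λ t → t
    edge-sym true  false true  false = λ t → t
    edge-sym true  false false true  = λ t → t
    edge-sym false true  true  true  = λ t → t
    edge-sym false true  true  false = λ t → t
    edge-sym false true  false true  = λ t → t

    graph₄ : BalancedPartiteGraph n 4
    graph₄ = record
      { graph = record
        { Adj    = λ (i , x) (j , z) → i ≢ j × T (edge (low i) (low j) (inner x) (inner z))
        ; adj?   = λ (i , x) (j , z) → ¬? (i Fin.≟ j) ×-dec T? (edge (low i) (low j) (inner x) (inner z))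
        ; sym    = λ {(i , x)} {(j , z)} (p , e) → ≢-sym p , edge-sym (low i) (low j) (inner x) (inner z) e
        ; irrefl = λ { refl (p , _) → p refl } }
      ; independent = λ _ _ _ (p , _) → p refl }

    open BalancedPartiteGraph graph₄ using (Adj; adj?)

    private
      -- Two bits name a part, by block and position, and the third says whether the vertex is among
      -- the first `Δ`. The parts are required to differ.
      joinᵇ : Bool → Bool → Bool → Bool → Bool → Bool → Bool
      joinᵇ b c p b′ c′ p′ = not (same b b′ ∧ same c c′) ∧ edge b b′ p p′
        where
        same : Bool → Bool → Bool
        same true  x = x
        same false x = not x

      noK₄ᵇ : Vec Bool 12 → Bool
      noK₄ᵇ (b₀ ∷ c₀ ∷ p₀ ∷ b₁ ∷ c₁ ∷ p₁ ∷ b₂ ∷ c₂ ∷ p₂ ∷ b₃ ∷ c₃ ∷ p₃ ∷ []) =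
        not (joinᵇ b₀ c₀ p₀ b₁ c₁ p₁ ∧ joinᵇ b₀ c₀ p₀ b₂ c₂ p₂ ∧ joinᵇ b₀ c₀ p₀ b₃ c₃ p₃
             ∧ joinᵇ b₁ c₁ p₁ b₂ c₂ p₂ ∧ joinᵇ b₁ c₁ p₁ b₃ c₃ p₃ ∧ joinᵇ b₂ c₂ p₂ b₃ c₃ p₃)

      join : Vertex n 4 → Vertex n 4 → Bool
      join (i , x) (j , z) = joinᵇ (low i) (odd i) (inner x) (low j) (odd j) (inner z)

      adj⇒join : ∀ {u v} → Adj u v → T (join u v)
      adj⇒join {i , x} {j , z} (p , e) = go i j p e
        where
        go : ∀ i j → i ≢ j → T (edge (low i) (low j) (inner x) (inner z)) → T (join (i , x) (j , z))
        go 0F 0F p e = ⊥-elim (p refl)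
        go 0F 1F p e = e
        go 0F 2F p e = e
        go 0F 3F p e = e
        go 1F 0F p e = e
        go 1F 1F p e = ⊥-elim (p refl)
        go 1F 2F p e = e
        go 1F 3F p e = e
        go 2F 0F p e = e
        go 2F 1F p e = e
        go 2F 2F p e = ⊥-elim (p refl)
        go 2F 3F p e = e
        go 3F 0F p e = e
        go 3F 1F p e = e
        go 3F 2F p e = e
        go 3F 3F p e = ⊥-elim (p refl)

      refute : ∀ a b c d e f → T (not (a ∧ b ∧ c ∧ d ∧ e ∧ f)) → T a → T b → T c → T d → T e → T f → ⊥
      refute true true true true true true ()

    -- A K₄ would have one vertex in each part. In each block not both can be inner, and an outer
    -- vertex of one block misses the outer vertices of the other. The check runs over all codes of
    -- four vertices.
    graph₄-¬K₄ : ¬ ContainsK graph₄ 4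
    graph₄-¬K₄ (φ , _ , adjacent) =
      refute (j 0F 1F) (j 0F 2F) (j 0F 3F) (j 1F 2F) (j 1F 3F) (j 2F 3F)
        (∀ᵇ-sound 12 noK₄ᵇ tt (code 0F (code 1F (code 2F (code 3F [])))))
        (t (λ ())) (t (λ ())) (t (λ ())) (t (λ ())) (t (λ ())) (t (λ ()))
      where
      j : Fin 4 → Fin 4 → Bool
      j a b = join (φ a) (φ b)
      code : ∀ {m} → Fin 4 → Vec Bool m → Vec Bool (3 + m)
      code a bs = low (proj₁ (φ a)) ∷ odd (proj₁ (φ a)) ∷ inner (proj₂ (φ a)) ∷ bs
      t : ∀ {a b} → a ≢ b → T (j a b)
      t p = adj⇒join (adjacent _ _ p)

    private
      count : Bool → Bool → Bool → ℕ
      count b c p = sum {n} (λ z → if edge b c p (inner z) then 1 else 0)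

      all-n : sum {n} (λ _ → 1) ≡ n
      all-n = trans (sum-const n 1) (*-identityʳ n)

      inner-n : sum {n} (λ z → if inner z then 1 else 0) ≡ Δ
      inner-n = trans (sum-step Δ 1 0 Δ≤n) (trans (cong₂ _+_ (*-identityʳ Δ) (*-zeroʳ (n ∸ Δ))) (+-identityʳ Δ))

      outer-n : sum {n} (λ z → if not (inner z) then 1 else 0) ≡ n ∸ Δ
      outer-n = trans (sum-cong-≗ flip) (trans (sum-step Δ 0 1 Δ≤n) (cong₂ _+_ (*-zeroʳ Δ) (*-identityʳ (n ∸ Δ))))
        where
        flip : ∀ z → (if not (inner z) then 1 else 0) ≡ step Δ 0 1 z
        flip z with inner z
        ... | true  = refl
        ... | false = refl

      count-same : ∀ b p → count b b p ≡ (if p then n ∸ Δ else n)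
      count-same true  true  = outer-n
      count-same true  false = all-n
      count-same false true  = outer-n
      count-same false false = all-n

      count-across : ∀ b p → count b (not b) p ≡ (if p then n else Δ)
      count-across true  true  = all-n
      count-across true  false = inner-n
      count-across false true  = all-n
      count-across false false = inner-n

      enough : 3 * n ≤ Δ + (n + Δ + Δ)
      enough = lin (n ∷ Δ ∷ []) 0 (κ 3 :* # 0 ≼ # 1 :+ (# 0 :+ # 1 :+ # 1)) (1 · κ 2 :* # 0 ≼ κ 3 :* # 1 by 2n≤3Δ)

      -- An inner vertex sees exactly n - Δ vertices in the other part of its block and everything
      -- in the other block. An outer vertex sees n + 2Δ, which suffices because 2n ≤ 3Δ.
      total : ∀ p {s c c′} → s ≡ (if p then n ∸ Δ else n) → c ≡ (if p then n else Δ) → c′ ≡ (if p then n else Δ) →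
        3 * n ∸ Δ ≤ s + c + c′
      total true  refl refl refl = ≤-reflexive (trans (+-∸-comm (2 * n) Δ≤n) (rearrange (n ∸ Δ) n))
        where
        rearrange : ∀ m n → m + 2 * n ≡ m + n + n
        rearrange = solve-∀
      total false refl refl refl = m≤n+o⇒m∸n≤o (3 * n) Δ enough

    graph₄-degree : ∀ v → 3 * n ∸ Δ ≤ degree graph₄ v
    graph₄-degree (i , x) = ≤-trans (go i) (≤-reflexive (≡.sym (degree-∑ graph₄ (i , x))))
      where
      p = inner x
      row : Fin 4 → Fin 4 → ℕ
      row i j = sum (λ z → ⟦ adj? (i , x) (j , z) ⟧)
      go : ∀ i → 3 * n ∸ Δ ≤ ∑ (λ z → ⟦ adj? (i , x) z ⟧)
      go 0F = arrange (3 * n ∸ Δ) (row 0F 1F) (row 0F 2F) (row 0F 3F) (row 0F 0F) (total p (count-same true p) (count-across true p) (count-across true p))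
        where arrange : ∀ d s c c′ o → d ≤ s + c + c′ → d ≤ o + (s + (c + (c′ + 0)))
              arrange d s c c′ o h = lin (d ∷ o ∷ s ∷ c ∷ c′ ∷ []) 0 (# 0 ≼ # 1 :+ (# 2 :+ (# 3 :+ (# 4 :+ κ 0))))
                  (1 · # 0 ≼ # 2 :+ # 3 :+ # 4 by h)
      go 1F = arrange (3 * n ∸ Δ) (row 1F 0F) (row 1F 2F) (row 1F 3F) (row 1F 1F) (total p (count-same true p) (count-across true p) (count-across true p))
        where arrange : ∀ d s c c′ o → d ≤ s + c + c′ → d ≤ s + (o + (c + (c′ + 0)))
              arrange d s c c′ o h = lin (d ∷ s ∷ o ∷ c ∷ c′ ∷ []) 0 (# 0 ≼ # 1 :+ (# 2 :+ (# 3 :+ (# 4 :+ κ 0))))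
                  (1 · # 0 ≼ # 1 :+ # 3 :+ # 4 by h)
      go 2F = arrange (3 * n ∸ Δ) (row 2F 3F) (row 2F 0F) (row 2F 1F) (row 2F 2F) (total p (count-same false p) (count-across false p) (count-across false p))
        where arrange : ∀ d s c c′ o → d ≤ s + c + c′ → d ≤ c + (c′ + (o + (s + 0)))
              arrange d s c c′ o h = lin (d ∷ c ∷ c′ ∷ o ∷ s ∷ []) 0 (# 0 ≼ # 1 :+ (# 2 :+ (# 3 :+ (# 4 :+ κ 0))))
                  (1 · # 0 ≼ # 4 :+ # 1 :+ # 2 by h)
      go 3F = arrange (3 * n ∸ Δ) (row 3F 2F) (row 3F 0F) (row 3F 1F) (row 3F 3F) (total p (count-same false p) (count-across false p) (count-across false p))
        where arrange : ∀ d s c c′ o → d ≤ s + c + c′ → d ≤ c + (c′ + (s + (o + 0)))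
              arrange d s c c′ o h = lin (d ∷ c ∷ c′ ∷ s ∷ o ∷ []) 0 (# 0 ≼ # 1 :+ (# 2 :+ (# 3 :+ (# 4 :+ κ 0))))
                  (1 · # 0 ≼ # 3 :+ # 1 :+ # 2 by h)

    witness₄ : Witness n 4 (3 * n ∸ Δ)
    witness₄ = graph₄ , graph₄-¬K₄ , graph₄-degree

-- Matching constructions with upper bounds, and the final formula.

open import Data.Empty using (⊥-elim)
open import Data.Fin.Base as Fin using (Fin; fromℕ<)
open import Data.List.Base using ([]; _∷_)
open import Data.Nat
open import Data.Nat.Divisibility using (_∣_; _∤_; _∣?_; divides)
open import Data.Nat.DivMod
open import Data.Nat.Tactic.RingSolver using (solve; solve-∀)
open import Data.Nat.Properties
open import Data.Product using (_×_; _,_; ∃-syntax)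
open import Data.Sum using (inj₁; inj₂)
open import Relation.Binary.PropositionalEquality using (_≡_; refl; trans; cong; cong₂; subst; sym)
open import Relation.Nullary using (¬_; Dec; yes; no)
open LinearArithmetic
open Sums
open UpperBounds
open FourPartite using (module FourParts)
open LowerBounds

open BalancedPartiteGraph using (ContainsK; degree)

Bounded : (n r d : ℕ) → Set₁
Bounded n r d = ∀ (G : BalancedPartiteGraph n r) → ¬ ContainsK G 4 → ¬ (∀ v → d < degree G v)

-- The bound is used twice: on the witness, whose minimum degree is thereby exactly `d`, and on
-- every competitor.
extremal : ∀ {n r d} → Witness n r d → Bounded n r d → f⟨ n , r , 4 ⟩≡ d
extremal {n} {r} {d} (G , ¬K , ≥d) bounded = (G , ¬K , ≥d , attained (∃? (λ v → degree G v ≟ d))) , maximal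
  where
  attained : Dec (∃[ v ] degree G v ≡ d) → ∃[ v ] degree G v ≡ d
  attained (yes p) = p
  attained (no ¬p) = ⊥-elim (bounded G ¬K (λ v → ≤∧≢⇒< (≥d v) (λ e → ¬p (v , sym e))))

  maximal : ∀ G d′ → ¬ ContainsK G 4 → BalancedPartiteGraph.IsMinDegree G d′ → d′ ≤ d
  maximal G d′ ¬K (≥d′ , _) = ≮⇒≥ (λ lt → bounded G ¬K (λ v → <-≤-trans lt (≥d′ v)))

deg-∑ : ∀ {n r d} (G : BalancedPartiteGraph n r) → (∀ v → d ≤ degree G v) →
        ∀ v → d ≤ Counting.deg (BalancedPartiteGraph.graph G) v
deg-∑ G h v = ≤-trans (h v) (≤-reflexive (degree-∑ G v))

div-unique : ∀ {a t} q d .{{_ : NonZero d}} → t < d → a ≡ t + q * d → a / d ≡ q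
div-unique {a} {t} q d t<d eq = ≤-antisym
  (s≤s⁻¹ (m<n*o⇒m/o<n (<-≤-trans (≤-<-trans (≤-reflexive eq) (+-monoˡ-< (q * d) t<d)) ≤-refl)))
  (≤-trans (≤-reflexive (sym (m*n/n≡m q d))) (/-monoˡ-≤ d (≤-trans (m≤n+m (q * d) t) (≤-reflexive (sym eq)))))

case₄ : ∀ n → 1 ≤ n → f⟨ n , 4 , 4 ⟩≡ (3 * n ∸ ⌈ 2 * n / 3 ⌉)
case₄ n 1≤n = extremal (Four.witness₄ n W W≤n 2n≤3W) bounded
  where
  W = ⌈ 2 * n / 3 ⌉

  eq : 2 * n + 2 ≡ (2 * n + 2) % 3 + W * 3
  eq = m≡m%n+[m/n]*n (2 * n + 2) 3

  2n≤3W : 2 * n ≤ 3 * W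
  2n≤3W = lin (n ∷ W ∷ (2 * n + 2) % 3 ∷ []) 0 (κ 2 :* # 0 ≼ κ 3 :* # 1)
            (1 · κ 2 :* # 0 :+ κ 2 ≼ # 2 :+ # 1 :* κ 3 by ≡⇒≤ eq ⊹ 1 · κ 1 :+ # 2 ≼ κ 3 by m%n<n (2 * n + 2) 3)

  3W≤ : 3 * W ≤ 2 * n + 2
  3W≤ = lin (W ∷ n ∷ (2 * n + 2) % 3 ∷ []) 0 (κ 3 :* # 0 ≼ κ 2 :* # 1 :+ κ 2)
          (1 · # 2 :+ # 0 :* κ 3 ≼ κ 2 :* # 1 :+ κ 2 by ≡⇒≥ eq)

  W≤n : W ≤ n
  W≤n = lin (W ∷ n ∷ []) 2 (# 0 ≼ # 1) (1 · κ 3 :* # 0 ≼ κ 2 :* # 1 :+ κ 2 by 3W≤ ⊹ 1 · κ 1 ≼ # 1 by 1≤n)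

  3n : 3 * n ∸ W + W ≡ 3 * n
  3n = m∸n+n≡m (≤-trans W≤n (m≤n*m n 3))

  bounded : Bounded n 4 (3 * n ∸ W)
  -- With δ = 3n - W + 1 and 3W ≤ 2n + 2, indeed 3δ ≥ 7n + 1.
  bounded G ¬K h = FourParts.upper₄ G (deg-∑ G h) (¬K₄⇒K₄-free G ¬K)
    (lin (n ∷ 3 * n ∸ W ∷ W ∷ []) 0 (κ 1 :+ κ 7 :* # 0 ≼ κ 3 :* (κ 1 :+ # 1))
       (3 · κ 3 :* # 0 ≼ # 1 :+ # 2 by ≡⇒≥ 3n ⊹ 1 · κ 3 :* # 2 ≼ κ 2 :* # 0 :+ κ 2 by 3W≤)) (fromℕ< 1≤n)

case₀ : ∀ k n → 1 ≤ k → 1 ≤ n → f⟨ n , k + (k + k) , 4 ⟩≡ (2 * (k * n))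
case₀ k n 1≤k 1≤n = extremal (plain n (2 * (k * n)) k k k d≤ d≤ d≤) λ G ¬K h →
  upper₀ G (deg-∑ G h) (¬K₄⇒K₄-free G ¬K) (fromℕ< {m = 0} (≤-trans 1≤k (m≤m+n k (k + k))) , fromℕ< 1≤n) {k} rn≡ ≤-refl
  where
  d≤ : 2 * (k * n) ≤ (k + k) * n
  d≤ = lin (k ∷ n ∷ []) 0 (κ 2 :* (# 0 :* # 1) ≼ (# 0 :+ # 0) :* # 1) ∅
  rn≡ : (k + (k + k)) * n ≡ 3 * (k * n)
  rn≡ = solve (k ∷ n ∷ [])

case₂ : ∀ k n → 1 ≤ k → 1 ≤ n → f⟨ n , suc k + (suc k + k) , 4 ⟩≡ (2 * (k * n) + n)
case₂ k n 1≤k 1≤n = extremal (plain n (2 * (k * n) + n) (suc k) (suc k) k (lin (k ∷ n ∷ []) 0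
    (κ 2 :* (# 0 :* # 1) :+ # 1 ≼ (κ 1 :+ # 0 :+ # 0) :* # 1) ∅) (lin (k ∷ n ∷ []) 0 (κ 2 :* (# 0 :* # 1) :+ # 1
    ≼ (κ 1 :+ # 0 :+ # 0) :* # 1) ∅) (lin (k ∷ n ∷ []) 0 (κ 2 :* (# 0 :* # 1) :+ # 1
    ≼ (κ 1 :+ # 0 :+ (κ 1 :+ # 0)) :* # 1) ∅)) λ G ¬K h →
  upper₂ G (deg-∑ G h) (¬K₄⇒K₄-free G ¬K) (Fin.zero , fromℕ< 1≤n) {k} 1≤k 1≤n rn≡ (lin (k ∷ n ∷ []) 0
      (κ 2 :* (# 0 :* # 1) :+ κ 1 :+ κ 1 :* # 1 ≼ κ 1 :+ (κ 2 :* (# 0 :* # 1) :+ # 1)) ∅)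
  where
  rn≡ : (suc k + (suc k + k)) * n ≡ 3 * (k * n) + n + 1 * n
  rn≡ = solve (k ∷ n ∷ [])

-- Below r = 3k + 1 with k = k′ + 1, and n = qr + ρ.
module Case₁ (k′ n : ℕ) (1≤k′ : 1 ≤ k′) (1≤n : 1 ≤ n) where

  k r q ρ : ℕ
  k = suc k′
  r = suc k + (suc k + k′)
  q = n / r
  ρ = n % r

  n≡ : n ≡ ρ + q * (suc (suc k′) + (suc (suc k′) + k′))
  n≡ = m≡m%n+[m/n]*n n r

  ρ<r : ρ < suc (suc k′) + (suc (suc k′) + k′)
  ρ<r = m%n<n n r

  Value : ℕ → Set₁
  Value g = Witness n r (2 * (k * n) + g)

  private
    double : ∀ {y} → y ≤ n → n + y ≤ 2 * n
    double {y} y≤n = lin (n ∷ y ∷ []) 0 (# 0 :+ # 1 ≼ κ 2 :* # 0) (1 · # 1 ≼ # 0 by y≤n)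

  -- Cutting `q` vertices from each of the k + 1 parts satisfies the side conditions with equality,
  -- and the condition at the cut vertices becomes (3k + 1) q ≤ n.
  uniform : Value (k * q)
  uniform = stepped k′ (k * q) 0 q q z≤n q≤n q≤n lo lo (λ _ → c) (λ _ → c) (≤-trans c (double q≤n))
    where
    q≤n : q ≤ n
    q≤n = lin (q ∷ n ∷ ρ ∷ k′ ∷ []) 0 (# 0 ≼ # 1)
            (1 · # 2 :+ # 0 :* (κ 2 :+ # 3 :+ (κ 2 :+ # 3 :+ # 3)) ≼ # 1 by ≡⇒≥ n≡)
    lo : suc k′ * q + q ≤ suc (suc k′) * q
    lo = lin (k′ ∷ q ∷ []) 0 ((κ 1 :+ # 0) :* # 1 :+ # 1 ≼ (κ 2 :+ # 0) :* # 1) ∅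
    c : suc k′ * q + 2 * (suc (suc k′) * q) ≤ n + q
    c = lin (k′ ∷ q ∷ n ∷ ρ ∷ []) 0 ((κ 1 :+ # 0) :* # 1 :+ κ 2 :* ((κ 2 :+ # 0) :* # 1) ≼ # 2 :+ # 1)
          (1 · # 3 :+ # 1 :* (κ 2 :+ # 0 :+ (κ 2 :+ # 0 :+ # 0)) ≼ # 2 by ≡⇒≥ n≡)

  -- Now Y = (k + 1) q + j + 1 equals g + (q + 1), and the condition at the cut vertices becomes 3j
  -- + 2 ≤ ρ.
  unequal : ∀ j → j ≤ k → 3 * j + 2 ≤ ρ → Value (k * q + j)
  unequal j j≤k ρ≥ = stepped k′ (k * q + j) (suc j) (suc q) q (s≤s j≤k) sq≤n (≤-trans (n≤1+n q) sq≤n)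
    lo (≤-trans (+-monoʳ-≤ (k * q + j) (n≤1+n q)) lo) (λ _ → ≤-trans hi (+-monoʳ-≤ n (n≤1+n q))) (λ _ → hi)
    (≤-trans hi (double (≤-trans (n≤1+n q) sq≤n)))
    where
    l = k ∸ j
    l+j : l + j ≡ suc k′
    l+j = m∸n+n≡m j≤k
    sq≤n : suc q ≤ n
    sq≤n = lin (q ∷ n ∷ ρ ∷ k′ ∷ j ∷ []) 0 (κ 1 :+ # 0 ≼ # 1)
             (1 · # 2 :+ # 0 :* (κ 2 :+ # 3 :+ (κ 2 :+ # 3 :+ # 3)) ≼ # 1 by ≡⇒≥ n≡
              ⊹ 1 · κ 3 :* # 4 :+ κ 2 ≼ # 2 by ρ≥)
    lo : suc k′ * q + j + suc q ≤ suc j * suc q + l * q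
    lo = lin (k′ ∷ q ∷ j ∷ l ∷ []) 0 ((κ 1 :+ # 0) :* # 1 :+ # 2 :+ (κ 1 :+ # 1)
        ≼ (κ 1 :+ # 2) :* (κ 1 :+ # 1) :+ # 3 :* # 1)
           (1 · (κ 1 :+ # 0) :* # 1 ≼ (# 3 :+ # 2) :* # 1 by scaleʳ q (≡⇒≥ l+j))
    hi : suc k′ * q + j + 2 * (suc j * suc q + l * q) ≤ n + q
    hi = lin (k′ ∷ q ∷ j ∷ l ∷ n ∷ ρ ∷ []) 0
        ((κ 1 :+ # 0) :* # 1 :+ # 2 :+ κ 2 :* ((κ 1 :+ # 2) :* (κ 1 :+ # 1) :+ # 3 :* # 1) ≼ # 4 :+ # 1)
           (2 · (# 3 :+ # 2) :* # 1 ≼ (κ 1 :+ # 0) :* # 1 by scaleʳ q (≡⇒≤ l+j)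
            ⊹ 1 · # 5 :+ # 1 :* (κ 2 :+ # 0 :+ (κ 2 :+ # 0 :+ # 0)) ≼ # 4 by ≡⇒≥ n≡
            ⊹ 1 · κ 3 :* # 2 :+ κ 2 ≼ # 5 by ρ≥)

  -- The quotient `t` is the number of uncut parts in either block, as in the equality case of the
  -- upper bound. The other k + 1 - t parts lose q + 1 vertices each, and Y = g + q + 1 and g + 2Y =
  -- n + q + 1 hold exactly.
  few-cut : ∀ h → h ≤ k → ρ ≡ 3 * h + 1 → suc q ∣ (k ∸ h) → Value (k * q + h)
  few-cut h h≤k ρ≡ (divides t k∸h≡) = stepped k′ (k * q + h) (suc s) (suc q) 0 (s≤s (m∸n≤m k t)) sq≤n z≤n
    lo (≤-trans (+-monoʳ-≤ (k * q + h) z≤n) lo) (λ _ → hi) (λ ()) (≤-trans hi (double sq≤n))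
    where
    s = k ∸ t
    tq+h : t * suc q + h ≡ suc k′
    tq+h = trans (cong (_+ h) (sym k∸h≡)) (m∸n+n≡m h≤k)
    t≤k : t ≤ suc k′
    t≤k = lin (t ∷ k′ ∷ q ∷ h ∷ []) 0 (# 0 ≼ κ 1 :+ # 1) (1 · # 0 :* (κ 1 :+ # 2) :+ # 3 ≼ κ 1 :+ # 1 by ≡⇒≤ tq+h)
    s+t : s + t ≡ suc k′
    s+t = m∸n+n≡m t≤k
    sq≤n : suc q ≤ n
    sq≤n = lin (q ∷ n ∷ ρ ∷ k′ ∷ h ∷ []) 0 (κ 1 :+ # 0 ≼ # 1)
             (1 · # 2 :+ # 0 :* (κ 2 :+ # 3 :+ (κ 2 :+ # 3 :+ # 3)) ≼ # 1 by ≡⇒≥ n≡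
              ⊹ 1 · κ 3 :* # 4 :+ κ 1 ≼ # 2 by ≡⇒≥ ρ≡)
    lo : suc k′ * q + h + suc q ≤ suc s * suc q + (suc (suc k′) ∸ suc s) * 0
    lo = lin (k′ ∷ q ∷ h ∷ s ∷ suc (suc k′) ∸ suc s ∷ t ∷ []) 0 ((κ 1 :+ # 0) :* # 1 :+ # 2 :+ (κ 1 :+ # 1)
        ≼ (κ 1 :+ # 3) :* (κ 1 :+ # 1) :+ # 4 :* κ 0)
           (1 · (κ 1 :+ # 0) :* (κ 1 :+ # 1) ≼ (# 3 :+ # 5) :* (κ 1 :+ # 1) by scaleʳ (suc q) (≡⇒≥ s+t)
            ⊹ 1 · # 5 :* (κ 1 :+ # 1) :+ # 2 ≼ κ 1 :+ # 0 by ≡⇒≤ tq+h)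
    hi : suc k′ * q + h + 2 * (suc s * suc q + (suc (suc k′) ∸ suc s) * 0) ≤ n + suc q
    hi = lin (k′ ∷ q ∷ h ∷ s ∷ suc (suc k′) ∸ suc s ∷ n ∷ t ∷ ρ ∷ []) 0
        ((κ 1 :+ # 0) :* # 1 :+ # 2 :+ κ 2 :* ((κ 1 :+ # 3) :* (κ 1 :+ # 1) :+ # 4 :* κ 0) ≼ # 5 :+ (κ 1 :+ # 1))
           (2 · (# 3 :+ # 6) :* (κ 1 :+ # 1) ≼ (κ 1 :+ # 0) :* (κ 1 :+ # 1) by scaleʳ (suc q) (≡⇒≤ s+t)
            ⊹ 2 · κ 1 :+ # 0 ≼ # 6 :* (κ 1 :+ # 1) :+ # 2 by ≡⇒≥ tq+h
            ⊹ 1 · # 7 :+ # 1 :* (κ 2 :+ # 0 :+ (κ 2 :+ # 0 :+ # 0)) ≼ # 5 by ≡⇒≥ n≡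
            ⊹ 1 · κ 3 :* # 2 :+ κ 1 ≼ # 7 by ≡⇒≥ ρ≡)

  private
    p : ℕ
    p = suc k′ + (suc (suc k′) + k′)

    F : ℕ
    F = suc k′ * n / r

    N≡ : suc k′ * n ≡ suc k′ * n % r + F * suc (suc k′ + (suc (suc k′) + k′))
    N≡ = m≡m%n+[m/n]*n (suc k′ * n) r

    N%r<r : suc k′ * n % r < suc (suc k′ + (suc (suc k′) + k′))
    N%r<r = m%n<n (suc k′ * n) r

    F≤N : F ≤ suc k′ * n
    F≤N = lin (F ∷ k′ ∷ n ∷ suc k′ * n % r ∷ []) 0 (# 0 ≼ (κ 1 :+ # 1) :* # 2)
            (1 · # 3 :+ # 0 :* (κ 2 :+ # 1 :+ (κ 2 :+ # 1 :+ # 1)) ≼ (κ 1 :+ # 1) :* # 2 by ≡⇒≥ N≡)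

    -- As p = r - 1, the numerator is r times kn minus kn, so rounding up turns into subtracting the
    -- floor `F`.
    ceiling : ⌈ suc k′ * p * n / r ⌉ ≡ suc k′ * n ∸ F
    ceiling = div-unique (suc k′ * n ∸ F) r (s≤s (m∸n≤m p (suc k′ * n % r))) eq
      where
      M+F : suc k′ * n ∸ F + F ≡ suc k′ * n
      M+F = m∸n+n≡m F≤N
      t+s : p ∸ suc k′ * n % r + suc k′ * n % r ≡ suc k′ + (suc (suc k′) + k′)
      t+s = m∸n+n≡m (s≤s⁻¹ N%r<r)
      eq : suc k′ * (suc k′ + (suc (suc k′) + k′)) * n + (suc k′ + (suc (suc k′) + k′))
         ≡ (p ∸ suc k′ * n % r) + (suc k′ * n ∸ F) * (suc (suc k′) + (suc (suc k′) + k′))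
      eq = ≤-antisym
        (lin (k′ ∷ n ∷ p ∸ suc k′ * n % r ∷ suc k′ * n ∸ F ∷ suc k′ * n % r ∷ F ∷ []) 0
            ((κ 1 :+ # 0) :* (κ 1 :+ # 0 :+ (κ 2 :+ # 0 :+ # 0)) :* # 1 :+ (κ 1 :+ # 0 :+ (κ 2 :+ # 0 :+ # 0))
            ≼ # 2 :+ # 3 :* (κ 2 :+ # 0 :+ (κ 2 :+ # 0 :+ # 0)))
           (1 · # 4 :+ # 5 :* (κ 2 :+ # 0 :+ (κ 2 :+ # 0 :+ # 0)) ≼ (κ 1 :+ # 0) :* # 1 by ≡⇒≥ N≡
            ⊹ 1 · (κ 1 :+ # 0 :+ (κ 2 :+ # 0 :+ # 0) :+ κ 1) :* ((κ 1 :+ # 0) :* # 1) ≼ (κ 1 :+ # 0 :+ (κ 2 :+ # 0 :+ # 0) :+ κ 1) :* (# 3 :+ # 5)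
                by scaleˡ (suc k′ + (suc (suc k′) + k′) + 1) (≡⇒≥ M+F)
            ⊹ 1 · κ 1 :+ # 0 :+ (κ 2 :+ # 0 :+ # 0) ≼ # 2 :+ # 4 by ≡⇒≥ t+s))
        (lin (p ∸ suc k′ * n % r ∷ suc k′ * n ∸ F ∷ k′ ∷ n ∷ suc k′ * n % r ∷ F ∷ []) 0
            (# 0 :+ # 1 :* (κ 2 :+ # 2 :+ (κ 2 :+ # 2 :+ # 2))
            ≼ (κ 1 :+ # 2) :* (κ 1 :+ # 2 :+ (κ 2 :+ # 2 :+ # 2)) :* # 3 :+ (κ 1 :+ # 2 :+ (κ 2 :+ # 2 :+ # 2)))
           (1 · (κ 1 :+ # 2) :* # 3 ≼ # 4 :+ # 5 :* (κ 2 :+ # 2 :+ (κ 2 :+ # 2 :+ # 2)) by ≡⇒≤ N≡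
            ⊹ 1 · (κ 1 :+ # 2 :+ (κ 2 :+ # 2 :+ # 2) :+ κ 1) :* (# 1 :+ # 5) ≼ (κ 1 :+ # 2 :+ (κ 2 :+ # 2 :+ # 2) :+ κ 1) :* ((κ 1 :+ # 2) :* # 3)
                by scaleˡ (suc k′ + (suc (suc k′) + k′) + 1) (≡⇒≤ M+F)
            ⊹ 1 · # 0 :+ # 4 ≼ κ 1 :+ # 2 :+ (κ 2 :+ # 2 :+ # 2) by ≡⇒≤ t+s))

    value : (r ∸ 1) * n ∸ ⌈ suc k′ * (r ∸ 1) * n / r ⌉ ≡ 2 * (k * n) + F
    value = trans (cong (p * n ∸_) ceiling)
      (trans (cong (_∸ (suc k′ * n ∸ F)) split) (m+n∸n≡m (2 * (k * n) + F) (suc k′ * n ∸ F)))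
      where
      M+F : suc k′ * n ∸ F + F ≡ suc k′ * n
      M+F = m∸n+n≡m F≤N
      split : (suc k′ + (suc (suc k′) + k′)) * n ≡ 2 * (suc k′ * n) + F + (suc k′ * n ∸ F)
      split = ≤-antisym (lin (k′ ∷ n ∷ F ∷ suc k′ * n ∸ F ∷ []) 0 ((κ 1 :+ # 0 :+ (κ 2 :+ # 0 :+ # 0)) :* # 1
          ≼ κ 2 :* ((κ 1 :+ # 0) :* # 1) :+ # 2 :+ # 3)
          (1 · (κ 1 :+ # 0) :* # 1 ≼ # 3 :+ # 2
              by ≡⇒≥ M+F)) (lin (k′ ∷ n ∷ F ∷ suc k′ * n ∸ F ∷ []) 0 (κ 2 :* ((κ 1 :+ # 0) :* # 1) :+ # 2 :+ # 3
                  ≼ (κ 1 :+ # 0 :+ (κ 2 :+ # 0 :+ # 0)) :* # 1)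
              (1 · # 3 :+ # 2 ≼ (κ 1 :+ # 0) :* # 1 by ≡⇒≤ M+F))

    floor : ∀ g {t} → t < r → suc k′ * ρ ≡ t + g * (suc (suc k′) + (suc (suc k′) + k′)) → F ≡ k * q + g
    floor g {t} t<r eq = div-unique (k * q + g) r t<r eq′
      where
      eq′ : suc k′ * n ≡ t + (suc k′ * q + g) * (suc (suc k′) + (suc (suc k′) + k′))
      eq′ = ≤-antisym (lin (k′ ∷ n ∷ t ∷ q ∷ g ∷ ρ ∷ []) 0 ((κ 1 :+ # 0) :* # 1
          ≼ # 2 :+ ((κ 1 :+ # 0) :* # 3 :+ # 4) :* (κ 2 :+ # 0 :+ (κ 2 :+ # 0 :+ # 0)))
          (1 · (κ 1 :+ # 0) :* # 1 ≼ (κ 1 :+ # 0) :* (# 5 :+ # 3 :* (κ 2 :+ # 0 :+ (κ 2 :+ # 0 :+ # 0)))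
              by scaleˡ (suc k′) (≡⇒≤ n≡)
           ⊹ 1 · (κ 1 :+ # 0) :* # 5 ≼ # 2 :+ # 4 :* (κ 2 :+ # 0 :+ (κ 2 :+ # 0 :+ # 0)) by ≡⇒≤ eq))
                      (lin (t ∷ k′ ∷ q ∷ g ∷ n ∷ ρ ∷ []) 0
                          (# 0 :+ ((κ 1 :+ # 1) :* # 2 :+ # 3) :* (κ 2 :+ # 1 :+ (κ 2 :+ # 1 :+ # 1))
                          ≼ (κ 1 :+ # 1) :* # 4)
                          (1 · (κ 1 :+ # 1) :* (# 5 :+ # 2 :* (κ 2 :+ # 1 :+ (κ 2 :+ # 1 :+ # 1))) ≼ (κ 1 :+ # 1) :* # 4
                              by scaleˡ (suc k′) (≡⇒≥ n≡)
                           ⊹ 1 · # 0 :+ # 3 :* (κ 2 :+ # 1 :+ (κ 2 :+ # 1 :+ # 1)) ≼ (κ 1 :+ # 1) :* # 5 by ≡⇒≥ eq))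

    η-yes : ∀ {m} → Exceptional n r m → η n r m ≡ 1
    η-yes {m} e with exceptional? n r m
    ... | yes _ = refl
    ... | no ¬e = ⊥-elim (¬e e)

    η-no : ∀ {m} → ¬ Exceptional n r m → η n r m ≡ 0
    η-no {m} ¬e with exceptional? n r m
    ... | yes e = ⊥-elim (¬e e)
    ... | no _  = refl

    v₀ : Vertex n r
    v₀ = Fin.zero , fromℕ< 1≤n

    rn≡ : (suc (suc k′) + (suc (suc k′) + k′)) * n ≡ 3 * (suc k′ * n) + n + 0 * n
    rn≡ = solve (k′ ∷ n ∷ [])

    bounded-floor : Bounded n r (2 * (k * n) + F)
    bounded-floor G ¬K h = upper₁ G (deg-∑ G h) (¬K₄⇒K₄-free G ¬K) v₀ {k} {suc F} (s≤s 1≤k′) 1≤n rn≡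
      (inj₁ excess) (lin (k ∷ n ∷ F ∷ []) 0 (κ 2 :* (# 0 :* # 1) :+ (κ 1 :+ # 2) :+ κ 0 :* # 1
          ≼ κ 1 :+ (κ 2 :* (# 0 :* # 1) :+ # 2)) ∅)
      where
      excess : suc k′ * n < (3 * suc k′ + 1) * suc F
      excess = lin (k′ ∷ n ∷ F ∷ suc k′ * n % r ∷ []) 0 (κ 1 :+ (κ 1 :+ # 0) :* # 1
          ≼ (κ 3 :* (κ 1 :+ # 0) :+ κ 1) :* (κ 1 :+ # 2))
                 (1 · (κ 1 :+ # 0) :* # 1 ≼ # 3 :+ # 2 :* (κ 2 :+ # 0 :+ (κ 2 :+ # 0 :+ # 0)) by ≡⇒≤ N≡
                  ⊹ 1 · κ 1 :+ # 3 ≼ κ 2 :+ # 0 :+ (κ 2 :+ # 0 :+ # 0) by N%r<r)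

    -- Here h = j + 1, so the floor is kq + j + 1; the failure of divisibility lowers the bound by
    -- one.
    bounded-exceptional : ∀ j → suc j ≤ k → ρ ≡ 3 * suc j + 1 → ¬ (suc q ∣ (k ∸ suc j)) →
      Bounded n r (2 * (k * n) + (k * q + j))
    bounded-exceptional j j≤k ρ≡ ¬d G ¬K h =
      upper₁ G (deg-∑ G h) (¬K₄⇒K₄-free G ¬K) v₀ {k} {k * q + suc j} (s≤s 1≤k′) 1≤n rn≡
        (inj₂ (q , suc j , s≤s z≤n , j≤k , refl , n≡′ , ¬d)) (lin (k ∷ n ∷ q ∷ j ∷ []) 0
            (κ 2 :* (# 0 :* # 1) :+ (# 0 :* # 2 :+ (κ 1 :+ # 3)) :+ κ 0 :* # 1
            ≼ κ 1 :+ (κ 2 :* (# 0 :* # 1) :+ (# 0 :* # 2 :+ # 3))) ∅)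
      where
      n≡′ : n ≡ (3 * suc k′ + 1) * q + 3 * suc j + 1
      n≡′ = ≤-antisym (lin (n ∷ k′ ∷ q ∷ j ∷ ρ ∷ []) 0 (# 0
          ≼ (κ 3 :* (κ 1 :+ # 1) :+ κ 1) :* # 2 :+ κ 3 :* (κ 1 :+ # 3) :+ κ 1)
          (1 · # 0 ≼ # 4 :+ # 2 :* (κ 2 :+ # 1 :+ (κ 2 :+ # 1 :+ # 1)) by ≡⇒≤ n≡
           ⊹ 1 · # 4 ≼ κ 3 :* (κ 1 :+ # 3) :+ κ 1
               by ≡⇒≤ ρ≡)) (lin (k′ ∷ q ∷ j ∷ n ∷ ρ ∷ []) 0
                   ((κ 3 :* (κ 1 :+ # 0) :+ κ 1) :* # 1 :+ κ 3 :* (κ 1 :+ # 2) :+ κ 1 ≼ # 3)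
               (1 · # 4 :+ # 1 :* (κ 2 :+ # 0 :+ (κ 2 :+ # 0 :+ # 0)) ≼ # 3 by ≡⇒≥ n≡
                ⊹ 1 · κ 3 :* (κ 1 :+ # 2) :+ κ 1 ≼ # 4 by ≡⇒≥ ρ≡))

    1k<r : suc k′ < suc (suc k′) + (suc (suc k′) + k′)
    1k<r = lin (k′ ∷ []) 0 (κ 2 :+ # 0 ≼ κ 2 :+ # 0 :+ (κ 2 :+ # 0 :+ # 0)) ∅
    2k<r : suc k′ + suc k′ < suc (suc k′) + (suc (suc k′) + k′)
    2k<r = lin (k′ ∷ []) 0 (κ 2 :+ # 0 :+ (κ 1 :+ # 0) ≼ κ 2 :+ # 0 :+ (κ 2 :+ # 0 :+ # 0)) ∅
    3k<r : suc k′ + (suc k′ + suc k′) < suc (suc k′) + (suc (suc k′) + k′)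
    3k<r = lin (k′ ∷ []) 0 (κ 2 :+ # 0 :+ (κ 1 :+ # 0 :+ (κ 1 :+ # 0)) ≼ κ 2 :+ # 0 :+ (κ 2 :+ # 0 :+ # 0)) ∅

    floor₀ : ρ ≡ 0 → F ≡ k * q + 0
    floor₀ e = floor 0 {0} z<s (trans (cong (suc k′ *_) e) (*-zeroʳ (suc k′)))

    -- The remainder comes from k (3j + 1) = jr + (k - j). For ρ = 3j + 2 and ρ = 3j + 3 it is 2k -
    -- j and 3k - j.
    floor₁ : ∀ j → j ≤ k → ρ ≡ 3 * j + 1 → F ≡ k * q + j
    floor₁ j j≤k e = floor j {k ∸ j} (≤-<-trans (m∸n≤m k j) 1k<r)
      (≤-antisym (lin (k′ ∷ ρ ∷ k ∸ j ∷ j ∷ []) 0 ((κ 1 :+ # 0) :* # 1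
          ≼ # 2 :+ # 3 :* (κ 2 :+ # 0 :+ (κ 2 :+ # 0 :+ # 0)))
                    (1 · (κ 1 :+ # 0) :* # 1 ≼ (κ 1 :+ # 0) :* (κ 3 :* # 3 :+ κ 1) by scaleˡ (suc k′) (≡⇒≤ e)
                     ⊹ 1 · κ 1 :+ # 0 ≼ # 2 :+ # 3
                         by ≡⇒≥ l)) (lin (k ∸ j ∷ j ∷ k′ ∷ ρ ∷ []) 0
                             (# 0 :+ # 1 :* (κ 2 :+ # 2 :+ (κ 2 :+ # 2 :+ # 2)) ≼ (κ 1 :+ # 2) :* # 3)
                         (1 · (κ 1 :+ # 2) :* (κ 3 :* # 1 :+ κ 1) ≼ (κ 1 :+ # 2) :* # 3 by scaleˡ (suc k′) (≡⇒≥ e)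
                          ⊹ 1 · # 0 :+ # 1 ≼ κ 1 :+ # 2 by ≡⇒≤ l)))
      where
      l : k ∸ j + j ≡ suc k′
      l = m∸n+n≡m j≤k

    floor₂ : ∀ j → suc j ≤ k → ρ ≡ 3 * j + 2 → F ≡ k * q + j
    floor₂ j j<k e = floor j {k ∸ j + suc k′} (≤-<-trans (+-monoˡ-≤ k (m∸n≤m k j)) 2k<r)
      (≤-antisym (lin (k′ ∷ ρ ∷ k ∸ j ∷ j ∷ []) 0 ((κ 1 :+ # 0) :* # 1
          ≼ # 2 :+ (κ 1 :+ # 0) :+ # 3 :* (κ 2 :+ # 0 :+ (κ 2 :+ # 0 :+ # 0)))
                    (1 · (κ 1 :+ # 0) :* # 1 ≼ (κ 1 :+ # 0) :* (κ 3 :* # 3 :+ κ 2) by scaleˡ (suc k′) (≡⇒≤ e)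
                     ⊹ 1 · κ 1 :+ # 0 ≼ # 2 :+ # 3
                         by ≡⇒≥ l)) (lin (k ∸ j ∷ k′ ∷ j ∷ ρ ∷ []) 0
                             (# 0 :+ (κ 1 :+ # 1) :+ # 2 :* (κ 2 :+ # 1 :+ (κ 2 :+ # 1 :+ # 1))
                             ≼ (κ 1 :+ # 1) :* # 3)
                         (1 · (κ 1 :+ # 1) :* (κ 3 :* # 2 :+ κ 2) ≼ (κ 1 :+ # 1) :* # 3 by scaleˡ (suc k′) (≡⇒≥ e)
                          ⊹ 1 · # 0 :+ # 2 ≼ κ 1 :+ # 1 by ≡⇒≤ l)))
      where
      l : k ∸ j + j ≡ suc k′
      l = m∸n+n≡m (≤-trans (n≤1+n j) j<k)

    floor₃ : ∀ j → suc j ≤ k → ρ ≡ 3 * suc j → F ≡ k * q + j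
    floor₃ j j<k e = floor j {k ∸ j + (suc k′ + suc k′)} (≤-<-trans (+-monoˡ-≤ (k + k) (m∸n≤m k j)) 3k<r)
      (≤-antisym (lin (k′ ∷ ρ ∷ k ∸ j ∷ j ∷ []) 0 ((κ 1 :+ # 0) :* # 1
          ≼ # 2 :+ (κ 1 :+ # 0 :+ (κ 1 :+ # 0)) :+ # 3 :* (κ 2 :+ # 0 :+ (κ 2 :+ # 0 :+ # 0)))
                    (1 · (κ 1 :+ # 0) :* # 1 ≼ (κ 1 :+ # 0) :* (κ 3 :* (κ 1 :+ # 3)) by scaleˡ (suc k′) (≡⇒≤ e)
                     ⊹ 1 · κ 1 :+ # 0 ≼ # 2 :+ # 3
                         by ≡⇒≥ l)) (lin (k ∸ j ∷ k′ ∷ j ∷ ρ ∷ []) 0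
                             (# 0 :+ (κ 1 :+ # 1 :+ (κ 1 :+ # 1)) :+ # 2 :* (κ 2 :+ # 1 :+ (κ 2 :+ # 1 :+ # 1))
                             ≼ (κ 1 :+ # 1) :* # 3)
                         (1 · (κ 1 :+ # 1) :* (κ 3 :* (κ 1 :+ # 2)) ≼ (κ 1 :+ # 1) :* # 3 by scaleˡ (suc k′) (≡⇒≥ e)
                          ⊹ 1 · # 0 :+ # 2 ≼ κ 1 :+ # 1 by ≡⇒≤ l)))
      where
      l : k ∸ j + j ≡ suc k′
      l = m∸n+n≡m (≤-trans (n≤1+n j) j<k)

    at-floor : ∀ {g} → F ≡ k * q + g → Value (k * q + g) → Value F
    at-floor e = subst Value (sym e)

    -- Divisibility matters only for ρ = 3h + 1 with h positive. For ρ = 3j + 2 or 3j + 3 the floor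
    -- is kq + j and `unequal` reaches it; for ρ at most 1 the floor is kq.
    witness-floor : (∀ h → 1 ≤ h → h ≤ k′ → ρ ≡ 3 * h + 1 → suc q ∣ (k ∸ h)) → Value F
    witness-floor div = go (ρ % 3) (ρ / 3) (m%n<n ρ 3) (m≡m%n+[m/n]*n ρ 3)
      where
      uniform′ : Value (k * q + 0)
      uniform′ = subst Value (sym (+-identityʳ (k * q))) uniform

      three : ∀ {c} j → ρ ≡ c + j * 3 → ρ ≡ 3 * j + c
      three {c} j e = trans e (trans (+-comm c (j * 3)) (cong (_+ c) (*-comm j 3)))

      go : ∀ c j → c < 3 → ρ ≡ c + j * 3 → Value F
      go 0 zero _ e = at-floor (floor₀ e) uniform′
      go 0 (suc j) _ e = at-floor (floor₃ j j<k ρ≡) (unequal j (≤-trans (n≤1+n j) j<k) (lin (j ∷ ρ ∷ []) 0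
          (κ 3 :* # 0 :+ κ 2 ≼ # 1)
          (1 · κ 3 :* (κ 1 :+ # 0) ≼ # 1 by ≡⇒≥ ρ≡)))
        where
        ρ≡ : ρ ≡ 3 * suc j
        ρ≡ = trans (three (suc j) e) (+-identityʳ (3 * suc j))
        j<k : suc j ≤ suc k′
        j<k = lin (j ∷ k′ ∷ ρ ∷ []) 2 (κ 1 :+ # 0 ≼ κ 1 :+ # 1)
                (1 · κ 3 :* (κ 1 :+ # 0) ≼ # 2 by ≡⇒≥ ρ≡
                 ⊹ 1 · κ 1 :+ # 2 ≼ κ 2 :+ # 1 :+ (κ 2 :+ # 1 :+ # 1) by ρ<r)
      go 1 zero _ e = at-floor (floor₁ 0 z≤n e) uniform′
      go 1 (suc j) _ e = at-floor (floor₁ (suc j) (m≤n⇒m≤1+n j≤k′) ρ≡)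
                                  (few-cut (suc j) (m≤n⇒m≤1+n j≤k′) ρ≡ (div (suc j) (s≤s z≤n) j≤k′ ρ≡))
        where
        ρ≡ : ρ ≡ 3 * suc j + 1
        ρ≡ = three (suc j) e
        j≤k′ : suc j ≤ k′
        j≤k′ = lin (j ∷ k′ ∷ ρ ∷ []) 2 (κ 1 :+ # 0 ≼ # 1)
                 (1 · κ 3 :* (κ 1 :+ # 0) :+ κ 1 ≼ # 2 by ≡⇒≥ ρ≡
                  ⊹ 1 · κ 1 :+ # 2 ≼ κ 2 :+ # 1 :+ (κ 2 :+ # 1 :+ # 1) by ρ<r)
      go 2 j _ e = at-floor (floor₂ j j<k ρ≡) (unequal j (≤-trans (n≤1+n j) j<k) (≡⇒≥ ρ≡))
        where
        ρ≡ : ρ ≡ 3 * j + 2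
        ρ≡ = three j e
        j<k : suc j ≤ suc k′
        j<k = lin (j ∷ k′ ∷ ρ ∷ []) 2 (κ 1 :+ # 0 ≼ κ 1 :+ # 1)
                (1 · κ 3 :* # 0 :+ κ 2 ≼ # 2 by ≡⇒≥ ρ≡
                 ⊹ 1 · κ 1 :+ # 2 ≼ κ 2 :+ # 1 :+ (κ 2 :+ # 1 :+ # 1) by ρ<r)
      go (suc (suc (suc _))) _ (s≤s (s≤s (s≤s ()))) _

    simplify : ∀ h → suc k ∸ h ∸ 1 ≡ k ∸ h
    simplify h = trans (∸-+-assoc (suc k) h 1) (cong (suc k ∸_) (+-comm h 1))

  case₁ : f⟨ n , r , 4 ⟩≡ ((r ∸ 1) * n ∸ ⌈ suc k′ * (r ∸ 1) * n / r ⌉ ∸ η n r (suc k))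
  case₁ = decide (exceptional? n r (suc k))
    where
    answer : ∀ {d e} → η n r (suc k) ≡ e → 2 * (k * n) + F ∸ e ≡ d → Witness n r d → Bounded n r d →
      f⟨ n , r , 4 ⟩≡ ((r ∸ 1) * n ∸ ⌈ suc k′ * (r ∸ 1) * n / r ⌉ ∸ η n r (suc k))
    answer η≡ d≡ w b = subst (f⟨ n , r , 4 ⟩≡_) (sym (trans (cong₂ _∸_ value η≡) d≡)) (extremal w b)

    decide : Dec (Exceptional n r (suc k)) → _
    decide (yes e@(zero , () , _))
    decide (yes e@(suc j , 1≤h , h≤ , ρ≡ , ∤)) =
      -- One below the floor, `unequal` has room to spare: ρ = 3j + 4.
      answer (η-yes e) d≡ (unequal j (≤-trans (n≤1+n j) j<k) (bound ρ≡))
        (bounded-exceptional j j<k ρ≡ (λ d → ∤ (subst₂′ d)))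
      where
      j<k : suc j ≤ k
      j<k = m≤n⇒m≤1+n h≤
      bound : ρ ≡ 3 * suc j + 1 → 3 * j + 2 ≤ ρ
      bound eq = lin (j ∷ ρ ∷ []) 0 (κ 3 :* # 0 :+ κ 2 ≼ # 1) (1 · κ 3 :* (κ 1 :+ # 0) :+ κ 1 ≼ # 1 by ≡⇒≥ eq)
      subst₂′ : suc q ∣ (k ∸ suc j) → (n / r + 1) ∣ (suc k ∸ suc j ∸ 1)
      subst₂′ d = subst (_∣ (suc k ∸ suc j ∸ 1)) (+-comm 1 q) (subst (suc q ∣_) (sym (simplify (suc j))) d)
      d≡ : 2 * (k * n) + F ∸ 1 ≡ 2 * (k * n) + (k * q + j)
      d≡ = trans (cong (λ f → 2 * (k * n) + f ∸ 1) (trans (floor₁ (suc j) j<k ρ≡) (+-suc (k * q) j)))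
                 (cong (_∸ 1) (+-suc (2 * (k * n)) (k * q + j)))
    decide (no ¬e) = answer (η-no ¬e) refl (witness-floor div) bounded-floor
      where
      div : ∀ h → 1 ≤ h → h ≤ k′ → ρ ≡ 3 * h + 1 → suc q ∣ (k ∸ h)
      div h 1≤h h≤ ρ≡ with suc q ∣? (k ∸ h)
      ... | yes d = d
      ... | no ¬d = ⊥-elim (¬e (h , 1≤h , h≤ , ρ≡ , λ d →
        ¬d (subst (suc q ∣_) (simplify h) (subst (_∣ (suc k ∸ h ∸ 1)) (+-comm q 1) d))))

corollary5p3 : (n r : ℕ) .{{_ : NonZero r}} → 1 ≤ n → 4 ≤ r →
    (r ≡ 4 → f⟨ n , r , 4 ⟩≡ (3 * n ∸ ⌈ 2 * n / 3 ⌉))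
    × (6 ≤ r → r % 3 ≡ 0 → f⟨ n , r , 4 ⟩≡ ((2 * r) / 3 * n))
    × (r % 3 ≡ 2 → f⟨ n , r , 4 ⟩≡ ((r ∸ ⌈ r / 3 ⌉) * n))
    × ((m : ℕ) → 3 ≤ m → r ≡ 3 * m ∸ 2 →
        f⟨ n , r , 4 ⟩≡ ((r ∸ 1) * n ∸ ⌈ (m ∸ 1) * (r ∸ 1) * n / r ⌉ ∸ η n r m))
corollary5p3 n r 1≤n 4≤r = (λ { refl → case₄ n 1≤n }) , zero-mod , two-mod , one-mod
  where
  k = r / 3

  r≡ : r ≡ r % 3 + k * 3
  r≡ = m≡m%n+[m/n]*n r 3

  1≤k : r % 3 ≤ 2 → 1 ≤ k
  1≤k h = lin (k ∷ r ∷ r % 3 ∷ []) 2 (κ 1 ≼ # 0)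
            (1 · # 1 ≼ # 2 :+ # 0 :* κ 3 by ≡⇒≤ r≡ ⊹ 1 · # 2 ≼ κ 2 by h ⊹ 1 · κ 4 ≼ # 1 by 4≤r)

  zero-mod : 6 ≤ r → r % 3 ≡ 0 → f⟨ n , r , 4 ⟩≡ ((2 * r) / 3 * n)
  zero-mod _ e = subst (f⟨ n , r , 4 ⟩≡_) (sym d≡)
    (subst (λ r → f⟨ n , r , 4 ⟩≡ (2 * (k * n))) (sym r≡′) (case₀ k n (1≤k (≤-trans (≤-reflexive e) z≤n)) 1≤n))
    where
    r≡′ : r ≡ k + (k + k)
    r≡′ = ≤-antisym (lin (r ∷ k ∷ r % 3 ∷ []) 0 (# 0 ≼ # 1 :+ (# 1 :+ # 1))
                       (1 · # 0 ≼ # 2 :+ # 1 :* κ 3 by ≡⇒≤ r≡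
                        ⊹ 1 · # 2 ≼ κ 0 by ≡⇒≤ e)) (lin (k ∷ r ∷ r % 3 ∷ []) 0 (# 0 :+ (# 0 :+ # 0) ≼ # 1)
                           (1 · # 2 :+ # 0 :* κ 3 ≼ # 1 by ≡⇒≥ r≡))
    2r≡ : 2 * r ≡ 0 + 2 * k * 3
    2r≡ = ≤-antisym (lin (r ∷ k ∷ []) 0 (κ 2 :* # 0 ≼ κ 0 :+ κ 2 :* # 1 :* κ 3) (2 · # 0 ≼ # 1 :+ (# 1 :+ # 1)
        by ≡⇒≤ r≡′)) (lin (k ∷ r ∷ []) 0 (κ 0 :+ κ 2 :* # 0 :* κ 3 ≼ κ 2 :* # 1)
        (2 · # 0 :+ (# 0 :+ # 0) ≼ # 1 by ≡⇒≥ r≡′))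
    d≡ : (2 * r) / 3 * n ≡ 2 * (k * n)
    d≡ = trans (cong (_* n) (div-unique (2 * k) 3 z<s 2r≡)) (*-assoc 2 k n)

  two-mod : r % 3 ≡ 2 → f⟨ n , r , 4 ⟩≡ ((r ∸ ⌈ r / 3 ⌉) * n)
  two-mod e = subst (f⟨ n , r , 4 ⟩≡_) (sym d≡)
    (subst (λ r → f⟨ n , r , 4 ⟩≡ (2 * (k * n) + n)) (sym r≡′) (case₂ k n (1≤k (≤-reflexive e)) 1≤n))
    where
    r≡′ : r ≡ suc k + (suc k + k)
    r≡′ = ≤-antisym (lin (r ∷ k ∷ r % 3 ∷ []) 0 (# 0 ≼ κ 1 :+ # 1 :+ (κ 1 :+ # 1 :+ # 1))
                       (1 · # 0 ≼ # 2 :+ # 1 :* κ 3 by ≡⇒≤ r≡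
                        ⊹ 1 · # 2 ≼ κ 2
                            by ≡⇒≤ e)) (lin (k ∷ r ∷ r % 3 ∷ []) 0 (κ 1 :+ # 0 :+ (κ 1 :+ # 0 :+ # 0) ≼ # 1)
                           (1 · # 2 :+ # 0 :* κ 3 ≼ # 1 by ≡⇒≥ r≡
                            ⊹ 1 · κ 2 ≼ # 2 by ≡⇒≥ e))
    r+2≡ : r + 2 ≡ 1 + suc k * 3
    r+2≡ = ≤-antisym (lin (r ∷ k ∷ []) 0 (# 0 :+ κ 2 ≼ κ 1 :+ (κ 1 :+ # 1) :* κ 3)
                        (1 · # 0 ≼ κ 1 :+ # 1 :+ (κ 1 :+ # 1 :+ # 1)
                            by ≡⇒≤ r≡′)) (lin (k ∷ r ∷ []) 0 (κ 1 :+ (κ 1 :+ # 0) :* κ 3 ≼ # 1 :+ κ 2)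
                            (1 · κ 1 :+ # 0 :+ (κ 1 :+ # 0 :+ # 0) ≼ # 1 by ≡⇒≥ r≡′))
    r≡″ : r ≡ 2 * k + 1 + suc k
    r≡″ = ≤-antisym (lin (r ∷ k ∷ []) 0 (# 0 ≼ κ 2 :* # 1 :+ κ 1 :+ (κ 1 :+ # 1))
                       (1 · # 0 ≼ κ 1 :+ # 1 :+ (κ 1 :+ # 1 :+ # 1)
                           by ≡⇒≤ r≡′)) (lin (k ∷ r ∷ []) 0 (κ 2 :* # 0 :+ κ 1 :+ (κ 1 :+ # 0) ≼ # 1)
                           (1 · κ 1 :+ # 0 :+ (κ 1 :+ # 0 :+ # 0) ≼ # 1 by ≡⇒≥ r≡′))
    r∸ : r ∸ ⌈ r / 3 ⌉ ≡ 2 * k + 1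
    r∸ = trans (cong₂ _∸_ r≡″ (div-unique (suc k) 3 (s≤s (s≤s z≤n)) r+2≡)) (m+n∸n≡m (2 * k + 1) (suc k))
    expand : ∀ k n → (2 * k + 1) * n ≡ 2 * (k * n) + n
    expand = solve-∀
    d≡ : (r ∸ ⌈ r / 3 ⌉) * n ≡ 2 * (k * n) + n
    d≡ = trans (cong (_* n) r∸) (expand k n)

  one-mod : (m : ℕ) → 3 ≤ m → r ≡ 3 * m ∸ 2 →
            f⟨ n , r , 4 ⟩≡ ((r ∸ 1) * n ∸ ⌈ (m ∸ 1) * (r ∸ 1) * n / r ⌉ ∸ η n r m)
  -- Here m = k + 1 with k = k′ + 1; `r` is generalised in `go` so that its equation can be matched
  -- with `refl`.
  one-mod (suc (suc k′)) (s≤s (s≤s 1≤k′)) e = go r (trans e (trans (cong (_∸ 2) split) (m+n∸n≡m _ 2)))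
    where
    split : 3 * suc (suc k′) ≡ suc (suc k′) + (suc (suc k′) + k′) + 2
    split = solve (k′ ∷ [])
    go : ∀ r .{{_ : NonZero r}} → r ≡ suc (suc k′) + (suc (suc k′) + k′) →
      f⟨ n , r , 4 ⟩≡ ((r ∸ 1) * n ∸ ⌈ suc k′ * (r ∸ 1) * n / r ⌉ ∸ η n r (suc (suc k′)))
    go _ refl = Case₁.case₁ k′ n 1≤k′ 1≤n
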